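{- Each of the following sums is universal over $\mathbb{Z}$: $2p_5+4p_5+p_8+p_8$, $4p_5+p_8+p_8+p_8$, $2p_5+p_8+p_8+2p_8$, $p_8+p_8+p_8+2p_8$, $4p_5+p_8+2p_8+2p_8$, $p_8+2p_8+2p_8+2p_8$, $3p_4+p_5+2p_5+p_8$, $6p_3+p_5+2p_5+2p_5$, $3p_4+p_5+p_8+p_8$, $6p_3+p_5+2p_5+p_8$, $3p_4+2p_5+p_8+p_8$, $3p_4+p_8+p_8+p_8$, $6p_3+2p_5+2p_5+p_8$, $6p_3+2p_5+p_8+p_8$, $3p_3+p_5+p_5+4p_5$, $3p_3+p_5+p_5+2p_8$, $3p_3+3p_4+p_5+p_8$, $3p_3+6p_3+p_5+2p_5$, $3p_4+p_8+p_8+2p_8$, $6p_3+2p_5+p_8+2p_8$, $3p_3+p_5+4p_5+p_8$, $3p_3+p_5+p_8+2p_8$, $p_3+p_4+3p_4+p_8$, $p_3+6p_3+p_4+2p_5$, $p_3+2p_3+3p_4+p_8$, $p_3+6p_3+p_4+p_8$, $2p_5+4p_5+p_8+2p_8$, $4p_5+p_8+p_8+2p_8$, $2p_5+p_8+2p_8+2p_8$, $p_8+p_8+2p_8+2p_8$, $p_5+2p_5+4p_5+p_8$, $p_5+2p_5+p_8+2p_8$, $p_5+4p_5+p_8+p_8$, $p_5+p_8+p_8+2p_8$, $p_3+p_4+4p_5+p_8$, $p_3+p_4+p_8+2p_8$, $p_3+2p_3+2p_5+4p_5$, $p_3+2p_3+2p_5+2p_8$, $2p_3+2p_4+p_5+p_8$,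 $2p_3+4p_3+p_5+p_8$, $p_3+2p_5+4p_5+6p_5$, $p_3+2p_5+6p_5+2p_8$, $2p_5+4p_5+p_8+3p_8$, $4p_5+p_8+p_8+3p_8$, $2p_5+p_8+2p_8+3p_8$, $p_8+p_8+2p_8+3p_8$, $4p_5+p_8+2p_8+6p_8$, $p_8+2p_8+2p_8+6p_8$, $3p_4+p_8+p_8+3p_8$, $6p_3+2p_5+p_8+3p_8$, $3p_4+p_8+p_8+4p_8$, $6p_3+2p_5+p_8+4p_8$, $3p_3+p_5+4p_5+2p_8$, $3p_3+p_5+2p_8+2p_8$, $3p_4+p_8+p_8+5p_8$, $6p_3+2p_5+p_8+5p_8$, $3p_4+p_8+p_8+6p_8$, $6p_3+2p_5+p_8+6p_8$, $3p_3+p_5+4p_5+3p_8$, $3p_3+p_5+2p_8+3p_8$, $4p_5+p_8+2p_8+3p_8$, $p_8+2p_8+2p_8+3p_8$, $4p_5+p_8+2p_8+5p_8$, $p_8+2p_8+2p_8+5p_8$, $2p_3+2p_4+p_8+3p_8$, $2p_3+4p_3+p_8+3p_8$.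
   Context: For an integer $m\ge 3$ and $x\in\mathbb{Z}$, the generalized $m$-gonal number is $p_m(x)=\frac{(m-2)x^2-(m-4)x}{2}$; thus $p_3(x)=x(x+1)/2$, $p_4(x)=x^2$, $p_5(x)=x(3x-1)/2$, $p_8(x)=x(3x-2)$. For positive integers $a,b,c,d$ and $r,s,t,u\in\{3,4,5,8\}$, the notation $ap_r+bp_s+cp_t+dp_u$ denotes the function $(h,l,m,n)\mapsto ap_r(h)+bp_s(l)+cp_t(m)+dp_u(n)$ on $\mathbb{Z}^4$ (four independent integer variables). Such a sum is called universal over $\mathbb{Z}$ if its set of values on $\mathbb{Z}^4$ equals $\mathbb{N}_0=\{0,1,2,\dots\}$, i.e. every nonnegative integer is represented. -}

module Defs where

open import Data.Nat using (ℕ)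
open import Data.Integer using (ℤ; +_; _+_; _*_; _-_; _≤_)
open import Data.Integer.DivMod using (_/ℕ_)
open import Data.Product using (_×_; _,_; ∃; ∃-syntax)
open import Data.Vec using (Vec; _∷_; [])
open import Data.List using (List; _∷_; [])
open import Relation.Binary.PropositionalEquality using (_≡_)

-- generalized m-gonal number p_m(x) = ((m-2)x^2 - (m-4)x)/2  (numerator always even)
p : ℕ → ℤ → ℤ
p m x = ((+ m - + 2) * (x * x) - (+ m - + 4) * x) /ℕ 2

Form : Set
Form = Vec (ℕ × ℕ) 4

eval : Form → ℤ → ℤ → ℤ → ℤ → ℤ
eval ((a , r) ∷ (b , s) ∷ (c , t) ∷ (d , u) ∷ []) h l m n =
  + a * p r h + + b * p s l + + c * p t m + + d * p u n

Universal : Form → Set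
Universal F =
  (∀ h l m n → + 0 ≤ eval F h l m n) ×
  (∀ (N : ℕ) → ∃[ h ] ∃[ l ] ∃[ m ] ∃[ n ] eval F h l m n ≡ + N)

theorem3p1-forms : List Form
theorem3p1-forms =
  ( (2 , 5) ∷ (4 , 5) ∷ (1 , 8) ∷ (1 , 8) ∷ [] ) ∷
  ( (4 , 5) ∷ (1 , 8) ∷ (1 , 8) ∷ (1 , 8) ∷ [] ) ∷
  ( (2 , 5) ∷ (1 , 8) ∷ (1 , 8) ∷ (2 , 8) ∷ [] ) ∷
  ( (1 , 8) ∷ (1 , 8) ∷ (1 , 8) ∷ (2 , 8) ∷ [] ) ∷
  ( (4 , 5) ∷ (1 , 8) ∷ (2 , 8) ∷ (2 , 8) ∷ [] ) ∷
  ( (1 , 8) ∷ (2 , 8) ∷ (2 , 8) ∷ (2 , 8) ∷ [] ) ∷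
  ( (3 , 4) ∷ (1 , 5) ∷ (2 , 5) ∷ (1 , 8) ∷ [] ) ∷
  ( (6 , 3) ∷ (1 , 5) ∷ (2 , 5) ∷ (2 , 5) ∷ [] ) ∷
  ( (3 , 4) ∷ (1 , 5) ∷ (1 , 8) ∷ (1 , 8) ∷ [] ) ∷
  ( (6 , 3) ∷ (1 , 5) ∷ (2 , 5) ∷ (1 , 8) ∷ [] ) ∷
  ( (3 , 4) ∷ (2 , 5) ∷ (1 , 8) ∷ (1 , 8) ∷ [] ) ∷
  ( (3 , 4) ∷ (1 , 8) ∷ (1 , 8) ∷ (1 , 8) ∷ [] ) ∷
  ( (6 , 3) ∷ (2 , 5) ∷ (2 , 5) ∷ (1 , 8) ∷ [] ) ∷
  ( (6 , 3) ∷ (2 , 5) ∷ (1 , 8) ∷ (1 , 8) ∷ [] ) ∷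
  ( (3 , 3) ∷ (1 , 5) ∷ (1 , 5) ∷ (4 , 5) ∷ [] ) ∷
  ( (3 , 3) ∷ (1 , 5) ∷ (1 , 5) ∷ (2 , 8) ∷ [] ) ∷
  ( (3 , 3) ∷ (3 , 4) ∷ (1 , 5) ∷ (1 , 8) ∷ [] ) ∷
  ( (3 , 3) ∷ (6 , 3) ∷ (1 , 5) ∷ (2 , 5) ∷ [] ) ∷
  ( (3 , 4) ∷ (1 , 8) ∷ (1 , 8) ∷ (2 , 8) ∷ [] ) ∷
  ( (6 , 3) ∷ (2 , 5) ∷ (1 , 8) ∷ (2 , 8) ∷ [] ) ∷
  ( (3 , 3) ∷ (1 , 5) ∷ (4 , 5) ∷ (1 , 8) ∷ [] ) ∷
  ( (3 , 3) ∷ (1 , 5) ∷ (1 , 8) ∷ (2 , 8) ∷ [] ) ∷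
  ( (1 , 3) ∷ (1 , 4) ∷ (3 , 4) ∷ (1 , 8) ∷ [] ) ∷
  ( (1 , 3) ∷ (6 , 3) ∷ (1 , 4) ∷ (2 , 5) ∷ [] ) ∷
  ( (1 , 3) ∷ (2 , 3) ∷ (3 , 4) ∷ (1 , 8) ∷ [] ) ∷
  ( (1 , 3) ∷ (6 , 3) ∷ (1 , 4) ∷ (1 , 8) ∷ [] ) ∷
  ( (2 , 5) ∷ (4 , 5) ∷ (1 , 8) ∷ (2 , 8) ∷ [] ) ∷
  ( (4 , 5) ∷ (1 , 8) ∷ (1 , 8) ∷ (2 , 8) ∷ [] ) ∷
  ( (2 , 5) ∷ (1 , 8) ∷ (2 , 8) ∷ (2 , 8) ∷ [] ) ∷
  ( (1 , 8) ∷ (1 , 8) ∷ (2 , 8) ∷ (2 , 8) ∷ [] ) ∷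
  ( (1 , 5) ∷ (2 , 5) ∷ (4 , 5) ∷ (1 , 8) ∷ [] ) ∷
  ( (1 , 5) ∷ (2 , 5) ∷ (1 , 8) ∷ (2 , 8) ∷ [] ) ∷
  ( (1 , 5) ∷ (4 , 5) ∷ (1 , 8) ∷ (1 , 8) ∷ [] ) ∷
  ( (1 , 5) ∷ (1 , 8) ∷ (1 , 8) ∷ (2 , 8) ∷ [] ) ∷
  ( (1 , 3) ∷ (1 , 4) ∷ (4 , 5) ∷ (1 , 8) ∷ [] ) ∷
  ( (1 , 3) ∷ (1 , 4) ∷ (1 , 8) ∷ (2 , 8) ∷ [] ) ∷
  ( (1 , 3) ∷ (2 , 3) ∷ (2 , 5) ∷ (4 , 5) ∷ [] ) ∷
  ( (1 , 3) ∷ (2 , 3) ∷ (2 , 5) ∷ (2 , 8) ∷ [] ) ∷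
  ( (2 , 3) ∷ (2 , 4) ∷ (1 , 5) ∷ (1 , 8) ∷ [] ) ∷
  ( (2 , 3) ∷ (4 , 3) ∷ (1 , 5) ∷ (1 , 8) ∷ [] ) ∷
  ( (1 , 3) ∷ (2 , 5) ∷ (4 , 5) ∷ (6 , 5) ∷ [] ) ∷
  ( (1 , 3) ∷ (2 , 5) ∷ (6 , 5) ∷ (2 , 8) ∷ [] ) ∷
  ( (2 , 5) ∷ (4 , 5) ∷ (1 , 8) ∷ (3 , 8) ∷ [] ) ∷
  ( (4 , 5) ∷ (1 , 8) ∷ (1 , 8) ∷ (3 , 8) ∷ [] ) ∷
  ( (2 , 5) ∷ (1 , 8) ∷ (2 , 8) ∷ (3 , 8) ∷ [] ) ∷
  ( (1 , 8) ∷ (1 , 8) ∷ (2 , 8) ∷ (3 , 8) ∷ [] ) ∷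
  ( (4 , 5) ∷ (1 , 8) ∷ (2 , 8) ∷ (6 , 8) ∷ [] ) ∷
  ( (1 , 8) ∷ (2 , 8) ∷ (2 , 8) ∷ (6 , 8) ∷ [] ) ∷
  ( (3 , 4) ∷ (1 , 8) ∷ (1 , 8) ∷ (3 , 8) ∷ [] ) ∷
  ( (6 , 3) ∷ (2 , 5) ∷ (1 , 8) ∷ (3 , 8) ∷ [] ) ∷
  ( (3 , 4) ∷ (1 , 8) ∷ (1 , 8) ∷ (4 , 8) ∷ [] ) ∷
  ( (6 , 3) ∷ (2 , 5) ∷ (1 , 8) ∷ (4 , 8) ∷ [] ) ∷
  ( (3 , 3) ∷ (1 , 5) ∷ (4 , 5) ∷ (2 , 8) ∷ [] ) ∷
  ( (3 , 3) ∷ (1 , 5) ∷ (2 , 8) ∷ (2 , 8) ∷ [] ) ∷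
  ( (3 , 4) ∷ (1 , 8) ∷ (1 , 8) ∷ (5 , 8) ∷ [] ) ∷
  ( (6 , 3) ∷ (2 , 5) ∷ (1 , 8) ∷ (5 , 8) ∷ [] ) ∷
  ( (3 , 4) ∷ (1 , 8) ∷ (1 , 8) ∷ (6 , 8) ∷ [] ) ∷
  ( (6 , 3) ∷ (2 , 5) ∷ (1 , 8) ∷ (6 , 8) ∷ [] ) ∷
  ( (3 , 3) ∷ (1 , 5) ∷ (4 , 5) ∷ (3 , 8) ∷ [] ) ∷
  ( (3 , 3) ∷ (1 , 5) ∷ (2 , 8) ∷ (3 , 8) ∷ [] ) ∷
  ( (4 , 5) ∷ (1 , 8) ∷ (2 , 8) ∷ (3 , 8) ∷ [] ) ∷
  ( (1 , 8) ∷ (2 , 8) ∷ (2 , 8) ∷ (3 , 8) ∷ [] ) ∷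
  ( (4 , 5) ∷ (1 , 8) ∷ (2 , 8) ∷ (5 , 8) ∷ [] ) ∷
  ( (1 , 8) ∷ (2 , 8) ∷ (2 , 8) ∷ (5 , 8) ∷ [] ) ∷
  ( (2 , 3) ∷ (2 , 4) ∷ (1 , 8) ∷ (3 , 8) ∷ [] ) ∷
  ( (2 , 3) ∷ (4 , 3) ∷ (1 , 8) ∷ (3 , 8) ∷ [] ) ∷
  []

-- Completing squares turns each sum into the representation of an arithmetic progression by a diagonal quaternary form in
-- variables prime to 3, and for suitable values of one or two variables the remaining form is equivalent, over these
-- progressions, to a sum of three squares n ≡ 1 or 2 (mod 4). Such n are sums of three squares by an identity of series:
-- with ψ = Σ q^((4p+1)²), θ = Σ q^((2t)²) and E = Σ σ(n) qⁿ over odd n, Liouville's method gives a recurrence determining E,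
-- whence E(q²) = ψ²θ²; it also shows ψ C = E(q²) = θ Y for two series C, Y that count certain binary quadratic forms.
-- So ψθ² = C and ψ²θ = Y, and these have positive coefficients at all n ≡ 1, respectively n ≡ 2 (mod 4). Rotations with
-- denominator 3 finally make the variables prime to 3.

module Submission where

open import Defs
open import Data.Nat as ℕ using (ℕ; zero; suc; z≤n; s≤s)
import Data.Nat.Properties as ℕₚ
open import Data.Integer using (ℤ; +_; -[1+_]; _+_; _*_; _-_; -_; ∣_∣; 0ℤ; 1ℤ; -1ℤ; _≤_; +≤+)
import Data.Integer.Properties as ℤₚ
open import Data.Integer.Tactic.RingSolver using (solve-∀)
open import Data.Product using (_×_; _,_; proj₁; proj₂; ∃; ∃-syntax; Σ-syntax)
open import Data.Sum using (_⊎_; inj₁; inj₂; [_,_]′)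
open import Data.Sum.Properties using (inj₁-injective; inj₂-injective)
open import Data.Product.Properties using (,-injectiveʳ; ≡-dec)
open import Data.Empty using (⊥; ⊥-elim)
open import Data.List using (List; []; _∷_; _++_; map; foldr; filter; upTo; cartesianProduct; length)
open import Data.List.Properties using (length-upTo)
open import Data.List.Membership.Propositional using (_∈_)
open import Data.List.Membership.Propositional.Properties
open import Data.List.Membership.Propositional.Properties.WithK using (unique∧set⇒bag)
open import Data.List.Relation.Unary.Any using (here; there)
open import Data.List.Relation.Unary.All as All using (All; []; _∷_)
open import Data.List.Relation.Unary.AllPairs using ([]; _∷_)
open import Data.List.Relation.Unary.Unique.Propositional using (Unique)
import Data.List.Relation.Unary.Unique.Propositional.Properties as Unique
open import Data.List.Relation.Binary.BagAndSetEquality using (∼bag⇒↭)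
open import Data.List.Relation.Binary.Permutation.Propositional using (_↭_)
open import Data.List.Relation.Binary.Permutation.Propositional.Properties using (map⁺)
open import Function using (_∘_; id; mk⇔; case_of_)
open import Relation.Nullary using (¬_; yes; no)
open import Relation.Binary.PropositionalEquality
open import Data.Unit using (⊤; tt)
open import Level using (0ℓ)
open import Algebra.Bundles using (CommutativeRing)
import Algebra.Solver.Ring.NaturalCoefficients.Default as Solver
open import Data.Nat.Induction using (<-rec)
open import Data.Nat.Divisibility using (_∣?_; divides)
open import Data.Integer.DivMod using (_%ℕ_; _/ℕ_; n%ℕd<d; a≡a%ℕn+[a/ℕn]*n)
open import Relation.Nullary.Decidable using (False; toWitnessFalse)
open import Data.Bool using (T)
open import Data.Fin using (Fin; zero; suc; toℕ)
open import Data.Vec using ([]; _∷_)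
open import Data.Maybe as Maybe using (Maybe; just; nothing; is-just; _>>=_)
open import Data.Nat.DivMod using (_divMod_; result)
open import Algebra.Properties.AbelianGroup ℤₚ.+-0-abelianGroup using (∙-cancelˡ)

open ≡-Reasoning

-- No class number is ever evaluated: one explicit form of determinant n already makes the
-- coefficient of `ψθ²` or `ψ²θ` at n nonzero. The products with the series of forms are tractable
-- because w² + (ac - b²) = e² + 2eb + ac for e = w - b. In the variable e, the bounds on b say that
-- one summation variable stays below a multiple of another. Subtracting that multiple maps the
-- excluded terms onto a second class, and the difference of the two classes is E(q²). The classes
-- occur with a weak and with a strict boundary (`id` and `suc`) because their diagonal terms then
-- have multiplicities y + 1 and y, whose sum is the divisor 2y + 1. Three squares alone do not
-- suffice: pentagonal and octagonal numbers come from squares of 6x - 1 and 3x - 1, so the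
-- variables have to be prime to 3. Sign changes make x + y + z prime to 3 unless all variables are
-- multiples of 3, and the rotations are chosen so that every new coordinate is ±(x + y + z) modulo
-- 3.

-- Enumerated finite sums

sumOf : {A : Set} → (A → ℤ) → List A → ℤ
sumOf v = foldr (λ x s → v x + s) 0ℤ

sumOf-map : {A B : Set} (v : B → ℤ) (f : A → B) (xs : List A) → sumOf v (map f xs) ≡ sumOf (v ∘ f) xs
sumOf-map v f []       = refl
sumOf-map v f (x ∷ xs) = cong (_+_ (v (f x))) (sumOf-map v f xs)

sumOf-++ : {A : Set} (v : A → ℤ) (xs ys : List A) → sumOf v (xs ++ ys) ≡ sumOf v xs + sumOf v ys
sumOf-++ v []       ys = sym (ℤₚ.+-identityˡ _)
sumOf-++ v (x ∷ xs) ys = trans (cong (_+_ (v x)) (sumOf-++ v xs ys)) (sym (ℤₚ.+-assoc (v x) _ _))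

sumOf-cong : {A : Set} (v u : A → ℤ) (xs : List A) → (∀ {x} → x ∈ xs → v x ≡ u x) → sumOf v xs ≡ sumOf u xs
sumOf-cong v u []       e = refl
sumOf-cong v u (x ∷ xs) e = cong₂ _+_ (e (here refl)) (sumOf-cong v u xs (e ∘ there))

sumOf-↭ : {A : Set} (v : A → ℤ) {xs ys : List A} → xs ↭ ys → sumOf v xs ≡ sumOf v ys
sumOf-↭ v _↭_.refl = refl
sumOf-↭ v (_↭_.prep x p) = cong (_+_ (v x)) (sumOf-↭ v p)
sumOf-↭ v {x ∷ y ∷ xs} (_↭_.swap x y p) = trans (cong (λ t → v x + (v y + t)) (sumOf-↭ v p)) (lem (v x) (v y) _)
  where
  lem : ∀ a b c → a + (b + c) ≡ b + (a + c)
  lem = solve-∀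
sumOf-↭ v (_↭_.trans p q) = trans (sumOf-↭ v p) (sumOf-↭ v q)

sumOf-+ : {A : Set} (v u : A → ℤ) (xs : List A) → sumOf (λ x → v x + u x) xs ≡ sumOf v xs + sumOf u xs
sumOf-+ v u []       = refl
sumOf-+ v u (x ∷ xs) = trans (cong (_+_ (v x + u x)) (sumOf-+ v u xs)) (lem (v x) (u x) _ _)
  where
  lem : ∀ a b c d → a + b + (c + d) ≡ a + c + (b + d)
  lem = solve-∀

sumOf-scale : {A : Set} (c : ℤ) (v : A → ℤ) (xs : List A) → sumOf (λ x → c * v x) xs ≡ c * sumOf v xs
sumOf-scale c v []       = sym (ℤₚ.*-zeroʳ c)
sumOf-scale c v (x ∷ xs) = trans (cong (_+_ (c * v x)) (sumOf-scale c v xs)) (sym (ℤₚ.*-distribˡ-+ c (v x) _))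

-- `P` need not be decidable. A sum over it is certified by a complete list without repetitions, so
-- its value does not depend on how the list was found.
record Enum {A : Set} (P : A → Set) (v : A → ℤ) (s : ℤ) : Set where
  constructor mkEnum
  field
    elems    : List A
    unique   : Unique elems
    sound    : ∀ {x} → x ∈ elems → P x
    complete : ∀ {x} → P x → x ∈ elems
    total    : sumOf v elems ≡ s

open Enum

enum-count : {A : Set} {P : A → Set} {s : ℤ} → Enum P (λ _ → 1ℤ) s → Σ[ n ∈ ℕ ] s ≡ + n
enum-count {A} (mkEnum xs _ _ _ t) = let n , e = count xs in n , trans (sym t) e
  where
  count : (ys : List A) → Σ[ n ∈ ℕ ] sumOf (λ _ → 1ℤ) ys ≡ + n
  count []       = 0 , refl
  count (y ∷ ys) = let n , e = count ys in suc n , cong (_+_ 1ℤ) e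

module _ {A : Set} {P : A → Set} where

  -- Two complete lists without repetitions have the same members, hence are permutations of each
  -- other.
  enum-det : ∀ {v s t} → Enum P v s → Enum P v t → s ≡ t
  enum-det {v} p q = trans (sym (total p)) (trans (sumOf-↭ v (∼bag⇒↭ (unique∧set⇒bag (unique p) (unique q)
    (mk⇔ (complete q ∘ sound p) (complete p ∘ sound q))))) (total q))

  enum-empty : ∀ {v s} → (∀ x → ¬ P x) → Enum P v s → s ≡ 0ℤ
  enum-empty ne (mkEnum [] _ _ _ t) = sym t
  enum-empty ne (mkEnum (x ∷ _) _ so _ _) = ⊥-elim (ne x (so (here refl)))

  enum-nonempty : ∀ {v s} → s ≢ 0ℤ → Enum P v s → ∃ P
  enum-nonempty ne (mkEnum [] _ _ _ t) = ⊥-elim (ne (sym t))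
  enum-nonempty ne (mkEnum (x ∷ _) _ so _ _) = x , so (here refl)

  enum-+ : ∀ {v u s t} → Enum P v s → Enum P u t → Enum P (λ x → v x + u x) (s + t)
  enum-+ {v} {u} {s} {t} p q = mkEnum (elems p) (unique p) (sound p) (complete p)
    (trans (sumOf-+ v u (elems p)) (cong₂ _+_ (total p)
      (enum-det (mkEnum (elems p) (unique p) (sound p) (complete p) refl) q)))

  enum-scale : ∀ {v s} c → Enum P v s → Enum P (λ x → c * v x) (c * s)
  enum-scale {v} c p = mkEnum (elems p) (unique p) (sound p) (complete p)
    (trans (sumOf-scale c v (elems p)) (cong (c *_) (total p)))

  enum-weight : ∀ {v s} (u : A → ℤ) → Enum P v s → ∃[ t ] Enum P u t
  enum-weight u p = _ , mkEnum (elems p) (unique p) (sound p) (complete p) refl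

  enum-cast : ∀ {v s t} → s ≡ t → Enum P v s → Enum P v t
  enum-cast refl p = p

  enum-count>0 : ∀ {s x} → P x → Enum P (λ _ → 1ℤ) s → s ≢ 0ℤ
  enum-count>0 px (mkEnum [] _ _ co _) with () ← co px
  enum-count>0 px (mkEnum (x ∷ xs) (_ ∷ u) _ _ t) s≡0 = nz (enum-count (mkEnum {P = _∈ xs} xs u id id refl)) (trans t s≡0)
    where
    nz : ∀ {z} → Σ[ n ∈ ℕ ] z ≡ + n → 1ℤ + z ≢ 0ℤ
    nz (n , refl) ()

unique-map : {A B : Set} (f : A → B) (xs : List A) → (∀ {x y} → x ∈ xs → y ∈ xs → f x ≡ f y → x ≡ y) → Unique xs → Unique (map f xs)
unique-map f [] inj u = []
unique-map f (x ∷ xs) inj (x∉ ∷ u) = All.tabulate (λ {y} y∈ fx≡y → case y∈ fx≡y) ∷ unique-map f xs (λ p q → inj (there p) (there q)) u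
  where
  case : ∀ {y} → y ∈ map f xs → f x ≡ y → ⊥
  case y∈ e with z , z∈ , refl ← ∈-map⁻ f y∈ = All.lookup x∉ z∈ (inj (here refl) (there z∈) e)

module _ {A B : Set} {P : A → Set} {Q : B → Set} where

  -- The maps have to be inverse only on `P` and `Q`, so formulas on the ambient types are enough.
  enum-↔ : ∀ {v u s} (to : A → B) (from : B → A) →
    (∀ {x} → P x → Q (to x)) → (∀ {y} → Q y → P (from y)) →
    (∀ {x} → P x → from (to x) ≡ x) → (∀ {y} → Q y → to (from y) ≡ y) →
    (∀ {x} → P x → u (to x) ≡ v x) → Enum P v s → Enum Q u s
  enum-↔ {v} {u} to from pq qp ft tf w p = record
    { elems    = map to (elems p)
    ; unique   = unique-map to (elems p)
        (λ x∈ y∈ e → trans (sym (ft (sound p x∈))) (trans (cong from e) (ft (sound p y∈)))) (unique p)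
    ; sound    = λ y∈ → let x , x∈ , e = ∈-map⁻ to y∈ in subst Q (sym e) (pq (sound p x∈))
    ; complete = λ {y} qy → subst (_∈ map to (elems p)) (tf qy) (∈-map⁺ to (complete p (qp qy)))
    ; total    = trans (sumOf-map u to (elems p)) (trans (sumOf-cong _ v (elems p) (w ∘ sound p)) (total p))
    }

  enum-⊎ : ∀ {v u s t} → Enum P v s → Enum Q u t → Enum [ P , Q ]′ [ v , u ]′ (s + t)
  enum-⊎ {v} {u} p q = record
    { elems    = map inj₁ (elems p) ++ map inj₂ (elems q)
    ; unique   = Unique.++⁺ (Unique.map⁺ inj₁-injective (unique p)) (Unique.map⁺ inj₂-injective (unique q)) disj
    ; sound    = λ x∈ → snd (∈-++⁻ (map inj₁ (elems p)) x∈)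
    ; complete = λ { {inj₁ x} px → ∈-++⁺ˡ (∈-map⁺ inj₁ (complete p px))
                   ; {inj₂ y} qy → ∈-++⁺ʳ _ (∈-map⁺ inj₂ (complete q qy)) }
    ; total    = trans (sumOf-++ [ v , u ]′ (map inj₁ (elems p)) _)
        (cong₂ _+_ (trans (sumOf-map [ v , u ]′ inj₁ (elems p)) (total p))
                   (trans (sumOf-map [ v , u ]′ inj₂ (elems q)) (total q)))
    }
    where
    disj : ∀ {x} → x ∈ map inj₁ (elems p) × x ∈ map inj₂ (elems q) → ⊥
    disj (a , b) with ∈-map⁻ inj₁ a | ∈-map⁻ inj₂ b
    ... | _ , _ , refl | _ , _ , ()
    snd : ∀ {x} → x ∈ map inj₁ (elems p) ⊎ x ∈ map inj₂ (elems q) → [ P , Q ]′ x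
    snd (inj₁ a) with y , y∈ , refl ← ∈-map⁻ inj₁ a = sound p y∈
    snd (inj₂ b) with y , y∈ , refl ← ∈-map⁻ inj₂ b = sound q y∈

module _ {A B : Set} where

  lefts : List (A ⊎ B) → List A
  lefts []            = []
  lefts (inj₁ x ∷ xs) = x ∷ lefts xs
  lefts (inj₂ _ ∷ xs) = lefts xs

  rights : List (A ⊎ B) → List B
  rights []            = []
  rights (inj₁ _ ∷ xs) = rights xs
  rights (inj₂ y ∷ xs) = y ∷ rights xs

  ∈-lefts⁺ : ∀ {x xs} → inj₁ x ∈ xs → x ∈ lefts xs
  ∈-lefts⁺ {xs = inj₁ _ ∷ _} (here refl) = here refl
  ∈-lefts⁺ {xs = inj₁ _ ∷ _} (there p)   = there (∈-lefts⁺ p)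
  ∈-lefts⁺ {xs = inj₂ _ ∷ _} (there p)   = ∈-lefts⁺ p

  ∈-lefts⁻ : ∀ {x} xs → x ∈ lefts xs → inj₁ x ∈ xs
  ∈-lefts⁻ (inj₁ _ ∷ xs) (here refl) = here refl
  ∈-lefts⁻ (inj₁ _ ∷ xs) (there p)   = there (∈-lefts⁻ xs p)
  ∈-lefts⁻ (inj₂ _ ∷ xs) p           = there (∈-lefts⁻ xs p)

  ∈-rights⁺ : ∀ {x xs} → inj₂ x ∈ xs → x ∈ rights xs
  ∈-rights⁺ {xs = inj₂ _ ∷ _} (here refl) = here refl
  ∈-rights⁺ {xs = inj₂ _ ∷ _} (there p)   = there (∈-rights⁺ p)
  ∈-rights⁺ {xs = inj₁ _ ∷ _} (there p)   = ∈-rights⁺ p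

  ∈-rights⁻ : ∀ {x} xs → x ∈ rights xs → inj₂ x ∈ xs
  ∈-rights⁻ (inj₂ _ ∷ xs) (here refl) = here refl
  ∈-rights⁻ (inj₂ _ ∷ xs) (there p)   = there (∈-rights⁻ xs p)
  ∈-rights⁻ (inj₁ _ ∷ xs) p           = there (∈-rights⁻ xs p)

  lefts-unique : ∀ {xs} → Unique xs → Unique (lefts xs)
  lefts-unique {[]}          u        = []
  lefts-unique {inj₁ x ∷ xs} (x∉ ∷ u) = All.tabulate (λ y∈ e → All.lookup x∉ (∈-lefts⁻ xs y∈) (cong inj₁ e)) ∷ lefts-unique u
  lefts-unique {inj₂ _ ∷ xs} (x∉ ∷ u) = lefts-unique u

  rights-unique : ∀ {xs} → Unique xs → Unique (rights xs)
  rights-unique {[]}          u        = []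
  rights-unique {inj₂ x ∷ xs} (x∉ ∷ u) = All.tabulate (λ y∈ e → All.lookup x∉ (∈-rights⁻ xs y∈) (cong inj₂ e)) ∷ rights-unique u
  rights-unique {inj₁ _ ∷ xs} (x∉ ∷ u) = rights-unique u

  enum-lefts : ∀ {R : A ⊎ B → Set} {v s} → Enum R v s → ∃[ t ] Enum (R ∘ inj₁) (v ∘ inj₁) t
  enum-lefts p = _ , mkEnum (lefts (elems p)) (lefts-unique (unique p))
    (sound p ∘ ∈-lefts⁻ (elems p)) (∈-lefts⁺ ∘ complete p) refl

  enum-rights : ∀ {R : A ⊎ B → Set} {v s} → Enum R v s → ∃[ t ] Enum (R ∘ inj₂) (v ∘ inj₂) t
  enum-rights p = _ , mkEnum (rights (elems p)) (rights-unique (unique p))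
    (sound p ∘ ∈-rights⁻ (elems p)) (∈-rights⁺ ∘ complete p) refl

  -- Fubini: the weight of a is the sum over its fibre.
  enum-Σ : ∀ {P : A → Set} {Q : A → B → Set} {u : A → ℤ} {v : A × B → ℤ} {s} →
    (∀ a → P a → Enum (Q a) (λ b → v (a , b)) (u a)) → Enum P u s →
    Enum (λ ab → P (proj₁ ab) × Q (proj₁ ab) (proj₂ ab)) v s
  enum-Σ {P} {Q} {u} {v} fib p = record
    { elems    = proj₁ r
    ; unique   = unique (proj₂ r)
    ; sound    = λ x∈ → let a∈ , q = sound (proj₂ r) x∈ in sound p a∈ , q
    ; complete = λ { (pa , q) → complete (proj₂ r) (complete p pa , q) }
    ; total    = trans (total (proj₂ r)) (total p)
    }
    where
    go : ∀ xs → Unique xs → (∀ {a} → a ∈ xs → P a) →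
      Enum (λ ab → proj₁ ab ∈ xs × Q (proj₁ ab) (proj₂ ab)) v (sumOf u xs)
    go [] _ _ = mkEnum [] [] (λ ()) (λ ()) refl
    go (a ∷ xs) (a∉ ∷ un) pa = record
      { elems    = map (a ,_) (elems f) ++ elems rest
      ; unique   = Unique.++⁺ (Unique.map⁺ ,-injectiveʳ (unique f)) (unique rest) disj
      ; sound    = λ x∈ → snd (∈-++⁻ (map (a ,_) (elems f)) x∈)
      ; complete = λ { (here refl , q) → ∈-++⁺ˡ (∈-map⁺ (a ,_) (complete f q))
                     ; (there a∈ , q) → ∈-++⁺ʳ _ (complete rest (a∈ , q)) }
      ; total    = trans (sumOf-++ v (map (a ,_) (elems f)) _)
          (cong₂ _+_ (trans (sumOf-map v (a ,_) (elems f)) (total f)) (total rest))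
      }
      where
      f    = fib a (pa (here refl))
      rest = go xs un (pa ∘ there)
      disj : ∀ {x} → x ∈ map (a ,_) (elems f) × x ∈ elems rest → ⊥
      disj (l , r) with _ , _ , refl ← ∈-map⁻ (a ,_) l = All.lookup a∉ (proj₁ (sound rest r)) refl
      snd : ∀ {x} → x ∈ map (a ,_) (elems f) ⊎ x ∈ elems rest → (proj₁ x ∈ a ∷ xs) × Q (proj₁ x) (proj₂ x)
      snd (inj₁ l) with _ , b∈ , refl ← ∈-map⁻ (a ,_) l = here refl , sound f b∈
      snd (inj₂ r) = let a∈ , q = sound rest r in there a∈ , q
    r = elems (go (elems p) (unique p) (sound p)) , go (elems p) (unique p) (sound p)

-- Formal power series

Series : Set
Series = ℕ → ℤ

infixl 6 _⊞_
infixl 7 _⊛_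
infixr 8 _⊙_

_⊞_ : Series → Series → Series
(f ⊞ g) n = f n + g n

_⊙_ : ℤ → Series → Series
(c ⊙ f) n = c * f n

-- Peeling off the constant term of the left factor lets the ring laws go by induction on the index;
-- `diag` inside `gf-×` recovers the usual sum over i ≤ n.
_⊛_ : Series → Series → Series
(f ⊛ g) zero    = f 0 * g 0
(f ⊛ g) (suc n) = f 0 * g (suc n) + ((f ∘ suc) ⊛ g) n

⊛-cong : ∀ {f f′ g g′} → f ≗ f′ → g ≗ g′ → f ⊛ g ≗ f′ ⊛ g′
⊛-cong p q zero    = cong₂ _*_ (p 0) (q 0)
⊛-cong p q (suc n) = cong₂ _+_ (cong₂ _*_ (p 0) (q (suc n))) (⊛-cong (p ∘ suc) q n)

⊞-cong : ∀ {f f′ g g′} → f ≗ f′ → g ≗ g′ → f ⊞ g ≗ f′ ⊞ g′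
⊞-cong p q n = cong₂ _+_ (p n) (q n)

⊛-distribʳ : ∀ f g h → (f ⊞ g) ⊛ h ≗ f ⊛ h ⊞ g ⊛ h
⊛-distribʳ f g h zero    = ℤₚ.*-distribʳ-+ (h 0) (f 0) (g 0)
⊛-distribʳ f g h (suc n) = trans (cong (_+_ ((f 0 + g 0) * h (suc n))) (⊛-distribʳ (f ∘ suc) (g ∘ suc) h n)) (lem (f 0) (g 0) (h (suc n)) _ _)
  where
  lem : ∀ a b c x y → (a + b) * c + (x + y) ≡ a * c + x + (b * c + y)
  lem = solve-∀

⊛-scaleˡ : ∀ c f g → (c ⊙ f) ⊛ g ≗ c ⊙ (f ⊛ g)
⊛-scaleˡ c f g zero    = ℤₚ.*-assoc c (f 0) (g 0)
⊛-scaleˡ c f g (suc n) = trans (cong (_+_ (c * f 0 * g (suc n))) (⊛-scaleˡ c (f ∘ suc) g n)) (lem c (f 0) (g (suc n)) _)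
  where
  lem : ∀ c a b x → c * a * b + c * x ≡ c * (a * b + x)
  lem = solve-∀

⊛-sucʳ : ∀ f g n → (f ⊛ g) (suc n) ≡ (f ⊛ (g ∘ suc)) n + f (suc n) * g 0
⊛-sucʳ f g zero    = refl
⊛-sucʳ f g (suc n) = trans (cong (_+_ (f 0 * g (suc (suc n)))) (⊛-sucʳ (f ∘ suc) g n)) (sym (ℤₚ.+-assoc (f 0 * g (suc (suc n))) _ _))

⊛-comm : ∀ f g → f ⊛ g ≗ g ⊛ f
⊛-comm f g zero    = ℤₚ.*-comm (f 0) (g 0)
⊛-comm f g (suc n) = trans (⊛-sucʳ f g n) (trans (cong₂ _+_ (⊛-comm f (g ∘ suc) n) (ℤₚ.*-comm (f (suc n)) (g 0))) (ℤₚ.+-comm (((g ∘ suc) ⊛ f) n) _))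

⊛-assoc : ∀ f g h → (f ⊛ g) ⊛ h ≗ f ⊛ (g ⊛ h)
⊛-assoc f g h zero    = ℤₚ.*-assoc (f 0) (g 0) (h 0)
⊛-assoc f g h (suc n) = begin
  f 0 * g 0 * h (suc n) + ((f 0 ⊙ (g ∘ suc) ⊞ (f ∘ suc) ⊛ g) ⊛ h) n
    ≡⟨ cong (_+_ (f 0 * g 0 * h (suc n))) (trans (⊛-distribʳ (f 0 ⊙ (g ∘ suc)) ((f ∘ suc) ⊛ g) h n)
         (cong₂ _+_ (⊛-scaleˡ (f 0) (g ∘ suc) h n) (⊛-assoc (f ∘ suc) g h n))) ⟩
  f 0 * g 0 * h (suc n) + (f 0 * ((g ∘ suc) ⊛ h) n + ((f ∘ suc) ⊛ (g ⊛ h)) n)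
    ≡⟨ lem (f 0) (g 0) (h (suc n)) _ _ ⟩
  f 0 * (g 0 * h (suc n) + ((g ∘ suc) ⊛ h) n) + ((f ∘ suc) ⊛ (g ⊛ h)) n ∎
  where
  lem : ∀ a b c x y → a * b * c + (a * x + y) ≡ a * (b * c + x) + y
  lem = solve-∀

⊛-distribˡ : ∀ f g h → f ⊛ (g ⊞ h) ≗ f ⊛ g ⊞ f ⊛ h
⊛-distribˡ f g h n = trans (⊛-comm f (g ⊞ h) n) (trans (⊛-distribʳ g h f n) (cong₂ _+_ (⊛-comm g f n) (⊛-comm h f n)))

⊛-scaleʳ : ∀ c f g → f ⊛ (c ⊙ g) ≗ c ⊙ (f ⊛ g)
⊛-scaleʳ c f g n = trans (⊛-comm f (c ⊙ g) n) (trans (⊛-scaleˡ c g f n) (cong (c *_) (⊛-comm g f n)))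

-- If the second factor starts late, only its first coefficient counts. This turns identities of
-- products into recursions, for the uniqueness of E and for cancelling `ψ` and `θ`.
⊛-low₀ : ∀ f g n → (∀ i → i ℕ.< n → g i ≡ 0ℤ) → (f ⊛ g) n ≡ f 0 * g n
⊛-low₀ f g zero    z = refl
⊛-low₀ f g (suc n) z = trans (cong (_+_ (f 0 * g (suc n))) (trans (⊛-low₀ (f ∘ suc) g n (λ i i<n → z i (ℕₚ.m<n⇒m<1+n i<n)))
  (trans (cong (f 1 *_) (z n ℕₚ.≤-refl)) (ℤₚ.*-zeroʳ (f 1))))) (ℤₚ.+-identityʳ _)

⊛-low₁ : ∀ f g n → (∀ i → i ℕ.< n → g i ≡ 0ℤ) → (f ⊛ g) (suc n) ≡ f 0 * g (suc n) + f 1 * g n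
⊛-low₁ f g n z = cong (_+_ (f 0 * g (suc n))) (⊛-low₀ (f ∘ suc) g n z)

-- dil f (q) = f (q²)
dil : Series → Series
dil f zero          = f 0
dil f (suc zero)    = 0ℤ
dil f (suc (suc n)) = dil (f ∘ suc) n

dil-cong : ∀ {f g} → f ≗ g → dil f ≗ dil g
dil-cong p zero          = p 0
dil-cong p (suc zero)    = refl
dil-cong p (suc (suc n)) = dil-cong (p ∘ suc) n

dil-⊞ : ∀ f g → dil (f ⊞ g) ≗ dil f ⊞ dil g
dil-⊞ f g zero          = refl
dil-⊞ f g (suc zero)    = refl
dil-⊞ f g (suc (suc n)) = dil-⊞ (f ∘ suc) (g ∘ suc) n

dil-⊙ : ∀ c f → dil (c ⊙ f) ≗ c ⊙ dil f
dil-⊙ c f zero          = refl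
dil-⊙ c f (suc zero)    = sym (ℤₚ.*-zeroʳ c)
dil-⊙ c f (suc (suc n)) = dil-⊙ c (f ∘ suc) n

dil-⊛ : ∀ f g → dil (f ⊛ g) ≗ dil f ⊛ dil g
dil-⊛ f g zero          = refl
dil-⊛ f g (suc zero)    = sym (trans (cong (_+ 0ℤ * g 0) (ℤₚ.*-zeroʳ (f 0))) (cong (_+_ (0ℤ)) (ℤₚ.*-zeroˡ (g 0))))
dil-⊛ f g (suc (suc n)) = trans (dil-⊞ (f 0 ⊙ (g ∘ suc)) ((f ∘ suc) ⊛ g) n)
  (cong₂ _+_ (dil-⊙ (f 0) (g ∘ suc) n) (trans (dil-⊛ (f ∘ suc) g n) (sym (ℤₚ.+-identityˡ _))))

dil-2* : ∀ f n → dil f (n ℕ.+ n) ≡ f n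
dil-2* f zero    = refl
dil-2* f (suc n) rewrite ℕₚ.+-suc n n = dil-2* (f ∘ suc) n

dil-odd : ∀ f n → dil f (suc (n ℕ.+ n)) ≡ 0ℤ
dil-odd f zero    = refl
dil-odd f (suc n) rewrite ℕₚ.+-suc n n = dil-odd (f ∘ suc) n

data Parity : ℕ → Set where
  even : ∀ n → Parity (n ℕ.+ n)
  odd  : ∀ n → Parity (suc (n ℕ.+ n))

parity : ∀ n → Parity n
parity zero    = even 0
parity (suc n) with parity n
... | even m = odd m
... | odd m  = subst Parity (cong suc (ℕₚ.+-suc m m)) (even (suc m))

-- GF e v f : the series f is the sum of v(x) q^e(x) over the index set A.

GF : {A : Set} → (A → ℤ) → (A → ℤ) → Series → Set
GF e v f = ∀ n → Enum (λ x → e x ≡ + n) v (f n)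

one : {A : Set} → A → ℤ
one _ = 1ℤ

-- Exponents are integers so that polynomial identities apply to them; a Cauchy product needs them
-- to be natural numbers.
NonNeg : {A : Set} → (A → ℤ) → Set
NonNeg {A} e = ∀ x → Σ[ k ∈ ℕ ] e x ≡ + k

module _ {A : Set} where

  gf-det : ∀ {e v : A → ℤ} {f g} → GF e v f → GF e v g → f ≗ g
  gf-det p q n = enum-det (p n) (q n)

  gf-+ : ∀ {e v u : A → ℤ} {f g} → GF e v f → GF e u g → GF e (λ x → v x + u x) (f ⊞ g)
  gf-+ p q n = enum-+ (p n) (q n)

  gf-scale : ∀ {e v : A → ℤ} {f} c → GF e v f → GF e (λ x → c * v x) (c ⊙ f)
  gf-scale c p n = enum-scale c (p n)

  gf-reweight : ∀ {e v : A → ℤ} {f} (u : A → ℤ) → GF e v f → Σ[ g ∈ Series ] GF e u g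
  gf-reweight u p = (λ n → proj₁ (enum-weight u (p n))) , (λ n → proj₂ (enum-weight u (p n)))

  gf-resp : ∀ {e v : A → ℤ} {f g} → f ≗ g → GF e v f → GF e v g
  gf-resp fg p n = enum-cast (fg n) (p n)

  gf-zero : ∀ {e v : A → ℤ} {f} n → (∀ x → e x ≢ + n) → GF e v f → f n ≡ 0ℤ
  gf-zero n ne p = enum-empty ne (p n)

module _ {A B : Set} where

  gf-↔ : ∀ {e v : A → ℤ} {e′ u : B → ℤ} {f} (to : A → B) (from : B → A) →
    (∀ x → from (to x) ≡ x) → (∀ y → to (from y) ≡ y) →
    (∀ x → e′ (to x) ≡ e x) → (∀ x → u (to x) ≡ v x) → GF e v f → GF e′ u f
  gf-↔ {e′ = e′} to from ft tf ee vv p n = enum-↔ to from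
    (λ {x} → trans (ee x))
    (λ {y} h → trans (sym (ee (from y))) (trans (cong e′ (tf y)) h))
    (λ {x} _ → ft x) (λ {y} _ → tf y) (λ {x} _ → vv x) (p n)

  -- The value i of the first exponent is carried as an extra coordinate. For fixed i the fibre is a
  -- product of sets, and the Cauchy product adds the fibres over i ≤ n.
  gf-× : ∀ {e v : A → ℤ} {e′ u : B → ℤ} {f g} → NonNeg e → NonNeg e′ → GF e v f → GF e′ u g →
    GF (λ ab → e (proj₁ ab) + e′ (proj₂ ab)) (λ ab → v (proj₁ ab) * u (proj₂ ab)) (f ⊛ g)
  gf-× {e} {v} {e′} {u} {f} {g} nn nn′ p q n =
    enum-↔ proj₂ (λ ab → proj₁ (nn (proj₁ ab)) , ab)
      (λ { {i , a , b} (i≤n , ea , eb) → trans (cong₂ _+_ ea eb) (cong +_ (ℕₚ.m+[n∸m]≡n i≤n)) })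
      back
      (λ { {i , a , b} (i≤n , ea , eb) → cong (_, (a , b)) (ℤₚ.+-injective (trans (sym (proj₂ (nn a))) ea)) })
      (λ _ → refl) (λ _ → refl)
      (enum-Σ {v = λ iab → v (proj₁ (proj₂ iab)) * u (proj₂ (proj₂ iab))} (λ i _ → prod (p i) (q (n ℕ.∸ i))) (diag f g n))
    where
    back : ∀ {ab} → e (proj₁ ab) + e′ (proj₂ ab) ≡ + n → let i = proj₁ (nn (proj₁ ab)) in
      (i ℕ.≤ n) × (e (proj₁ ab) ≡ + i) × (e′ (proj₂ ab) ≡ + (n ℕ.∸ i))
    back {a , b} h with nn a | nn′ b
    ... | i , ei | j , ej = subst (i ℕ.≤_) ij (ℕₚ.m≤m+n i j) , ei ,
      trans ej (cong +_ (trans (sym (ℕₚ.m+n∸m≡n i j)) (cong (ℕ._∸ i) ij)))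
      where
      ij : i ℕ.+ j ≡ n
      ij = ℤₚ.+-injective (trans (sym (cong₂ _+_ ei ej)) h)
    prod : ∀ {P : A → Set} {Q : B → Set} {s t} → Enum P v s → Enum Q u t →
      Enum (λ ab → P (proj₁ ab) × Q (proj₂ ab)) (λ ab → v (proj₁ ab) * u (proj₂ ab)) (s * t)
    prod {s = s} {t} ps qt = enum-cast (ℤₚ.*-comm t s) (enum-Σ (λ a _ → enum-cast (ℤₚ.*-comm (v a) t) (enum-scale (v a) qt)) (enum-scale t ps))
    diag : ∀ f g n → Enum (ℕ._≤ n) (λ i → f i * g (n ℕ.∸ i)) ((f ⊛ g) n)
    diag f g zero = mkEnum (0 ∷ []) ([] ∷ []) (λ { (here refl) → z≤n }) (λ { {zero} z≤n → here refl }) (ℤₚ.+-identityʳ _)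
    diag f g (suc n) = mkEnum (0 ∷ map suc (elems r))
      (All.tabulate (λ x∈ 0≡x → case x∈ 0≡x) ∷ Unique.map⁺ ℕₚ.suc-injective (unique r))
      (λ { (here refl) → z≤n ; (there x∈) → up x∈ })
      (λ { {zero} _ → here refl ; {suc i} (s≤s i≤n) → there (∈-map⁺ suc (complete r i≤n)) })
      (cong (_+_ (f 0 * g (suc n))) (trans (sumOf-map (λ i → f i * g (suc n ℕ.∸ i)) suc (elems r)) (total r)))
      where
      r = diag (f ∘ suc) g n
      case : ∀ {x} → x ∈ map suc (elems r) → 0 ≡ x → ⊥
      case x∈ refl with ∈-map⁻ suc x∈
      ... | _ , _ , ()
      up : ∀ {x} → x ∈ map suc (elems r) → x ℕ.≤ suc n
      up x∈ with _ , y∈ , refl ← ∈-map⁻ suc x∈ = s≤s (sound r y∈)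

gf-dil : ∀ {A : Set} {e e² v : A → ℤ} {f} → (∀ x → e² x ≡ e x + e x) → NonNeg e → GF e v f → GF e² v (dil f)
gf-dil {A} {e} {e²} {v} {f} ee nn p n with parity n
... | even m = enum-cast (sym (dil-2* f m)) (enum-↔ id id
  (λ {x} h → trans (ee x) (cong₂ _+_ h h))
  (λ {x} h → half x (trans (sym (ee x)) h)) (λ _ → refl) (λ _ → refl) (λ _ → refl) (p m))
  where
  double-inj : ∀ k m → k ℕ.+ k ≡ m ℕ.+ m → k ≡ m
  double-inj zero    zero    _ = refl
  double-inj (suc k) (suc m) h = cong suc (double-inj k m (ℕₚ.suc-injective (trans (sym (ℕₚ.+-suc k k)) (trans (ℕₚ.suc-injective h) (ℕₚ.+-suc m m)))))
  half : ∀ x → e x + e x ≡ + (m ℕ.+ m) → e x ≡ + m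
  half x h with nn x
  ... | k , ek = trans ek (cong +_ (double-inj k m (ℤₚ.+-injective (trans (sym (cong₂ _+_ ek ek)) h))))
... | odd m = mkEnum [] [] (λ ()) (λ {x} h → ⊥-elim (no-odd x (trans (sym (ee x)) h))) (sym (dil-odd f m))
  where
  ne : ∀ k m → k ℕ.+ k ≢ suc (m ℕ.+ m)
  ne (suc k) zero    h rewrite ℕₚ.+-suc k k with () ← h
  ne (suc k) (suc m) h = ne k m (ℕₚ.suc-injective (trans (sym (ℕₚ.+-suc k k)) (trans (ℕₚ.suc-injective h) (cong suc (ℕₚ.+-suc m m)))))
  no-odd : ∀ x → e x + e x ≢ + suc (m ℕ.+ m)
  no-odd x h with nn x
  ... | k , ek = ne k m (ℤₚ.+-injective (trans (sym (cong₂ _+_ ek ek)) h))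

-- Splitting the index set

record Split (A B C : Set) : Set where
  field
    to   : A → B ⊎ C
    from : B ⊎ C → A
    ft   : ∀ x → from (to x) ≡ x
    tf   : ∀ y → to (from y) ≡ y

record Cut {B C : Set} (e₁ v₁ : B → ℤ) (e₂ v₂ : C → ℤ) (f : Series) : Set where
  constructor cut
  field
    part₁ part₂ : Series
    gf₁ : GF e₁ v₁ part₁
    gf₂ : GF e₂ v₂ part₂
    sum : f ≗ part₁ ⊞ part₂

module _ {A B C : Set} (S : Split A B C) {e v : A → ℤ} {e₁ v₁ : B → ℤ} {e₂ v₂ : C → ℤ}
  (ee₁ : ∀ x → e₁ x ≡ e (Split.from S (inj₁ x))) (ee₂ : ∀ x → e₂ x ≡ e (Split.from S (inj₂ x)))
  (vv₁ : ∀ x → v₁ x ≡ v (Split.from S (inj₁ x))) (vv₂ : ∀ x → v₂ x ≡ v (Split.from S (inj₂ x)))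
  where

  open Split S

  gf-join : ∀ {f g} → GF e₁ v₁ f → GF e₂ v₂ g → GF e v (f ⊞ g)
  gf-join p q n = enum-↔ {P = [ (λ x → e₁ x ≡ + n) , (λ x → e₂ x ≡ + n) ]′} from to
    (λ { {inj₁ x} h → trans (sym (ee₁ x)) h ; {inj₂ x} h → trans (sym (ee₂ x)) h })
    (λ {x} → back x)
    (λ {y} _ → tf y) (λ {x} _ → ft x)
    (λ { {inj₁ x} _ → sym (vv₁ x) ; {inj₂ x} _ → sym (vv₂ x) })
    (enum-⊎ (p n) (q n))
    where
    back : ∀ x → e x ≡ + n → [ (λ x → e₁ x ≡ + n) , (λ x → e₂ x ≡ + n) ]′ (to x)
    back x h with to x | ft x
    ... | inj₁ y | refl = trans (ee₁ y) h
    ... | inj₂ y | refl = trans (ee₂ y) h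

  abstract
   -- An enumeration of the whole filters to enumerations of both parts, so the part series exist
   -- without being computed. `abstract` keeps them from being unfolded.
   gf-cut : ∀ {f} → GF e v f → Cut e₁ v₁ e₂ v₂ f
   gf-cut {f} p = cut g h pg ph (gf-det p (gf-join pg ph))
     where
     q : GF (e ∘ from) (v ∘ from) f
     q = gf-↔ to from ft tf (λ x → cong e (ft x)) (λ x → cong v (ft x)) p
     g h : Series
     g = λ n → proj₁ (enum-lefts (q n))
     h = λ n → proj₁ (enum-rights (q n))
     pg : GF e₁ v₁ g
     pg = gf-↔ id id (λ _ → refl) (λ _ → refl) ee₁ vv₁ (λ n → proj₂ (enum-lefts (q n)))
     ph : GF e₂ v₂ h
     ph = gf-↔ id id (λ _ → refl) (λ _ → refl) ee₂ vv₂ (λ n → proj₂ (enum-rights (q n)))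

record Iso (A B : Set) : Set where
  constructor iso
  field
    to   : A → B
    from : B → A
    ft   : ∀ x → from (to x) ≡ x
    tf   : ∀ y → to (from y) ≡ y

-- Change of index set, defined separately on the two parts of a splitting.
gf-piecewise : {A B C A′ B′ C′ : Set} (S : Split A B C) (S′ : Split A′ B′ C′) (β : Iso B B′) (γ : Iso C C′)
  {e v : A → ℤ} {e′ v′ : A′ → ℤ} →
  (∀ x → e′ (Split.from S′ (inj₁ (Iso.to β x))) ≡ e (Split.from S (inj₁ x))) →
  (∀ x → e′ (Split.from S′ (inj₂ (Iso.to γ x))) ≡ e (Split.from S (inj₂ x))) →
  (∀ x → v′ (Split.from S′ (inj₁ (Iso.to β x))) ≡ v (Split.from S (inj₁ x))) →
  (∀ x → v′ (Split.from S′ (inj₂ (Iso.to γ x))) ≡ v (Split.from S (inj₂ x))) →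
  ∀ {f} → GF e v f → GF e′ v′ f
gf-piecewise S S′ β γ {e} {v} {e′} {v′} e₁ e₂ v₁ v₂ p = finish (gf-cut S {e₁ = e ∘ Split.from S ∘ inj₁} {v₁ = v ∘ Split.from S ∘ inj₁}
    {e₂ = e ∘ Split.from S ∘ inj₂} {v₂ = v ∘ Split.from S ∘ inj₂} (λ _ → refl) (λ _ → refl) (λ _ → refl) (λ _ → refl) p)
  where
  finish : ∀ {f} → Cut (e ∘ Split.from S ∘ inj₁) (v ∘ Split.from S ∘ inj₁) (e ∘ Split.from S ∘ inj₂) (v ∘ Split.from S ∘ inj₂) f → GF e′ v′ f
  finish (cut g h pg ph eq) = gf-resp (λ n → sym (eq n)) (gf-join S′
    {e₁ = e′ ∘ Split.from S′ ∘ inj₁} {v₁ = v′ ∘ Split.from S′ ∘ inj₁} {e₂ = e′ ∘ Split.from S′ ∘ inj₂} {v₂ = v′ ∘ Split.from S′ ∘ inj₂}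
    (λ _ → refl) (λ _ → refl) (λ _ → refl) (λ _ → refl)
    (gf-↔ (Iso.to β) (Iso.from β) (Iso.ft β) (Iso.tf β) e₁ v₁ pg)
    (gf-↔ (Iso.to γ) (Iso.from γ) (Iso.ft γ) (Iso.tf γ) e₂ v₂ ph))

module _ {A A′ B C : Set} where

  -- Lets a standard splitting act on any chosen coordinates.
  rearrange : (f : A → A′) (g : A′ → A) → (∀ x → g (f x) ≡ x) → (∀ y → f (g y) ≡ y) → Split A′ B C → Split A B C
  rearrange f g gf fg S = record
    { to = to ∘ f ; from = g ∘ from
    ; ft = λ x → trans (cong g (ft (f x))) (gf x)
    ; tf = λ y → trans (cong to (fg (from y))) (tf y) }
    where open Split S

module _ (X : Set) where

  -- The left part is x < y, stored as x and y - x - 1; the right part is x ≥ y, stored as y and x -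
  -- y.
  split-< : Split (X × ℕ × ℕ) (X × ℕ × ℕ) (X × ℕ × ℕ)
  split-< = record { to = to ; from = from ; ft = ft ; tf = tf }
    where
    to′ : ℕ → ℕ → (ℕ × ℕ) ⊎ (ℕ × ℕ)
    to′ zero    (suc y) = inj₁ (0 , y)
    to′ x       zero    = inj₂ (0 , x)
    to′ (suc x) (suc y) = Data.Sum.map (λ (a , d) → suc a , d) (λ (a , d) → suc a , d) (to′ x y)
    from′ : (ℕ × ℕ) ⊎ (ℕ × ℕ) → ℕ × ℕ
    from′ (inj₁ (x , d)) = x , suc (x ℕ.+ d)
    from′ (inj₂ (y , d)) = y ℕ.+ d , y
    ft′ : ∀ x y → from′ (to′ x y) ≡ (x , y)
    ft′ zero    (suc y) = refl
    ft′ zero    zero    = refl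
    ft′ (suc x) zero    = refl
    ft′ (suc x) (suc y) with to′ x y | ft′ x y
    ... | inj₁ (a , d) | refl = refl
    ... | inj₂ (a , d) | refl = refl
    tf₁ : ∀ x d → to′ x (suc (x ℕ.+ d)) ≡ inj₁ (x , d)
    tf₁ zero    d = refl
    tf₁ (suc x) d = cong (Data.Sum.map _ _) (tf₁ x d)
    tf₂ : ∀ y d → to′ (y ℕ.+ d) y ≡ inj₂ (y , d)
    tf₂ zero    zero    = refl
    tf₂ zero    (suc d) = refl
    tf₂ (suc y) d = cong (Data.Sum.map _ _) (tf₂ y d)
    to : X × ℕ × ℕ → (X × ℕ × ℕ) ⊎ (X × ℕ × ℕ)
    to (a , x , y) = Data.Sum.map (a ,_) (a ,_) (to′ x y)
    from : (X × ℕ × ℕ) ⊎ (X × ℕ × ℕ) → X × ℕ × ℕ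
    from (inj₁ (a , x)) = a , from′ (inj₁ x)
    from (inj₂ (a , x)) = a , from′ (inj₂ x)
    ft : ∀ x → from (to x) ≡ x
    ft (a , x , y) with to′ x y | ft′ x y
    ... | inj₁ _ | refl = refl
    ... | inj₂ _ | refl = refl
    tf : ∀ y → to (from y) ≡ y
    tf (inj₁ (a , x , d)) = cong (Data.Sum.map _ _) (tf₁ x d)
    tf (inj₂ (a , y , d)) = cong (Data.Sum.map _ _) (tf₂ y d)

  split-parity : Split (X × ℕ) (X × ℕ) (X × ℕ)
  split-parity = record { to = to ; from = from ; ft = ft ; tf = tf }
    where
    from : (X × ℕ) ⊎ (X × ℕ) → X × ℕ
    from (inj₁ (a , n)) = a , n ℕ.+ n
    from (inj₂ (a , n)) = a , suc (n ℕ.+ n)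
    to″ : ℕ → ℕ ⊎ ℕ
    to″ zero = inj₁ 0
    to″ (suc n) with to″ n
    ... | inj₁ m = inj₂ m
    ... | inj₂ m = inj₁ (suc m)
    to : X × ℕ → (X × ℕ) ⊎ (X × ℕ)
    to (a , n) = Data.Sum.map (a ,_) (a ,_) (to″ n)
    ft : ∀ x → from (to x) ≡ x
    ft (a , zero) = refl
    ft (a , suc n) with to″ n | ft (a , n)
    ... | inj₁ m | refl = refl
    ... | inj₂ m | refl = cong (λ t → a , suc t) (ℕₚ.+-suc m m)
    tfe : ∀ n → to″ (n ℕ.+ n) ≡ inj₁ n
    tfe zero = refl
    tfe (suc n) rewrite ℕₚ.+-suc n n | tfe n = refl
    tf : ∀ y → to (from y) ≡ y
    tf (inj₁ (a , n)) rewrite tfe n = refl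
    tf (inj₂ (a , n)) rewrite tfe n = refl

  split-suc : Split (X × ℕ) X (X × ℕ)
  split-suc = record
    { to = λ { (a , zero) → inj₁ a ; (a , suc n) → inj₂ (a , n) }
    ; from = λ { (inj₁ a) → a , 0 ; (inj₂ (a , n)) → a , suc n }
    ; ft = λ { (a , zero) → refl ; (a , suc n) → refl }
    ; tf = λ { (inj₁ a) → refl ; (inj₂ (a , n)) → refl } }

  split-sign : Split (X × ℤ) (X × ℕ) (X × ℕ)
  split-sign = record
    { to = λ { (a , + n) → inj₁ (a , n) ; (a , -[1+ n ]) → inj₂ (a , n) }
    ; from = λ { (inj₁ (a , n)) → a , + n ; (inj₂ (a , n)) → a , -[1+ n ] }
    ; ft = λ { (a , + n) → refl ; (a , -[1+ n ]) → refl }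
    ; tf = λ { (inj₁ a) → refl ; (inj₂ (a , n)) → refl } }

  split-ℤparity : Split (X × ℤ) (X × ℤ) (X × ℤ)
  split-ℤparity = record { to = to ; from = from ; ft = ft ; tf = tf }
    where
    open Split split-parity renaming (to to toₙ; from to fromₙ; ft to ftₙ; tf to tfₙ)
    from : (X × ℤ) ⊎ (X × ℤ) → X × ℤ
    from (inj₁ (a , z)) = a , z + z
    from (inj₂ (a , z)) = a , z + z + 1ℤ
    -- The number -1 - 2n is odd and -2 - 2n is even, so a negative number has the parity opposite
    -- to its stored index.
    neg : (X × ℕ) ⊎ (X × ℕ) → (X × ℤ) ⊎ (X × ℤ)
    neg (inj₁ (a , n)) = inj₂ (a , -[1+ n ])
    neg (inj₂ (a , n)) = inj₁ (a , -[1+ n ])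
    pos : (X × ℕ) ⊎ (X × ℕ) → (X × ℤ) ⊎ (X × ℤ)
    pos = Data.Sum.map (λ (a , n) → a , + n) (λ (a , n) → a , + n)
    to : X × ℤ → (X × ℤ) ⊎ (X × ℤ)
    to (a , + n)      = pos (toₙ (a , n))
    to (a , -[1+ n ]) = neg (toₙ (a , n))
    ft : ∀ x → from (to x) ≡ x
    ft (a , + n) with toₙ (a , n) | ftₙ (a , n)
    ... | inj₁ (b , m) | refl = refl
    ... | inj₂ (b , m) | refl = cong (λ t → b , + t) (ℕₚ.+-comm (m ℕ.+ m) 1)
    ft (a , -[1+ n ]) with toₙ (a , n) | ftₙ (a , n)
    ... | inj₁ (b , m) | refl = refl
    ... | inj₂ (b , m) | refl = refl
    tf : ∀ y → to (from y) ≡ y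
    tf (inj₁ (a , + n))      = cong pos (tfₙ (inj₁ (a , n)))
    tf (inj₁ (a , -[1+ n ])) = cong neg (tfₙ (inj₂ (a , n)))
    tf (inj₂ (a , + n)) rewrite ℕₚ.+-comm (n ℕ.+ n) 1 = cong pos (tfₙ (inj₂ (a , n)))
    tf (inj₂ (a , -[1+ n ])) = cong neg (tfₙ (inj₁ (a , n)))

-- Finiteness of the fibres

-- Infinite index sets get their enumerations here: an exponent that bounds `size` confines each of
-- its fibres to a finite box.
record Box (A : Set) : Set where
  field
    box    : ℕ → List A
    box-!  : ∀ n → Unique (box n)
    size   : A → ℕ
    box-∈  : ∀ n x → size x ℕ.≤ n → x ∈ box n

open Box

boxℕ : Box ℕ
boxℕ = record
  { box = λ n → upTo (suc n) ; box-! = λ n → Unique.upTo⁺ (suc n)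
  ; size = id ; box-∈ = λ n x x≤n → ∈-upTo⁺ (s≤s x≤n) }

boxℤ : Box ℤ
boxℤ = record
  { box = λ n → map +_ (upTo (suc n)) ++ map -[1+_] (upTo (suc n))
  ; box-! = λ n → Unique.++⁺ (Unique.map⁺ ℤₚ.+-injective (Unique.upTo⁺ (suc n)))
      (Unique.map⁺ ℤₚ.-[1+-injective (Unique.upTo⁺ (suc n))) (disj n)
  ; size = ∣_∣
  ; box-∈ = λ { n (+ x) x≤n → ∈-++⁺ˡ (∈-map⁺ +_ (∈-upTo⁺ (s≤s x≤n)))
              ; n -[1+ x ] x<n → ∈-++⁺ʳ (map +_ (upTo (suc n))) (∈-map⁺ -[1+_] (∈-upTo⁺ (ℕₚ.m<n⇒m<1+n x<n))) } }
  where
  disj : ∀ n {x} → x ∈ map +_ (upTo (suc n)) × x ∈ map -[1+_] (upTo (suc n)) → ⊥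
  disj n (a , b) with ∈-map⁻ +_ a | ∈-map⁻ -[1+_] b
  ... | _ , _ , refl | _ , _ , ()

infixr 2 _box×_

_box×_ : {A B : Set} → Box A → Box B → Box (A × B)
a box× b = record
  { box   = λ n → cartesianProduct (box a n) (box b n)
  ; box-! = λ n → Unique.cartesianProduct⁺ (box-! a n) (box-! b n)
  ; size  = λ (x , y) → size a x ℕ.⊔ size b y
  ; box-∈ = λ n (x , y) h → ∈-cartesianProduct⁺ (box-∈ a n x (ℕₚ.m⊔n≤o⇒m≤o _ _ h)) (box-∈ b n y (ℕₚ.m⊔n≤o⇒n≤o (size a x) _ h)) }

module _ {A : Set} (b : Box A) (e : A → ℕ) (v : A → ℤ) where

  fibre : ℕ → List A
  fibre n = filter (λ x → e x ℕ.≟ n) (box b n)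

  gfSum : Series
  gfSum n = sumOf v (fibre n)

  gf-box : (∀ x → size b x ℕ.≤ e x) → GF (λ x → + e x) v gfSum
  gf-box h n = mkEnum (fibre n) (Unique.filter⁺ (λ x → e x ℕ.≟ n) (box-! b n))
    (λ x∈ → cong +_ (proj₂ (∈-filter⁻ (λ x → e x ℕ.≟ n) {xs = box b n} x∈)))
    (λ {x} ex → ∈-filter⁺ (λ x → e x ℕ.≟ n) (box-∈ b n x (subst (size b x ℕ.≤_) (ℤₚ.+-injective ex) (h x))) (ℤₚ.+-injective ex))
    refl

-- The ring of power series

𝟘 𝟙 : Series
𝟘 _ = 0ℤ
𝟙 zero    = 1ℤ
𝟙 (suc n) = 0ℤ

⊟_ : Series → Series
(⊟ f) n = - f n

⊛-zeroˡ : ∀ f → 𝟘 ⊛ f ≗ 𝟘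
⊛-zeroˡ f zero    = refl
⊛-zeroˡ f (suc n) = trans (ℤₚ.+-identityˡ _) (⊛-zeroˡ f n)

⊛-identityˡ : ∀ f → 𝟙 ⊛ f ≗ f
⊛-identityˡ f zero    = ℤₚ.*-identityˡ (f 0)
⊛-identityˡ f (suc n) = trans (cong₂ _+_ (ℤₚ.*-identityˡ (f (suc n))) (⊛-zeroˡ f n)) (ℤₚ.+-identityʳ _)

seriesRing : CommutativeRing 0ℓ 0ℓ
seriesRing = record
  { Carrier = Series ; _≈_ = _≗_ ; _+_ = _⊞_ ; _*_ = _⊛_ ; -_ = ⊟_ ; 0# = 𝟘 ; 1# = 𝟙
  ; isCommutativeRing = record
    { isRing = record
      { +-isAbelianGroup = record
        { isGroup = record
          { isMonoid = record
            { isSemigroup = record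
              { isMagma = record
                { isEquivalence = record { refl = λ _ → refl ; sym = λ p n → sym (p n) ; trans = λ p q n → trans (p n) (q n) }
                ; ∙-cong = ⊞-cong }
              ; assoc = λ f g h n → ℤₚ.+-assoc (f n) (g n) (h n) }
            ; identity = (λ f n → ℤₚ.+-identityˡ (f n)) , (λ f n → ℤₚ.+-identityʳ (f n)) }
          ; inverse = (λ f n → ℤₚ.+-inverseˡ (f n)) , (λ f n → ℤₚ.+-inverseʳ (f n))
          ; ⁻¹-cong = λ p n → cong -_ (p n) }
        ; comm = λ f g n → ℤₚ.+-comm (f n) (g n) }
      ; *-cong = ⊛-cong
      ; *-assoc = ⊛-assoc
      ; *-identity = ⊛-identityˡ , (λ f n → trans (⊛-comm f 𝟙 n) (⊛-identityˡ f n))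
      ; distrib = ⊛-distribˡ , (λ f g h → ⊛-distribʳ g h f) }
    ; *-comm = ⊛-comm } }

open Solver (CommutativeRing.commutativeSemiring seriesRing) using (solve; _:=_; _:+_; _:*_)

-- This is the recurrence for the closed form pt(4p² + t²) with p = `ψ`, t = `θ`: here Θ = t + 2p,
-- the dilated series is p²t², and the remainder is pt(t³ + 8p³).
ΘE₀ : ∀ p t → ((t ⊞ (p ⊞ p)) ⊛ (p ⊛ t ⊛ (((p ⊛ p ⊞ p ⊛ p) ⊞ (p ⊛ p ⊞ p ⊛ p)) ⊞ t ⊛ t)))
  ≗ ((t ⊞ (p ⊞ p)) ⊛ (p ⊛ p ⊛ (t ⊛ t)) ⊞ (t ⊞ (p ⊞ p)) ⊛ (p ⊛ p ⊛ (t ⊛ t)) ⊞ p ⊛ t ⊛ (t ⊛ t ⊛ t ⊞ (p ⊞ p) ⊛ (p ⊞ p) ⊛ (p ⊞ p)))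
ΘE₀ = solve 2 (λ p t → ((t :+ (p :+ p)) :* (p :* t :* (((p :* p :+ p :* p) :+ (p :* p :+ p :* p)) :+ t :* t)))
  := ((t :+ (p :+ p)) :* (p :* p :* (t :* t)) :+ (t :+ (p :+ p)) :* (p :* p :* (t :* t)) :+ p :* t :* (t :* t :* t :+ (p :+ p) :* (p :+ p) :* (p :+ p)))) (λ _ → refl)

-- Theta series

d : ℤ → ℤ
d z = z + z

sq : (ℤ → ℤ) → ℤ → ℤ
sq h z = h z * h z

sqℕ : (ℤ → ℤ) → ℤ → ℕ
sqℕ h z = ∣ h z ∣ ℕ.* ∣ h z ∣

+sqℕ : ∀ z → + (∣ z ∣ ℕ.* ∣ z ∣) ≡ z * z
+sqℕ (+ n)      = ℤₚ.pos-* n n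
+sqℕ -[1+ n ] = refl

sq-≥0 : ∀ h → NonNeg (sq h)
sq-≥0 h z = sqℕ h z , sym (+sqℕ (h z))

+-≥0 : {A B : Set} {e : A → ℤ} {f : B → ℤ} → NonNeg e → NonNeg f → NonNeg (λ ab → e (proj₁ ab) + f (proj₂ ab))
+-≥0 p q (a , b) with p a | q b
... | k , ek | l , el = k ℕ.+ l , cong₂ _+_ ek el

theta : (ℤ → ℤ) → Series
theta h = gfSum boxℤ (sqℕ h) one

gf-theta : ∀ h → (∀ z → ∣ z ∣ ℕ.≤ ∣ h z ∣) → GF (sq h) one (theta h)
gf-theta h le = gf-↔ id id (λ _ → refl) (λ _ → refl) (λ z → sym (+sqℕ (h z))) (λ _ → refl)
  (gf-box boxℤ (sqℕ h) one (λ z → ℕₚ.≤-trans (le z) (k≤k² ∣ h z ∣)))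
  where
  k≤k² : ∀ k → k ℕ.≤ k ℕ.* k
  k≤k² zero    = z≤n
  k≤k² (suc k) = ℕₚ.m≤m*n (suc k) (suc k)

-- For every odd w exactly one of w and -w has the form 4z + 1, so `ψ` lists each odd square once.
h₄ : ℤ → ℤ
h₄ z = d (d z) + 1ℤ

h₂ : ℤ → ℤ
h₂ z = d z + 1ℤ

ψ θ θ₂ Θ : Series
ψ  = theta h₄
θ  = theta d
θ₂ = theta h₂
Θ  = theta id

∣d∣ : ∀ z → ∣ z ∣ ℕ.≤ ∣ d z ∣
∣d∣ (+ n)      = ℕₚ.m≤m+n n n
∣d∣ -[1+ n ] = s≤s (ℕₚ.m≤n⇒m≤1+n (ℕₚ.m≤m+n n n))

∣h₂∣ : ∀ z → ∣ z ∣ ℕ.≤ ∣ h₂ z ∣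
∣h₂∣ (+ n)      = ℕₚ.≤-trans (ℕₚ.m≤m+n n n) (ℕₚ.m≤m+n (n ℕ.+ n) 1)
∣h₂∣ -[1+ n ] = s≤s (ℕₚ.m≤m+n n n)

gψ : GF (sq h₄) one ψ
gψ = gf-theta h₄ (λ z → ℕₚ.≤-trans (∣d∣ z) (∣h₂∣ (d z)))

gθ : GF (sq d) one θ
gθ = gf-theta d ∣d∣

gθ₂ : GF (sq h₂) one θ₂
gθ₂ = gf-theta h₂ ∣h₂∣

gΘ : GF (sq id) one Θ
gΘ = gf-theta id (λ _ → ℕₚ.≤-refl)

split-ℤparity₁ : Split ℤ ℤ ℤ
split-ℤparity₁ = record
  { to = λ z → drop (to (tt , z)) ; from = from₁ ; ft = ft₁
  ; tf = λ { (inj₁ k) → cong drop (tf (inj₁ (tt , k))) ; (inj₂ k) → cong drop (tf (inj₂ (tt , k))) } }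
  where
  open Split (split-ℤparity ⊤)
  drop : (⊤ × ℤ) ⊎ (⊤ × ℤ) → ℤ ⊎ ℤ
  drop = Data.Sum.map proj₂ proj₂
  from₁ : ℤ ⊎ ℤ → ℤ
  from₁ (inj₁ k) = d k
  from₁ (inj₂ k) = h₂ k
  ft₁ : ∀ z → from₁ (drop (to (tt , z))) ≡ z
  ft₁ z with to (tt , z) | ft (tt , z)
  ... | inj₁ _ | e = cong proj₂ e
  ... | inj₂ _ | e = cong proj₂ e

data ℤParity : ℤ → Set where
  evenℤ : ∀ k → ℤParity (d k)
  oddℤ  : ∀ k → ℤParity (h₂ k)

parityℤ : ∀ z → ℤParity z
parityℤ z with Split.to split-ℤparity₁ z | Split.ft split-ℤparity₁ z
... | inj₁ k | refl = evenℤ k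
... | inj₂ k | refl = oddℤ k

Θ-split : Θ ≗ θ ⊞ θ₂
Θ-split = gf-det gΘ (gf-join split-ℤparity₁ (λ _ → refl) (λ _ → refl) (λ _ → refl) (λ _ → refl) gθ gθ₂)

θ₂-split : θ₂ ≗ ψ ⊞ ψ
θ₂-split = gf-det gθ₂ (gf-join split-ℤparity₁ {e₂ = λ k → h₂ (h₂ k) * h₂ (h₂ k)} (λ _ → refl) (λ _ → refl) (λ _ → refl) (λ _ → refl) gψ
  (gf-↔ inv inv inv-inv inv-inv eq (λ _ → refl) gψ))
  where
  inv : ℤ → ℤ
  inv z = - 1ℤ - z
  inv-inv : ∀ z → inv (inv z) ≡ z
  inv-inv = lem
    where
    lem : ∀ z → - 1ℤ - (- 1ℤ - z) ≡ z
    lem = solve-∀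
  eq : ∀ x → h₂ (h₂ (inv x)) * h₂ (h₂ (inv x)) ≡ h₄ x * h₄ x
  eq = lem
    where
    lem : ∀ z → let h₂ = λ (x : ℤ) → x + x + 1ℤ in h₂ (h₂ (- 1ℤ - z)) * h₂ (h₂ (- 1ℤ - z)) ≡ h₂ (z + z) * h₂ (z + z)
    lem = solve-∀

-- 2(a² + b²) = (a + b)² + (a - b)²

plus⁻plus : ∀ a b → a + b - b ≡ a
plus⁻plus = solve-∀

minus⁺minus : ∀ a b → a - b + b ≡ a
minus⁺minus = solve-∀

-- the change of variables (p , q) ↦ (q , p - q)
split-difference : Split (ℤ × ℤ) (ℤ × ℤ) (ℤ × ℤ)
split-difference = rearrange (λ pq → proj₂ pq , proj₁ pq - proj₂ pq) (λ qt → proj₂ qt + proj₁ qt , proj₁ qt)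
  (λ (p , q) → cong (_, q) (minus⁺minus p q)) (λ (q , t) → cong (q ,_) (plus⁻plus t q)) (split-ℤparity ℤ)

iso-add : Iso (ℤ × ℤ) (ℤ × ℤ)
iso-add = iso (λ qτ → proj₁ qτ + proj₂ qτ , proj₂ qτ) (λ sτ → proj₁ sτ - proj₂ sτ , proj₂ sτ)
  (λ (q , τ) → cong (_, τ) (plus⁻plus q τ)) (λ (s , τ) → cong (_, τ) (minus⁺minus s τ))

iso-reflect : Iso (ℤ × ℤ) (ℤ × ℤ)
iso-reflect = iso (λ qτ → - 1ℤ - proj₁ qτ - proj₂ qτ , proj₂ qτ) (λ sτ → - 1ℤ - proj₁ sτ - proj₂ sτ , proj₂ sτ)
  (λ (q , τ) → cong (_, τ) (inv q τ)) (λ (s , τ) → cong (_, τ) (inv s τ))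
  where
  inv : ∀ q τ → - 1ℤ - (- 1ℤ - q - τ) - τ ≡ q
  inv = solve-∀

sum2 : (ℤ → ℤ) → (ℤ → ℤ) → ℤ × ℤ → ℤ
sum2 h k pq = sq h (proj₁ pq) + sq k (proj₂ pq)

dsum2 : (ℤ → ℤ) → (ℤ → ℤ) → ℤ × ℤ → ℤ
dsum2 h k pq = d (sq h (proj₁ pq)) + d (sq k (proj₂ pq))

gf-sum2 : ∀ {h k f g} → GF (sq h) one f → GF (sq k) one g → GF (sum2 h k) one (f ⊛ g)
gf-sum2 {h} {k} p q = gf-× (sq-≥0 h) (sq-≥0 k) p q

gf-dsum2 : ∀ {h k f g} → GF (sq h) one f → GF (sq k) one g → GF (dsum2 h k) one (dil f ⊛ dil g)
gf-dsum2 {h} {k} p q = gf-× (λ s → +-≥0 (sq-≥0 h) (sq-≥0 h) (s , s)) (λ s → +-≥0 (sq-≥0 k) (sq-≥0 k) (s , s))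
    (gf-dil (λ _ → refl) (sq-≥0 h) p) (gf-dil (λ _ → refl) (sq-≥0 k) q)

-- For a, b ≡ 1 modulo 4 the half-sum is odd and the half-difference even. A half-sum that is 3
-- modulo 4 is replaced by its negative, which is what `iso-reflect` does.
ψ-rotate : ψ ⊛ ψ ≗ dil ψ ⊛ dil θ
ψ-rotate = gf-det (gf-piecewise split-difference (split-ℤparity ℤ) iso-add iso-reflect {e = sum2 h₄ h₄} {v = one} {e′ = dsum2 h₄ d} {v′ = one}
    (λ (q , τ) → even-eq q τ) (λ (q , τ) → odd-eq q τ) (λ _ → refl) (λ _ → refl) (gf-sum2 {h₄} {h₄} gψ gψ))
  (gf-dsum2 {h₄} {d} gψ gθ)
  where
  even-eq : ∀ q τ → let h = (q + τ) + (q + τ) + ((q + τ) + (q + τ)) + 1ℤ ; t = (τ + τ) + (τ + τ) ; p = ((τ + τ) + q) + ((τ + τ) + q) + (((τ + τ) + q) + ((τ + τ) + q)) + 1ℤ ; r = q + q + (q + q) + 1ℤ in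
      (h * h + h * h) + (t * t + t * t) ≡ p * p + r * r
  even-eq = solve-∀
  odd-eq : ∀ q τ → let s = - 1ℤ - q - τ ; h = s + s + (s + s) + 1ℤ ; t = (τ + τ + 1ℤ) + (τ + τ + 1ℤ) ; u = τ + τ + 1ℤ + q ; p = u + u + (u + u) + 1ℤ ; r = q + q + (q + q) + 1ℤ in
      (h * h + h * h) + (t * t + t * t) ≡ p * p + r * r
  odd-eq = solve-∀

-- For even a and b the half-sum and the half-difference have equal parity; the two parities give
-- the two products.
θ-rotate : θ ⊛ θ ≗ dil θ ⊛ dil θ ⊞ dil θ₂ ⊛ dil θ₂
θ-rotate = finish (gf-cut split-difference {e₁ = λ qτ → sum2 d d (d (proj₂ qτ) + proj₁ qτ , proj₁ qτ)} {v₁ = one}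
    {e₂ = λ qτ → sum2 d d (h₂ (proj₂ qτ) + proj₁ qτ , proj₁ qτ)} {v₂ = one}
    (λ _ → refl) (λ _ → refl) (λ _ → refl) (λ _ → refl) (gf-sum2 {d} {d} gθ gθ))
  where
  even-eq : ∀ q τ → let h = (q + τ) + (q + τ) ; t = τ + τ ; p = ((τ + τ) + q) + ((τ + τ) + q) ; r = q + q in
      (h * h + h * h) + (t * t + t * t) ≡ p * p + r * r
  even-eq = solve-∀
  odd-eq : ∀ q τ → let h = (q + τ) + (q + τ) + 1ℤ ; t = τ + τ + 1ℤ ; p = (τ + τ + 1ℤ + q) + (τ + τ + 1ℤ + q) ; r = q + q in
      (h * h + h * h) + (t * t + t * t) ≡ p * p + r * r
  odd-eq = solve-∀
  finish : Cut (λ qτ → sum2 d d (d (proj₂ qτ) + proj₁ qτ , proj₁ qτ)) one (λ qτ → sum2 d d (h₂ (proj₂ qτ) + proj₁ qτ , proj₁ qτ)) one (θ ⊛ θ) →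
    θ ⊛ θ ≗ dil θ ⊛ dil θ ⊞ dil θ₂ ⊛ dil θ₂
  finish (cut g h pg ph eq) n = trans (eq n) (⊞-cong
    (gf-det (gf-↔ (Iso.to iso-add) (Iso.from iso-add) (Iso.ft iso-add) (Iso.tf iso-add) (λ (q , τ) → even-eq q τ) (λ _ → refl) pg) (gf-dsum2 {d} {d} gθ gθ))
    (gf-det (gf-↔ (Iso.to iso-add) (Iso.from iso-add) (Iso.ft iso-add) (Iso.tf iso-add) (λ (q , τ) → odd-eq q τ) (λ _ → refl) ph) (gf-dsum2 {h₂} {h₂} gθ₂ gθ₂)) n)

gf-vcong : {A : Set} {e v u : A → ℤ} {f : Series} → (∀ x → u x ≡ v x) → GF e v f → GF e u f
gf-vcong h p = gf-↔ id id (λ _ → refl) (λ _ → refl) (λ _ → refl) h p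

-- Congruences modulo 2 and 4

even≢odd : ∀ {a b} → d a ≢ h₂ b
even≢odd {a} {b} h with trans (sym (Split.tf split-ℤparity₁ (inj₁ a))) (trans (cong (Split.to split-ℤparity₁) h) (Split.tf split-ℤparity₁ (inj₂ b)))
... | ()

d-injective : ∀ {a b} → d a ≡ d b → a ≡ b
d-injective {a} {b} h = inj₁-injective (trans (sym (Split.tf split-ℤparity₁ (inj₁ a))) (trans (cong (Split.to split-ℤparity₁) h) (Split.tf split-ℤparity₁ (inj₁ b))))

h₂-injective : ∀ {a b} → h₂ a ≡ h₂ b → a ≡ b
h₂-injective {a} {b} h = inj₂-injective (trans (sym (Split.tf split-ℤparity₁ (inj₂ a))) (trans (cong (Split.to split-ℤparity₁) h) (Split.tf split-ℤparity₁ (inj₂ b))))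

q : ℕ → ℕ
q k = (k ℕ.+ k) ℕ.+ (k ℕ.+ k)

+2q : ∀ k → + (2 ℕ.+ q k) ≡ d (h₂ (+ k))
+2q k = lem (+ k)
  where
  lem : ∀ k → + 2 + (k + k + (k + k)) ≡ k + k + 1ℤ + (k + k + 1ℤ)
  lem = solve-∀

+3q : ∀ k → + (3 ℕ.+ q k) ≡ h₂ (h₂ (+ k))
+3q k = lem (+ k)
  where
  lem : ∀ k → + 3 + (k + k + (k + k)) ≡ k + k + 1ℤ + (k + k + 1ℤ) + 1ℤ
  lem = solve-∀

square-mod4 : ∀ z → ∃[ c ] ((z * z ≡ d (d c)) ⊎ (z * z ≡ h₂ (d c)))
square-mod4 z with parityℤ z
... | evenℤ k = k * k , inj₁ (lem k)
  where
  lem : ∀ k → (k + k) * (k + k) ≡ k * k + k * k + (k * k + k * k)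
  lem = solve-∀
... | oddℤ k = k * k + k , inj₂ (lem k)
  where
  lem : ∀ k → (k + k + 1ℤ) * (k + k + 1ℤ) ≡ k * k + k + (k * k + k) + (k * k + k + (k * k + k)) + 1ℤ
  lem = solve-∀

Vanish₂₃ : Series → Set
Vanish₂₃ f = ∀ k → (f (2 ℕ.+ q k) ≡ 0ℤ) × (f (3 ℕ.+ q k) ≡ 0ℤ)

Res₀₁ : {A : Set} → (A → ℤ) → Set
Res₀₁ {A} e = ∀ x → ∃[ K ] ((e x ≡ d (d K)) ⊎ (e x ≡ h₂ (d K)))

gf-vanish₂₃ : {A : Set} {e v : A → ℤ} {f : Series} → Res₀₁ e → GF e v f → Vanish₂₃ f
gf-vanish₂₃ {e = e} res p k =
  gf-zero (2 ℕ.+ q k) (λ x h → two (res x) (trans h (+2q k))) p ,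
  gf-zero (3 ℕ.+ q k) (λ x h → three (res x) (trans h (+3q k))) p
  where
  two : ∀ {z} → ∃[ K ] ((z ≡ d (d K)) ⊎ (z ≡ h₂ (d K))) → z ≢ d (h₂ (+ k))
  two (K , inj₁ a) h = even≢odd {K} {+ k} (d-injective {d K} {h₂ (+ k)} (trans (sym a) h))
  two (K , inj₂ a) h = even≢odd {h₂ (+ k)} {d K} (trans (sym h) a)
  three : ∀ {z} → ∃[ K ] ((z ≡ d (d K)) ⊎ (z ≡ h₂ (d K))) → z ≢ h₂ (h₂ (+ k))
  three (K , inj₁ a) h = even≢odd {d K} {h₂ (+ k)} (trans (sym a) h)
  three (K , inj₂ a) h = even≢odd {K} {+ k} (h₂-injective {d K} {h₂ (+ k)} (trans (sym a) h))

gf-vanish-even : {A : Set} {e v : A → ℤ} {f : Series} → (∀ x → ∃[ K ] e x ≡ h₂ K) → GF e v f → ∀ m → f (m ℕ.+ m) ≡ 0ℤ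
gf-vanish-even od p m = gf-zero (m ℕ.+ m) (λ x h → even≢odd {+ m} {proj₁ (od x)} (trans (sym h) (proj₂ (od x)))) p

-- The sum of divisors: E = Σ σ(n) qⁿ over odd n

o : ℕ → ℤ
o x = 1ℤ + (+ x + + x)

oℕ : ℕ → ℕ
oℕ x = suc (x ℕ.+ x)

eE vE : ℕ × ℕ → ℤ
eE xy = o (proj₁ xy) * o (proj₂ xy)
vE xy = o (proj₂ xy)

boxE = boxℕ box× boxℕ

E : Series
E = gfSum boxE (λ xy → oℕ (proj₁ xy) ℕ.* oℕ (proj₂ xy)) vE

gE : GF eE vE E
gE = gf-↔ id id (λ _ → refl) (λ _ → refl) (λ xy → sym (ℤₚ.pos-* (oℕ (proj₁ xy)) (oℕ (proj₂ xy)))) (λ _ → refl)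
  (gf-box boxE _ vE (λ xy → ℕₚ.⊔-lub (bound₁ (proj₁ xy) (proj₂ xy)) (bound₂ (proj₁ xy) (proj₂ xy))))
  where
  k≤ok : ∀ k → k ℕ.≤ oℕ k
  k≤ok k = ℕₚ.m≤n⇒m≤1+n (ℕₚ.m≤m+n k k)
  bound₁ : ∀ x y → x ℕ.≤ oℕ x ℕ.* oℕ y
  bound₁ x y = ℕₚ.≤-trans (k≤ok x) (ℕₚ.m≤m*n (oℕ x) (oℕ y))
  bound₂ : ∀ x y → y ℕ.≤ oℕ x ℕ.* oℕ y
  bound₂ x y = ℕₚ.≤-trans (k≤ok y) (ℕₚ.m≤n*m (oℕ y) (oℕ x))

eE-≥0 : NonNeg eE
eE-≥0 xy = oℕ (proj₁ xy) ℕ.* oℕ (proj₂ xy) , sym (ℤₚ.pos-* (oℕ (proj₁ xy)) (oℕ (proj₂ xy)))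

E-even : ∀ m → E (m ℕ.+ m) ≡ 0ℤ
E-even = gf-vanish-even (λ (x , y) → + x * + y + + x * + y + + x + + y , lem (+ x) (+ y)) gE
  where
  lem : ∀ x y → (1ℤ + (x + x)) * (1ℤ + (y + y)) ≡ x * y + x * y + x + y + (x * y + x * y + x + y) + 1ℤ
  lem = solve-∀

-- An involution that keeps the degree and negates the weight gives f = -f.
gf-odd : {A : Set} {e v : A → ℤ} {f : Series} (σ : A → A) → (∀ x → σ (σ x) ≡ x) → (∀ x → e (σ x) ≡ e x) →
  (∀ x → - v (σ x) ≡ v x) → GF e v f → ∀ n → f n ≡ 0ℤ
gf-odd {v = v} {f} σ σσ eσ vσ p n = ℤₚ.*-cancelˡ-≡ (+ 2) (f n) 0ℤ (trans (double (f n)) (trans (cong (λ t → f n + t) (negf n)) (ℤₚ.+-inverseʳ (f n))))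
  where
  double : ∀ z → + 2 * z ≡ z + z
  double = solve-∀
  neg1 : ∀ z → -1ℤ * z ≡ - z
  neg1 = solve-∀
  negf : ∀ n → f n ≡ - f n
  negf n = trans (gf-det (gf-↔ σ σ σσ σσ eσ (λ x → trans (neg1 (v (σ x))) (vσ x)) p) (gf-scale -1ℤ p) n) (neg1 (f n))

-- Classes of triples: left (g, x, y) of degree g² + o(x) o(y), right (w, x, i) of degree w² + 2 o(x) o(i).
-- A left triple with y - x - g = 2i + 1 corresponds to the right triple with w = x + y + 1 - o(i).

eL : (ℕ × ℕ) × ℕ → ℤ
eL z = let x = + proj₁ (proj₁ z) ; y = + proj₂ (proj₁ z) ; i = proj₂ z ; g = y - x - o i in g * g + o (proj₁ (proj₁ z)) * o (proj₂ (proj₁ z))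

module Left where

  split-L : Split (ℤ × ℕ × ℕ) ((ℕ × ℕ) × ℤ) ((ℕ × ℕ) × ℤ)
  split-L = rearrange (λ z → proj₂ z , + proj₂ (proj₂ z) - + proj₁ (proj₂ z) - proj₁ z)
    (λ z → + proj₂ (proj₁ z) - + proj₁ (proj₁ z) - proj₂ z , proj₁ z)
    (λ (g , x , y) → cong (_, (x , y)) (lem (+ x) (+ y) g)) (λ ((x , y) , t) → cong ((x , y) ,_) (lem (+ x) (+ y) t)) (split-ℤparity (ℕ × ℕ))
    where
    lem : ∀ x y g → y - x - (y - x - g) ≡ g
    lem = solve-∀

  grade : (ℤ → ℤ) → (ℕ × ℕ) × ℤ → ℤ
  grade h z = sq (λ s → + proj₂ (proj₁ z) - + proj₁ (proj₁ z) - h s) (proj₂ z) + eE (proj₁ z)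

  -- With g = y - x - 2s the degree differs from (y - x + 1)² by a multiple of 4, so it is a square
  -- modulo 4.
  even-part : Res₀₁ (grade d)
  even-part ((x , y) , s) = go (square-mod4 (+ y - + x + 1ℤ))
    where
    K = s * s - s * (+ y - + x) + + x * + y + + x
    lem : ∀ x y s → (y - x - (s + s)) * (y - x - (s + s)) + (1ℤ + (x + x)) * (1ℤ + (y + y))
      ≡ (y - x + 1ℤ) * (y - x + 1ℤ) + (let K = s * s - s * (y - x) + x * y + x in (K + K) + (K + K))
    lem = solve-∀
    lem₀ : ∀ c K → c + c + (c + c) + (K + K + (K + K)) ≡ c + K + (c + K) + (c + K + (c + K))
    lem₀ = solve-∀
    lem₁ : ∀ c K → c + c + (c + c) + 1ℤ + (K + K + (K + K)) ≡ c + K + (c + K) + (c + K + (c + K)) + 1ℤ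
    lem₁ = solve-∀
    go : ∃[ c ] (((+ y - + x + 1ℤ) * (+ y - + x + 1ℤ) ≡ d (d c)) ⊎ ((+ y - + x + 1ℤ) * (+ y - + x + 1ℤ) ≡ h₂ (d c))) →
      ∃[ c ] ((grade d ((x , y) , s) ≡ d (d c)) ⊎ (grade d ((x , y) , s) ≡ h₂ (d c)))
    go (c , inj₁ e) = c + K , inj₁ (trans (lem (+ x) (+ y) s) (trans (cong (_+ d (d K)) e) (lem₀ c K)))
    go (c , inj₂ e) = c + K , inj₂ (trans (lem (+ x) (+ y) s) (trans (cong (_+ d (d K)) e) (lem₁ c K)))

  swap-eq : ∀ x y i → let o = λ (x : ℤ) → 1ℤ + (x + x) ; sqr = λ (x : ℤ) → x * x in sqr (x - y - o i) + o y * o x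
    ≡ sqr (y - x - (- (1ℤ + i) + - (1ℤ + i) + 1ℤ)) + o x * o y
  swap-eq = solve-∀

  pos-eq : ∀ x y i → (y - x - (1ℤ + (i + i))) * (y - x - (1ℤ + (i + i))) + (1ℤ + (x + x)) * (1ℤ + (y + y))
    ≡ (y - x - (i + i + 1ℤ)) * (y - x - (i + i + 1ℤ)) + (1ℤ + (x + x)) * (1ℤ + (y + y))
  pos-eq = solve-∀

  Odd : Series → Set
  Odd = Cut eL (λ z → o (proj₂ (proj₁ z))) eL (λ z → o (proj₁ (proj₁ z)))

  -- A triple with negative i is the image under x ↔ y, g ↦ -g of one with i ≥ 0; this moves the
  -- weight from y to x.
  odd-part : ∀ {f} → GF (grade h₂) (λ z → o (proj₂ (proj₁ z))) f → Odd f
  odd-part p = finish (gf-cut (split-sign (ℕ × ℕ)) {e₁ = eL} {v₁ = λ z → o (proj₂ (proj₁ z))}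
      {e₂ = λ z → grade h₂ (proj₁ z , -[1+ proj₂ z ])} {v₂ = λ z → o (proj₂ (proj₁ z))}
      (λ ((x , y) , i) → pos-eq (+ x) (+ y) (+ i)) (λ _ → refl) (λ _ → refl) (λ _ → refl) p)
    where
    swap : (ℕ × ℕ) × ℕ → (ℕ × ℕ) × ℕ
    swap ((x , y) , i) = (y , x) , i
    finish : ∀ {f} → Cut eL (λ z → o (proj₂ (proj₁ z))) (λ z → grade h₂ (proj₁ z , -[1+ proj₂ z ])) (λ z → o (proj₂ (proj₁ z))) f → Odd f
    finish (cut a b pa pb eq) = cut a b pa
      (gf-↔ swap swap (λ _ → refl) (λ _ → refl) (λ ((x , y) , i) → swap-eq (+ x) (+ y) (+ i)) (λ _ → refl) pb) eq

module Right where

  eR : ℤ × ℕ × ℕ → ℤ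
  eR z = sq id (proj₁ z) + d (eE (proj₂ z))

  gR : GF eR (λ z → o (proj₂ (proj₂ z))) (Θ ⊛ dil E)
  gR = gf-vcong (λ z → sym (ℤₚ.*-identityˡ _)) (gf-× {e = sq id} {e′ = λ z → d (eE z)} (sq-≥0 id) (λ z → +-≥0 eE-≥0 eE-≥0 (z , z)) gΘ (gf-dil (λ _ → refl) eE-≥0 gE))

  split-R : Split (ℤ × ℕ × ℕ) ((ℕ × ℕ) × ℕ) ((ℕ × ℕ) × ℕ)
  split-R = rearrange (λ z → proj₂ z , proj₁ z + o (proj₂ (proj₂ z)) - 1ℤ - + proj₁ (proj₂ z))
    (λ z → proj₂ z + 1ℤ + + proj₁ (proj₁ z) - o (proj₂ (proj₁ z)) , proj₁ z)
    (λ (w , x , i) → cong (_, (x , i)) (lem₁ w (+ x) (o i))) (λ ((x , i) , t) → cong ((x , i) ,_) (lem₂ t (+ x) (o i))) (split-sign (ℕ × ℕ))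
    where
    lem₁ : ∀ w x j → w + j - 1ℤ - x + 1ℤ + x - j ≡ w
    lem₁ = solve-∀
    lem₂ : ∀ t x j → t + 1ℤ + x - j + j - 1ℤ - x ≡ t
    lem₂ = solve-∀

  -- The weight w is odd, so it may be added to the weight o(i) of the right class.
  gR′ : GF eR (λ z → o (proj₂ (proj₂ z)) + proj₁ z) (Θ ⊛ dil E)
  gR′ = gf-resp (λ n → trans (cong (λ t → (Θ ⊛ dil E) n + t) (zero-w n)) (ℤₚ.+-identityʳ _)) (gf-+ gR (proj₂ rw))
    where
    rw = gf-reweight proj₁ gR
    neg² : ∀ w → - - w ≡ w
    neg² = solve-∀
    neg-sq : ∀ w a → - w * - w + a ≡ w * w + a
    neg-sq = solve-∀
    zero-w : ∀ n → proj₁ rw n ≡ 0ℤ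
    zero-w = gf-odd (λ z → - proj₁ z , proj₂ z) (λ (w , z) → cong (_, z) (neg² w)) (λ (w , z) → neg-sq w (d (eE z))) (λ (w , z) → neg² w) (proj₂ rw)

  left-eq : ∀ x y i → let o = λ (x : ℤ) → 1ℤ + (x + x) in (y - x - o i) * (y - x - o i) + o x * o y
    ≡ (y + 1ℤ + x - o i) * (y + 1ℤ + x - o i) + (o x * o i + o x * o i)
  left-eq = solve-∀

  left-weight : ∀ x y j → y + x + 1ℤ ≡ j + (y + 1ℤ + x - j)
  left-weight = solve-∀

  right-weight : ∀ x y j → x - y ≡ j + (- (1ℤ + y) + 1ℤ + x - j)
  right-weight = solve-∀

  right-sym : ∀ x y i → let j = 1ℤ + (i + i) in
    (- (1ℤ + x) + 1ℤ + y - j) * (- (1ℤ + x) + 1ℤ + y - j) + ((1ℤ + (y + y)) * j + (1ℤ + (y + y)) * j)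
    ≡ (- (1ℤ + y) + 1ℤ + x - j) * (- (1ℤ + y) + 1ℤ + x - j) + ((1ℤ + (x + x)) * j + (1ℤ + (x + x)) * j)
  right-sym = solve-∀

  neg-minus : ∀ x y → - (y - x) ≡ x - y
  neg-minus = solve-∀

  eK : (ℕ × ℕ) × ℕ → ℤ
  eK z = eR (-[1+ proj₂ z ] + 1ℤ + + proj₁ (proj₁ z) - o (proj₂ (proj₁ z)) , proj₁ z)

  vL : (ℕ × ℕ) × ℕ → ℤ
  vL z = + proj₂ (proj₁ z) + + proj₁ (proj₁ z) + 1ℤ

  -- Put y = w + o(i) - 1 - x. For y ≥ 0 the terms are the left triples with weight x + y + 1. For y
  -- < 0 the degree is symmetric and the weight antisymmetric in x and -1 - y, so these terms
  -- cancel.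
  right : GF eL vL (Θ ⊛ dil E)
  right = finish (gf-cut split-R {e₁ = λ z → eL ((proj₁ (proj₁ z) , proj₂ z) , proj₂ (proj₁ z))}
      {v₁ = λ z → + proj₂ z + + proj₁ (proj₁ z) + 1ℤ} {e₂ = eK} {v₂ = λ z → + proj₁ (proj₁ z) - + proj₂ z}
      (λ ((x , i) , y) → left-eq (+ x) (+ y) (+ i)) (λ _ → refl)
      (λ ((x , i) , y) → left-weight (+ x) (+ y) (o i)) (λ ((x , i) , y) → right-weight (+ x) (+ y) (o i)) gR′)
    where
    finish : Cut (λ z → eL ((proj₁ (proj₁ z) , proj₂ z) , proj₂ (proj₁ z))) (λ z → + proj₂ z + + proj₁ (proj₁ z) + 1ℤ)
      eK (λ z → + proj₁ (proj₁ z) - + proj₂ z) (Θ ⊛ dil E) → GF eL vL (Θ ⊛ dil E)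
    finish (cut a b pa pb eq) = gf-resp (λ n → sym (trans (eq n) (trans (cong (λ t → a n + t) (zero-b n)) (ℤₚ.+-identityʳ _))))
      (gf-↔ (λ ((x , i) , y) → (x , y) , i) (λ ((x , y) , i) → (x , i) , y) (λ _ → refl) (λ _ → refl) (λ _ → refl) (λ _ → refl) pa)
      where
      zero-b : ∀ n → b n ≡ 0ℤ
      zero-b = gf-odd (λ ((x , i) , y) → (y , i) , x) (λ _ → refl) (λ ((x , i) , y) → right-sym (+ x) (+ y) (+ i)) (λ ((x , i) , y) → neg-minus (+ x) (+ y)) pb

-- The left triples with odd y - x - g have total weight o(x) + o(y) = 2(x + y + 1), twice the
-- weight on the right. Those with even y - x - g make up the remainder.
ΘE : Σ[ r ∈ Series ] Vanish₂₃ r × (Θ ⊛ E ≗ (Θ ⊛ dil E ⊞ Θ ⊛ dil E) ⊞ r)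
ΘE = finish (gf-cut Left.split-L {e₁ = Left.grade d} {v₁ = λ z → o (proj₂ (proj₁ z))} {e₂ = Left.grade h₂} {v₂ = λ z → o (proj₂ (proj₁ z))}
    (λ _ → refl) (λ _ → refl) (λ z → sym (ℤₚ.*-identityˡ _)) (λ z → sym (ℤₚ.*-identityˡ _)) (gf-× {e = sq id} {e′ = eE} (sq-≥0 id) eE-≥0 gΘ gE))
  where
  weights : ∀ x y → y + x + 1ℤ + (y + x + 1ℤ) ≡ 1ℤ + (y + y) + (1ℤ + (x + x))
  weights = solve-∀
  twice : ∀ {f} → Left.Odd f → f ≗ Θ ⊛ dil E ⊞ Θ ⊛ dil E
  twice (cut a b pa pb eq) n = trans (eq n) (gf-det (gf-vcong (λ ((x , y) , i) → weights (+ x) (+ y)) (gf-+ pa pb)) (gf-+ Right.right Right.right) n)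
  finish : Cut (Left.grade d) (λ z → o (proj₂ (proj₁ z))) (Left.grade h₂) (λ z → o (proj₂ (proj₁ z))) (Θ ⊛ E) →
    Σ[ r ∈ Series ] Vanish₂₃ r × (Θ ⊛ E ≗ (Θ ⊛ dil E ⊞ Θ ⊛ dil E) ⊞ r)
  finish (cut a b pa pb eq) = a , gf-vanish₂₃ Left.even-part pa ,
    λ n → trans (eq n) (trans (cong (λ t → a n + t) (twice (Left.odd-part pb) n)) (ℤₚ.+-comm (a n) _))

-- E is the series E₀ = ψθ(4ψ² + θ²): both satisfy the recurrence of ΘE, which determines them.

Rec : Series → Set
Rec f = Σ[ r ∈ Series ] Vanish₂₃ r × (Θ ⊛ f ≗ (Θ ⊛ dil f ⊞ Θ ⊛ dil f) ⊞ r)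

rec-minus : ∀ {f g} → Rec f → Rec g → Rec (f ⊞ -1ℤ ⊙ g)
rec-minus {f} {g} (r , vr , er) (s , vs , es) = r ⊞ -1ℤ ⊙ s ,
  (λ k → cong₂ (λ a b → a + -1ℤ * b) (proj₁ (vr k)) (proj₁ (vs k)) , cong₂ (λ a b → a + -1ℤ * b) (proj₂ (vr k)) (proj₂ (vs k))) ,
  λ n → trans (lin f g n) (trans (cong₂ (λ a b → a + -1ℤ * b) (er n) (es n)) (trans (rearr ((Θ ⊛ dil f) n) (r n) ((Θ ⊛ dil g) n) (s n))
    (cong (λ t → t + t + (r n + -1ℤ * s n)) {x = (Θ ⊛ dil f) n + -1ℤ * (Θ ⊛ dil g) n} (sym (trans (⊛-cong {f = Θ} (λ _ → refl) (λ m → trans (dil-⊞ f (-1ℤ ⊙ g) m) (cong (λ t → dil f m + t) (dil-⊙ -1ℤ g m))) n) (lin (dil f) (dil g) n))))))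
  where
  lin : ∀ f g → Θ ⊛ (f ⊞ -1ℤ ⊙ g) ≗ Θ ⊛ f ⊞ -1ℤ ⊙ (Θ ⊛ g)
  lin f g n = trans (⊛-distribˡ Θ f (-1ℤ ⊙ g) n) (cong (λ t → (Θ ⊛ f) n + t) (⊛-scaleʳ -1ℤ Θ g n))
  rearr : ∀ a b c e → a + a + b + -1ℤ * (c + c + e) ≡ a + -1ℤ * c + (a + -1ℤ * c) + (b + -1ℤ * e)
  rearr = solve-∀

-- For n ≡ 3 modulo 4 the coefficient at n determines f(n). For n ≡ 1 the coefficient at n + 1 does:
-- `Θ` contributes 2 f(n), since f(n + 1) = 0. On the right only f(i) with 2i ≤ n + 1 enters, which
-- is below n except for n = 1.
rec-zero : ∀ f → Rec f → (∀ m → f (m ℕ.+ m) ≡ 0ℤ) → f 1 ≡ 0ℤ → ∀ n → f n ≡ 0ℤ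
rec-zero f (r , vr , er) ev f1 = <-rec (λ n → f n ≡ 0ℤ) λ n ih → step n (λ i → ih {i})
  where
  dil-low : ∀ N n → (∀ i → i ℕ.< n → f i ≡ 0ℤ) → N ℕ.< n ℕ.+ n → dil f N ≡ 0ℤ
  dil-low N n ih N<2n with parity N
  ... | odd m  = dil-odd f m
  ... | even m = trans (dil-2* f m) (ih m (ℕₚ.≰⇒> (λ n≤m → ℕₚ.<⇒≱ N<2n (ℕₚ.+-mono-≤ n≤m n≤m))))
  rhs : ∀ N n → (∀ i → i ℕ.< n → f i ≡ 0ℤ) → N ℕ.< n ℕ.+ n → r N ≡ 0ℤ → (Θ ⊛ f) N ≡ 0ℤ
  rhs N n ih N<2n rN = trans (er N) (cong₂ (λ a b → a + a + b) low rN)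
    where
    low : (Θ ⊛ dil f) N ≡ 0ℤ
    low = trans (⊛-low₀ Θ (dil f) N (λ i i<N → dil-low i n ih (ℕₚ.<-trans i<N N<2n))) (cong (Θ 0 *_) (dil-low N n ih N<2n))
  step : ∀ n → (∀ i → i ℕ.< n → f i ≡ 0ℤ) → f n ≡ 0ℤ
  step n ih with parity n
  ... | even m = ev m
  ... | odd m with parity m
  ...   | odd k = trans (sym (ℤₚ.*-identityˡ _)) (trans (sym (⊛-low₀ Θ f N ih))
            (rhs N N ih (ℕₚ.m<m+n N (s≤s z≤n)) (subst (λ t → r t ≡ 0ℤ) (sym N≡) (proj₂ (vr k)))))
    where
    N = suc (suc (k ℕ.+ k) ℕ.+ suc (k ℕ.+ k))
    N≡ : N ≡ 3 ℕ.+ q k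
    N≡ = cong (λ t → suc (suc t)) (ℕₚ.+-suc (k ℕ.+ k) (k ℕ.+ k))
  ...   | even zero = f1
  ...   | even (suc k) = ℤₚ.*-cancelˡ-≡ (+ 2) (f N) 0ℤ (trans (sym (trans (⊛-low₁ Θ f N ih) (trans (cong (λ t → 1ℤ * t + + 2 * f N) evN) (ℤₚ.+-identityˡ _))))
            (rhs (suc N) N ih 1+N<2N (subst (λ t → r t ≡ 0ℤ) (sym N≡) (proj₁ (vr (suc k))))))
    where
    m′ = suc k ℕ.+ suc k
    N = suc (m′ ℕ.+ m′)
    N≡ : suc N ≡ 2 ℕ.+ q (suc k)
    N≡ = refl
    evN : f (suc N) ≡ 0ℤ
    evN = subst (λ t → f t ≡ 0ℤ) (cong suc (ℕₚ.+-suc m′ m′)) (ev (suc m′))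
    1+N<2N : suc N ℕ.< N ℕ.+ N
    1+N<2N = ℕₚ.+-monoˡ-≤ N (s≤s (s≤s z≤n))

E₀ : Series
E₀ = ψ ⊛ θ ⊛ (((ψ ⊛ ψ ⊞ ψ ⊛ ψ) ⊞ (ψ ⊛ ψ ⊞ ψ ⊛ ψ)) ⊞ θ ⊛ θ)

-- Since 4ψ² = θ₂², the last factor dilates to θ₂(q²)² + θ(q²)² = θ², and the rotation of ψ² takes
-- care of the other two.
dil-E₀ : dil E₀ ≗ ψ ⊛ ψ ⊛ (θ ⊛ θ)
dil-E₀ n = trans (dil-⊛ (ψ ⊛ θ) _ n) (⊛-cong
  (λ m → trans (dil-⊛ ψ θ m) (sym (ψ-rotate m)))
  (λ m → trans (dil-⊞ ((ψ ⊛ ψ ⊞ ψ ⊛ ψ) ⊞ (ψ ⊛ ψ ⊞ ψ ⊛ ψ)) (θ ⊛ θ) m) (trans (cong₂ _+_ (four m) (dil-⊛ θ θ m)) (trans (ℤₚ.+-comm _ ((dil θ ⊛ dil θ) m)) (sym (θ-rotate m))))) n)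
  where
  four : dil ((ψ ⊛ ψ ⊞ ψ ⊛ ψ) ⊞ (ψ ⊛ ψ ⊞ ψ ⊛ ψ)) ≗ dil θ₂ ⊛ dil θ₂
  four m = trans (dil-cong (solve 1 (λ p → (p :* p :+ p :* p) :+ (p :* p :+ p :* p) := (p :+ p) :* (p :+ p)) (λ _ → refl) ψ) m)
    (trans (dil-cong {g = θ₂ ⊛ θ₂} (λ i → sym (⊛-cong θ₂-split θ₂-split i)) m) (dil-⊛ θ₂ θ₂ m))

ψθ : GF (sum2 h₄ d) one (ψ ⊛ θ)
ψθ = gf-sum2 {h₄} {d} gψ gθ

≥0₂ : ∀ h k → NonNeg (sum2 h k)
≥0₂ h k = +-≥0 (sq-≥0 h) (sq-≥0 k)

cubes : ∀ {h f} → GF (sq h) one f → GF (λ z → sum2 h h (proj₁ z) + sq h (proj₂ z)) one (f ⊛ f ⊛ f)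
cubes {h} p = gf-× {e = sum2 h h} (≥0₂ h h) (sq-≥0 h) (gf-sum2 {h} {h} p p) p

-- In the remainder `ψθ` has degrees 1 modulo 4; three even squares add 0 and three odd squares add
-- 3, so all degrees are 1 or 0 modulo 4.
E₀-rec : Rec E₀
E₀-rec = ψ ⊛ θ ⊛ (θ ⊛ θ ⊛ θ ⊞ θ₂ ⊛ θ₂ ⊛ θ₂) , vanish , eq
  where
  vanish₁ : Vanish₂₃ (ψ ⊛ θ ⊛ (θ ⊛ θ ⊛ θ))
  vanish₁ = gf-vanish₂₃ (λ ((p , t) , ((a , b) , c)) → (let K = (p + p) * (p + p) + (p + p) + t * t + a * a + b * b + c * c in K) , inj₂ (lem p t a b c))
    (gf-× {e = sum2 h₄ d} (≥0₂ h₄ d) (+-≥0 (≥0₂ d d) (sq-≥0 d)) ψθ (cubes {d} gθ))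
    where
    lem : ∀ p t a b c → ((p + p + (p + p) + 1ℤ) * (p + p + (p + p) + 1ℤ) + (t + t) * (t + t)) + (((a + a) * (a + a) + (b + b) * (b + b)) + (c + c) * (c + c))
      ≡ (let K = (p + p) * (p + p) + (p + p) + t * t + a * a + b * b + c * c in (K + K) + (K + K) + 1ℤ)
    lem = solve-∀
  vanish₂ : Vanish₂₃ (ψ ⊛ θ ⊛ (θ₂ ⊛ θ₂ ⊛ θ₂))
  vanish₂ = gf-vanish₂₃ (λ ((p , t) , ((a , b) , c)) → (let K = (p + p) * (p + p) + (p + p) + t * t + a * a + b * b + c * c + a + b + c + 1ℤ in K) , inj₁ (lem p t a b c))
    (gf-× {e = sum2 h₄ d} (≥0₂ h₄ d) (+-≥0 (≥0₂ h₂ h₂) (sq-≥0 h₂)) ψθ (cubes {h₂} gθ₂))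
    where
    lem : ∀ p t a b c → ((p + p + (p + p) + 1ℤ) * (p + p + (p + p) + 1ℤ) + (t + t) * (t + t)) + (((a + a + 1ℤ) * (a + a + 1ℤ) + (b + b + 1ℤ) * (b + b + 1ℤ)) + (c + c + 1ℤ) * (c + c + 1ℤ))
      ≡ (let K = (p + p) * (p + p) + (p + p) + t * t + a * a + b * b + c * c + a + b + c + 1ℤ in (K + K) + (K + K))
    lem = solve-∀
  vanish : Vanish₂₃ (ψ ⊛ θ ⊛ (θ ⊛ θ ⊛ θ ⊞ θ₂ ⊛ θ₂ ⊛ θ₂))
  vanish k = trans (⊛-distribˡ (ψ ⊛ θ) (θ ⊛ θ ⊛ θ) (θ₂ ⊛ θ₂ ⊛ θ₂) (2 ℕ.+ q k)) (cong₂ _+_ (proj₁ (vanish₁ k)) (proj₁ (vanish₂ k))) ,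
             trans (⊛-distribˡ (ψ ⊛ θ) (θ ⊛ θ ⊛ θ) (θ₂ ⊛ θ₂ ⊛ θ₂) (3 ℕ.+ q k)) (cong₂ _+_ (proj₂ (vanish₁ k)) (proj₂ (vanish₂ k)))
  Θ≗ : Θ ≗ θ ⊞ (ψ ⊞ ψ)
  Θ≗ n = trans (Θ-split n) (cong (λ t → θ n + t) (θ₂-split n))
  side : Θ ⊛ dil E₀ ≗ (θ ⊞ (ψ ⊞ ψ)) ⊛ (ψ ⊛ ψ ⊛ (θ ⊛ θ))
  side = ⊛-cong Θ≗ dil-E₀
  cube : θ₂ ⊛ θ₂ ⊛ θ₂ ≗ (ψ ⊞ ψ) ⊛ (ψ ⊞ ψ) ⊛ (ψ ⊞ ψ)
  cube = ⊛-cong (⊛-cong θ₂-split θ₂-split) θ₂-split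
  eq : Θ ⊛ E₀ ≗ (Θ ⊛ dil E₀ ⊞ Θ ⊛ dil E₀) ⊞ ψ ⊛ θ ⊛ (θ ⊛ θ ⊛ θ ⊞ θ₂ ⊛ θ₂ ⊛ θ₂)
  eq n = trans (⊛-cong {g = E₀} Θ≗ (λ _ → refl) n) (trans (ΘE₀ ψ θ n)
    (cong₂ _+_ (cong₂ _+_ (sym (side n)) (sym (side n)))
      (⊛-cong {f = ψ ⊛ θ} (λ _ → refl) (λ m → cong (λ t → (θ ⊛ θ ⊛ θ) m + t) (sym (cube m))) n)))

E₀-even : ∀ m → E₀ (m ℕ.+ m) ≡ 0ℤ
E₀-even m = trans (⊛-distribˡ (ψ ⊛ θ) _ (θ ⊛ θ) (m ℕ.+ m)) (cong₂ _+_ (trans (dist (ψ ⊛ ψ ⊞ ψ ⊛ ψ) (ψ ⊛ ψ ⊞ ψ ⊛ ψ)) (cong₂ _+_ two two)) θθ)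
  where
  dist : ∀ f g → (ψ ⊛ θ ⊛ (f ⊞ g)) (m ℕ.+ m) ≡ (ψ ⊛ θ ⊛ f) (m ℕ.+ m) + (ψ ⊛ θ ⊛ g) (m ℕ.+ m)
  dist f g = ⊛-distribˡ (ψ ⊛ θ) f g (m ℕ.+ m)
  lem₁ : ∀ p t a b → ((p + p + (p + p) + 1ℤ) * (p + p + (p + p) + 1ℤ) + (t + t) * (t + t)) + ((a + a) * (a + a) + (b + b) * (b + b))
      ≡ (let K = (p + p) * (p + p) + (p + p) + t * t + a * a + b * b in (K + K) + (K + K) + 1ℤ)
  lem₁ = solve-∀
  lem₂ : ∀ p t a b → ((p + p + (p + p) + 1ℤ) * (p + p + (p + p) + 1ℤ) + (t + t) * (t + t)) + ((a + a + (a + a) + 1ℤ) * (a + a + (a + a) + 1ℤ) + (b + b + (b + b) + 1ℤ) * (b + b + (b + b) + 1ℤ))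
      ≡ (let K = (p + p) * (p + p) + (p + p) + t * t + (a + a) * (a + a) + (a + a) + (b + b) * (b + b) + (b + b) in (K + K + 1ℤ) + (K + K + 1ℤ) + 1ℤ)
  lem₂ = solve-∀
  θθ : (ψ ⊛ θ ⊛ (θ ⊛ θ)) (m ℕ.+ m) ≡ 0ℤ
  θθ = gf-vanish-even (λ ((p , t) , (a , b)) → (let K = (p + p) * (p + p) + (p + p) + t * t + a * a + b * b in K + K) , lem₁ p t a b)
    (gf-× {e = sum2 h₄ d} {e′ = sum2 d d} (≥0₂ h₄ d) (≥0₂ d d) ψθ (gf-sum2 {d} {d} gθ gθ)) m
  one′ : (ψ ⊛ θ ⊛ (ψ ⊛ ψ)) (m ℕ.+ m) ≡ 0ℤ
  one′ = gf-vanish-even (λ ((p , t) , (a , b)) → (let K = (p + p) * (p + p) + (p + p) + t * t + (a + a) * (a + a) + (a + a) + (b + b) * (b + b) + (b + b) in K + K + 1ℤ) , lem₂ p t a b)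
    (gf-× {e = sum2 h₄ d} {e′ = sum2 h₄ h₄} (≥0₂ h₄ d) (≥0₂ h₄ h₄) ψθ (gf-sum2 {h₄} {h₄} gψ gψ)) m
  two : (ψ ⊛ θ ⊛ (ψ ⊛ ψ ⊞ ψ ⊛ ψ)) (m ℕ.+ m) ≡ 0ℤ
  two = trans (dist (ψ ⊛ ψ) (ψ ⊛ ψ)) (cong₂ _+_ one′ one′)

E≗E₀ : E ≗ E₀
E≗E₀ n = trans (lem (E n) (E₀ n)) (trans (cong (_+ E₀ n) (rec-zero (E ⊞ -1ℤ ⊙ E₀) (rec-minus ΘE E₀-rec)
  -- The `refl` evaluates both series at 1, the odd index whose value the recurrence leaves free.
  (λ m → cong₂ (λ a b → a + -1ℤ * b) (E-even m) (E₀-even m)) refl n)) (ℤₚ.+-identityˡ (E₀ n)))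
  where
  lem : ∀ a b → a ≡ a + -1ℤ * b + b
  lem = solve-∀

-- the four-square theorem of Jacobi, for the residue class of two odd and two even squares
dil-E : dil E ≗ ψ ⊛ ψ ⊛ (θ ⊛ θ)
dil-E n = trans (dil-cong E≗E₀ n) (dil-E₀ n)

-- The balance of two classes of quadruples, used for both families of forms

-- Quadruples (A , J , m , k) stand for a = o(A), j = o(J), D = o(m), and G for the even number g = 2(G + 1).

g₂ : ℕ → ℤ
g₂ G = (1ℤ + + G) + (1ℤ + + G)

ℕ⁴ : Set
ℕ⁴ = ℕ × ℕ × ℕ × ℕ

eZ : ℕ⁴ → ℤ
eZ (G , X , F , E) = g₂ G * g₂ G + d (o X * o F + g₂ G * + E)

-- This is `eZ` with E replaced by E + f, and equally with x replaced by x + g.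
eW : ℕ⁴ → ℤ
eW (G , X , F , E) = g₂ G * g₂ G + d (o X * o F + g₂ G * o F + g₂ G * + E)

module _ (κ : ℕ → ℕ) where

  -- With D = w - b, j = a + b and c = a + 4κ(k) this is w² + ac - b², the degree of a square times
  -- a form ax² + 2bxy + cy².
  eT₁ : ℕ⁴ → ℤ
  eT₁ (A , J , m , k) = (o m - o A) * (o m - o A) + d (o m * o J) + d (d (o A * + κ k))

  -- This is `eT₁` with j replaced by j + 2a, and equally with κ(k) replaced by κ(k) + D. Each
  -- reading serves one of the two families of forms.
  eT₂ : ℕ⁴ → ℤ
  eT₂ (A , J , m , k) = (o m + o A) * (o m + o A) + d (o m * o J) + d (d (o A * + κ k))

  -- the parts D = a + g and a = D + g of the class eT₁
  eU₁ : ℕ⁴ → ℤ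
  eU₁ (A , G , J , k) = g₂ G * g₂ G + d ((o A + g₂ G) * o J) + d (d (o A * + κ k))

  eU₂ : ℕ⁴ → ℤ
  eU₂ (m , G , J , k) = g₂ G * g₂ G + d (o m * o J) + d (d ((o m + g₂ G) * + κ k))

gfZ : Σ[ z ∈ Series ] GF eZ one z
gfZ = _ , gf-↔ id id (λ _ → refl) (λ _ → refl) (λ (G , X , F , E) → sym (eq G X F E)) (λ _ → refl)
  (gf-box (boxℕ box× boxℕ box× boxℕ box× boxℕ) eℕ one
    (λ (G , X , F , E) → ℕₚ.⊔-lub (bG G X F E) (ℕₚ.⊔-lub (bX G X F E) (ℕₚ.⊔-lub (bF G X F E) (bE G X F E)))))
  where
  gℕ : ℕ → ℕ
  gℕ G = suc G ℕ.+ suc G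
  h : ℕ⁴ → ℕ
  h (G , X , F , E) = oℕ X ℕ.* oℕ F ℕ.+ gℕ G ℕ.* E
  eℕ : ℕ⁴ → ℕ
  eℕ (G , X , F , E) = gℕ G ℕ.* gℕ G ℕ.+ (h (G , X , F , E) ℕ.+ h (G , X , F , E))
  eq : ∀ G X F E → + eℕ (G , X , F , E) ≡ eZ (G , X , F , E)
  eq G X F E = cong₂ _+_ (ℤₚ.pos-* (gℕ G) (gℕ G)) (cong₂ _+_ h≡ h≡)
    where
    h≡ : + h (G , X , F , E) ≡ o X * o F + g₂ G * + E
    h≡ = cong₂ _+_ (ℤₚ.pos-* (oℕ X) (oℕ F)) (ℤₚ.pos-* (gℕ G) E)
  h≤ : ∀ G X F E → h (G , X , F , E) ℕ.≤ eℕ (G , X , F , E)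
  h≤ G X F E = ℕₚ.≤-trans (ℕₚ.m≤m+n (h (G , X , F , E)) _) (ℕₚ.m≤n+m _ (gℕ G ℕ.* gℕ G))
  k≤ok : ∀ k → k ℕ.≤ oℕ k
  k≤ok k = ℕₚ.m≤n⇒m≤1+n (ℕₚ.m≤m+n k k)
  bG : ∀ G X F E → G ℕ.≤ eℕ (G , X , F , E)
  bG G X F E = ℕₚ.≤-trans (ℕₚ.≤-trans (ℕₚ.≤-trans (ℕₚ.n≤1+n G) (ℕₚ.m≤m+n (suc G) (suc G))) (ℕₚ.m≤m*n (gℕ G) (gℕ G))) (ℕₚ.m≤m+n _ _)
  bX : ∀ G X F E → X ℕ.≤ eℕ (G , X , F , E)
  bX G X F E = ℕₚ.≤-trans (ℕₚ.≤-trans (ℕₚ.≤-trans (k≤ok X) (ℕₚ.m≤m*n (oℕ X) (oℕ F))) (ℕₚ.m≤m+n _ _)) (h≤ G X F E)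
  bF : ∀ G X F E → F ℕ.≤ eℕ (G , X , F , E)
  bF G X F E = ℕₚ.≤-trans (ℕₚ.≤-trans (ℕₚ.≤-trans (k≤ok F) (ℕₚ.m≤n*m (oℕ F) (oℕ X))) (ℕₚ.m≤m+n _ _)) (h≤ G X F E)
  bE : ∀ G X F E → E ℕ.≤ eℕ (G , X , F , E)
  bE G X F E = ℕₚ.≤-trans (ℕₚ.≤-trans (ℕₚ.m≤n*m E (gℕ G)) (ℕₚ.m≤n+m _ (oℕ X ℕ.* oℕ F))) (h≤ G X F E)

record Core : Set where
  field
    u₁ u₂ t₂ : Series
    gu₁ : GF (eU₁ suc) one u₁
    gu₂ : GF (eU₂ id) one u₂
    gt₂ : GF (eT₂ id) one t₂
    balance : u₁ ⊞ u₂ ≗ t₂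

-- The class eZ splits according to E < f or E ≥ f, and according to x < g or x > g; the complements of the
-- first alternatives are exchanged by (x , E) ↦ (x + g , E - f).
core : Core
core = record
  { u₁ = Cut.part₁ cO ; u₂ = Cut.part₂ cE ; t₂ = Cut.part₁ cVO ⊞ Cut.part₂ cVO
  ; gu₁ = gf-↔ (λ ((G , X) , J , k) → X , G , J , k) (λ (X , G , J , k) → (G , X) , J , k) (λ _ → refl) (λ _ → refl)
      (λ ((G , X) , J , k) → u₁-eq (+ G) (+ X) (+ J) (+ k)) (λ _ → refl) (Cut.gf₁ cO)
  ; gu₂ = gf-↔ (λ ((G , X) , k , J) → X , G , J , k) (λ (X , G , J , k) → (G , X) , k , J) (λ _ → refl) (λ _ → refl)
      (λ ((G , X) , k , J) → u₂-eq (+ G) (+ X) (+ J) (+ k)) (λ _ → refl) (Cut.gf₂ cE)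
  ; gt₂ = gf-resp (λ n → ℤₚ.+-comm (Cut.part₂ cVO n) (Cut.part₁ cVO n)) (gf-join (rearrange (λ (A , J , m , k) → (A , m) , J , k) (λ ((A , m) , J , k) → A , J , m , k) (λ _ → refl) (λ _ → refl) (split-< (ℕ × ℕ)))
      {e₁ = λ ((X , r) , e , F) → eZ (X ℕ.+ r , X , F , suc (e ℕ.+ e))} {v₁ = one}
      {e₂ = λ ((r , X) , k , F) → eZ (X ℕ.+ r , X , F , k ℕ.+ k)} {v₂ = one}
      (λ ((X , r) , e , F) → tO-eq (+ X) (+ r) (+ e) (+ F)) (λ ((r , X) , k , F) → tE-eq (+ X) (+ r) (+ k) (+ F)) (λ _ → refl) (λ _ → refl)
      (gf-↔ (λ ((F , X , r) , e) → (X , r) , e , F) (λ ((X , r) , e , F) → (F , X , r) , e) (λ _ → refl) (λ _ → refl) (λ _ → refl) (λ _ → refl) (Cut.gf₂ cVO))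
      (gf-↔ (λ ((F , X , r) , k) → (r , X) , k , F) (λ ((r , X) , k , F) → (F , X , r) , k) (λ _ → refl) (λ _ → refl) (λ _ → refl) (λ _ → refl) (Cut.gf₁ cVO)))
  ; balance = λ n → linear (proj₁ gfZ n) (Cut.part₁ cE n) (Cut.part₂ cE n) (Cut.part₁ cO n) (Cut.part₂ cO n) (Cut.part₁ cW n) (Cut.part₂ cW n) (Cut.part₁ cVO n) (trans (Cut.sum cP n) (cong₂ _+_ (Cut.sum cE n) (Cut.sum cO n)))
      (trans (Cut.sum cX n) (cong₂ _+_ (Cut.sum cW n) (Cut.sum cVO n)))
      (gf-det (gf-↔ (λ ((G , X) , F , r) → (G , X , F) , r) (λ ((G , X , F) , r) → (G , X) , F , r) (λ _ → refl) (λ _ → refl) (λ ((G , X) , F , r) → w₁-eq (+ G) (+ X) (+ F) (+ r)) (λ _ → refl) (Cut.gf₁ cE))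
        (Cut.gf₂ cW) n)
      (gf-det (gf-↔ (λ ((G , X) , F , r) → (G , X , F) , r) (λ ((G , X , F) , r) → (G , X) , F , r) (λ _ → refl) (λ _ → refl) (λ ((G , X) , F , r) → w₀-eq (+ G) (+ X) (+ F) (+ r)) (λ _ → refl) (Cut.gf₂ cO))
        (Cut.gf₁ cW) n)
  }
  where
  u₁-eq : ∀ G X J k → let d = λ (x : ℤ) → x + x ; o = λ (x : ℤ) → 1ℤ + (x + x) in d (1ℤ + G) * d (1ℤ + G) + d ((o X + d (1ℤ + G)) * o J) + d (d (o X * (1ℤ + k)))
    ≡ d (1ℤ + G) * d (1ℤ + G) + d (o X * o (1ℤ + (J + k)) + d (1ℤ + G) * o J)
  u₁-eq = solve-∀
  u₂-eq : ∀ G X J k → let d = λ (x : ℤ) → x + x in d (1ℤ + G) * d (1ℤ + G) + d ((1ℤ + (X + X)) * (1ℤ + (J + J))) + d (d ((1ℤ + (X + X) + d (1ℤ + G)) * k))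
    ≡ d (1ℤ + G) * d (1ℤ + G) + d ((1ℤ + (X + X)) * (1ℤ + (k + J + (k + J))) + d (1ℤ + G) * d k)
  u₂-eq = solve-∀
  w₁-eq : ∀ G X F r → let d = λ (x : ℤ) → x + x ; o = λ (x : ℤ) → 1ℤ + (x + x) in d (1ℤ + G) * d (1ℤ + G) + d (o X * o F + d (1ℤ + G) * o F + d (1ℤ + G) * o r)
    ≡ d (1ℤ + G) * d (1ℤ + G) + d (o X * o F + d (1ℤ + G) * d (1ℤ + (F + r)))
  w₁-eq = solve-∀
  w₀-eq : ∀ G X F r → let d = λ (x : ℤ) → x + x ; o = λ (x : ℤ) → 1ℤ + (x + x) in d (1ℤ + G) * d (1ℤ + G) + d (o X * o F + d (1ℤ + G) * o F + d (1ℤ + G) * d r)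
    ≡ d (1ℤ + G) * d (1ℤ + G) + d (o X * o F + d (1ℤ + G) * o (F + r))
  w₀-eq = solve-∀
  wX-eq : ∀ G X F E → let d = λ (x : ℤ) → x + x in d (1ℤ + G) * d (1ℤ + G) + d ((1ℤ + (X + X)) * (1ℤ + (F + F)) + d (1ℤ + G) * (1ℤ + (F + F)) + d (1ℤ + G) * E)
    ≡ d (1ℤ + G) * d (1ℤ + G) + d ((1ℤ + (1ℤ + (G + X) + (1ℤ + (G + X)))) * (1ℤ + (F + F)) + d (1ℤ + G) * E)
  wX-eq = solve-∀
  tO-eq : ∀ X r e F → let d = λ (x : ℤ) → x + x ; o = λ (x : ℤ) → 1ℤ + (x + x) in d (1ℤ + (X + r)) * d (1ℤ + (X + r)) + d (o X * o F + d (1ℤ + (X + r)) * o e)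
    ≡ (o r + o X) * (o r + o X) + d (o r * o e) + d (d (o X * (1ℤ + (e + F))))
  tO-eq = solve-∀
  tE-eq : ∀ X r k F → let d = λ (x : ℤ) → x + x ; o = λ (x : ℤ) → 1ℤ + (x + x) in d (1ℤ + (X + r)) * d (1ℤ + (X + r)) + d (o X * o F + d (1ℤ + (X + r)) * d k)
    ≡ (o X + o r) * (o X + o r) + d (o X * o (k + F)) + d (d (o r * k))
  tE-eq = solve-∀
  linear : ∀ z w₁ u₂ u₁ w₀ w₀′ w₁′ v₀ {v₁} → z ≡ (w₁ + u₂) + (u₁ + w₀) → z ≡ (w₀′ + w₁′) + (v₀ + v₁) → w₁ ≡ w₁′ → w₀ ≡ w₀′ → u₁ + u₂ ≡ v₀ + v₁
  linear z w₁ u₂ u₁ w₀ _ _ v₀ {v₁} p r refl refl = ∙-cancelˡ (w₁ + w₀) _ _ (trans (lem₁ w₁ u₂ u₁ w₀) (trans (trans (sym p) r) (lem₂ w₁ w₀ v₀ v₁)))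
    where
    lem₁ : ∀ w₁ u₂ u₁ w₀ → w₁ + w₀ + (u₁ + u₂) ≡ w₁ + u₂ + (u₁ + w₀)
    lem₁ = solve-∀
    lem₂ : ∀ w₁ w₀ v₀ v₁ → w₀ + w₁ + (v₀ + v₁) ≡ w₁ + w₀ + (v₀ + v₁)
    lem₂ = solve-∀
  cP = gf-cut (rearrange (λ (G , X , F , E) → (G , X , F) , E) (λ ((G , X , F) , E) → G , X , F , E) (λ _ → refl) (λ _ → refl) (split-parity (ℕ × ℕ × ℕ)))
    {e₁ = λ ((G , X , F) , k) → eZ (G , X , F , k ℕ.+ k)} {v₁ = one} {e₂ = λ ((G , X , F) , J) → eZ (G , X , F , suc (J ℕ.+ J))} {v₂ = one}
    (λ _ → refl) (λ _ → refl) (λ _ → refl) (λ _ → refl) (proj₂ gfZ)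
  -- E = 2k exceeds f = 2F + 1 exactly if F < k, and then E - f is odd.
  cE = gf-cut (rearrange (λ ((G , X , F) , k) → (G , X) , F , k) (λ ((G , X) , F , k) → (G , X , F) , k) (λ _ → refl) (λ _ → refl) (split-< (ℕ × ℕ)))
    {e₁ = λ ((G , X) , F , r) → eZ (G , X , F , suc (F ℕ.+ r) ℕ.+ suc (F ℕ.+ r))} {v₁ = one} {e₂ = λ ((G , X) , k , J) → eZ (G , X , k ℕ.+ J , k ℕ.+ k)} {v₂ = one}
    (λ _ → refl) (λ _ → refl) (λ _ → refl) (λ _ → refl) (Cut.gf₁ cP)
  -- E = 2J + 1 is below f exactly if J < F; otherwise E - f = 2r.
  cO = gf-cut (rearrange (λ ((G , X , F) , J) → (G , X) , J , F) (λ ((G , X) , J , F) → (G , X , F) , J) (λ _ → refl) (λ _ → refl) (split-< (ℕ × ℕ)))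
    {e₁ = λ ((G , X) , J , k) → eZ (G , X , suc (J ℕ.+ k) , suc (J ℕ.+ J))} {v₁ = one} {e₂ = λ ((G , X) , F , r) → eZ (G , X , F , suc ((F ℕ.+ r) ℕ.+ (F ℕ.+ r)))} {v₂ = one}
    (λ _ → refl) (λ _ → refl) (λ _ → refl) (λ _ → refl) (Cut.gf₂ cP)
  -- As x is odd and g even they never agree: G < X leaves the odd difference x - g, and otherwise g
  -- - x = o(r).
  cX = gf-cut (rearrange (λ (G , X , F , E) → (F , E) , G , X) (λ ((F , E) , G , X) → G , X , F , E) (λ _ → refl) (λ _ → refl) (split-< (ℕ × ℕ)))
    {e₁ = λ ((F , E) , G , X) → eW (G , X , F , E)} {v₁ = one} {e₂ = λ ((F , E) , X , r) → eZ (X ℕ.+ r , X , F , E)} {v₂ = one}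
    (λ ((F , E) , G , X) → wX-eq (+ G) (+ X) (+ F) (+ E)) (λ _ → refl) (λ _ → refl) (λ _ → refl) (proj₂ gfZ)
  cW = gf-cut (rearrange (λ ((F , E) , G , X) → (G , X , F) , E) (λ ((G , X , F) , E) → (F , E) , G , X) (λ _ → refl) (λ _ → refl) (split-parity (ℕ × ℕ × ℕ)))
    {e₁ = λ ((G , X , F) , r) → eW (G , X , F , r ℕ.+ r)} {v₁ = one} {e₂ = λ ((G , X , F) , r) → eW (G , X , F , suc (r ℕ.+ r))} {v₂ = one}
    (λ _ → refl) (λ _ → refl) (λ _ → refl) (λ _ → refl) (Cut.gf₁ cX)
  cVO = gf-cut (rearrange (λ ((F , E) , X , r) → (F , X , r) , E) (λ ((F , X , r) , E) → (F , E) , X , r) (λ _ → refl) (λ _ → refl) (split-parity (ℕ × ℕ × ℕ)))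
    {e₁ = λ ((F , X , r) , k) → eZ (X ℕ.+ r , X , F , k ℕ.+ k)} {v₁ = one} {e₂ = λ ((F , X , r) , e) → eZ (X ℕ.+ r , X , F , suc (e ℕ.+ e))} {v₂ = one}
    (λ _ → refl) (λ _ → refl) (λ _ → refl) (λ _ → refl) (Cut.gf₂ cX)

open Core core

-- The degree `eT₁` on the diagonal D = a.
eQ : (ℕ → ℕ) → ℕ × ℕ × ℕ → ℤ
eQ κ (A , J , k) = d (o A * o J) + d (d (o A * + κ k))

module _ (κ : ℕ → ℕ) where

  -- The cases are D < a, D = a and D > a. Both numbers are odd, so a nonzero difference is an even
  -- g = 2(G + 1).
  join-T₁ : ∀ {f g h} → GF (eQ κ) one f → GF (eU₁ κ) one g → GF (eU₂ κ) one h → GF (eT₁ κ) one (h ⊞ (f ⊞ g))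
  join-T₁ pf pg ph = gf-join (rearrange (λ (A , J , m , k) → (J , k) , m , A) (λ ((J , k) , m , A) → A , J , m , k) (λ _ → refl) (λ _ → refl) (split-< (ℕ × ℕ)))
      {e₁ = λ ((J , k) , m , G) → eU₂ κ (m , G , J , k)} {v₁ = one} {e₂ = λ ((J , k) , A , e) → eT₁ κ (A , J , A ℕ.+ e , k)} {v₂ = one}
      (λ ((J , k) , m , G) → lower (+ m) (+ G) (+ J) (+ κ k)) (λ _ → refl) (λ _ → refl) (λ _ → refl)
    (gf-↔ (λ (m , G , J , k) → (J , k) , m , G) (λ ((J , k) , m , G) → m , G , J , k) (λ _ → refl) (λ _ → refl) (λ _ → refl) (λ _ → refl) ph)
    (gf-join (rearrange (λ ((J , k) , A , e) → (A , J , k) , e) (λ ((A , J , k) , e) → (J , k) , A , e) (λ _ → refl) (λ _ → refl) (split-suc (ℕ × ℕ × ℕ)))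
        {e₁ = eQ κ} {v₁ = one} {e₂ = λ ((A , J , k) , G) → eU₁ κ (A , G , J , k)} {v₂ = one}
        (λ (A , J , k) → diagonal (+ A) (+ J) (+ κ k)) (λ ((A , J , k) , G) → upper (+ A) (+ G) (+ J) (+ κ k)) (λ _ → refl) (λ _ → refl)
      pf
      (gf-↔ (λ (A , G , J , k) → (A , J , k) , G) (λ ((A , J , k) , G) → A , G , J , k) (λ _ → refl) (λ _ → refl) (λ _ → refl) (λ _ → refl) pg))
    where
    lower : ∀ m G J k → let d = λ (x : ℤ) → x + x ; o = λ (x : ℤ) → 1ℤ + (x + x) in d (1ℤ + G) * d (1ℤ + G) + d (o m * o J) + d (d ((o m + d (1ℤ + G)) * k))
      ≡ (o m - o (1ℤ + (m + G))) * (o m - o (1ℤ + (m + G))) + d (o m * o J) + d (d (o (1ℤ + (m + G)) * k))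
    lower = solve-∀
    diagonal : ∀ A J k → let d = λ (x : ℤ) → x + x ; o = λ (x : ℤ) → 1ℤ + (x + x) in d (o A * o J) + d (d (o A * k))
      ≡ (o (A + + 0) - o A) * (o (A + + 0) - o A) + d (o (A + + 0) * o J) + d (d (o A * k))
    diagonal = solve-∀
    upper : ∀ A G J k → let d = λ (x : ℤ) → x + x ; o = λ (x : ℤ) → 1ℤ + (x + x) in d (1ℤ + G) * d (1ℤ + G) + d ((o A + d (1ℤ + G)) * o J) + d (d (o A * k))
      ≡ (o (A + (1ℤ + G)) - o A) * (o (A + (1ℤ + G)) - o A) + d (o (A + (1ℤ + G)) * o J) + d (d (o A * k))
    upper = solve-∀

  -- Summing over the decompositions y = J + κ(k) turns the weight counting them into 1.
  gf-Q : ∀ {f} (b : ℕ → ℕ) → (∀ {y k} → k ℕ.< b y → κ k ℕ.≤ y) → (∀ {y k} → κ k ℕ.≤ y → k ℕ.< b y) →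
    GF (λ xy → d (eE xy)) (λ xy → + b (proj₂ xy)) f → GF (eQ κ) one f
  gf-Q b lo hi p n = enum-↔ (λ ((x , y) , k) → x , y ℕ.∸ κ k , k) (λ (x , J , k) → (x , J ℕ.+ κ k) , k)
    (λ { {(x , y) , k} (h , le) → trans (grade (+ x) (+ (y ℕ.∸ κ k)) (+ κ k)) (trans (cong (λ t → d (eE (x , t))) (ℕₚ.m∸n+n≡m le)) h) })
    (λ { {x , J , k} h → trans (sym (grade (+ x) (+ J) (+ κ k))) h , ℕₚ.m≤n+m (κ k) J })
    (λ { {(x , y) , k} (h , le) → cong (λ t → (x , t) , k) (ℕₚ.m∸n+n≡m le) })
    (λ { {x , J , k} h → cong (λ t → x , t , k) (ℕₚ.m+n∸n≡m J (κ k)) })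
    (λ _ → refl)
    (enum-Σ {Q = λ xy k → κ k ℕ.≤ proj₂ xy} {v = one} (λ xy _ → mkEnum (upTo (b (proj₂ xy))) (Unique.upTo⁺ (b (proj₂ xy))) (lo ∘ ∈-upTo⁻) (∈-upTo⁺ ∘ hi)
      (trans (count (upTo (b (proj₂ xy)))) (cong +_ (length-upTo (b (proj₂ xy)))))) (p n))
    where
    count : (xs : List ℕ) → sumOf one xs ≡ + length xs
    count []       = refl
    count (x ∷ xs) = cong (_+_ 1ℤ) (count xs)
    grade : ∀ x J k → let d = λ (x : ℤ) → x + x in d ((1ℤ + (x + x)) * (1ℤ + (J + J))) + d (d ((1ℤ + (x + x)) * k))
      ≡ d ((1ℤ + (x + x)) * (1ℤ + (J + k + (J + k))))
    grade = solve-∀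

gdE : GF (λ xy → d (eE xy)) vE (dil E)
gdE = gf-dil (λ _ → refl) eE-≥0 gE

record Balanced : Set where
  field
    t₁ t₁⁺ t₂⁺ : Series
    gt₁  : GF (eT₁ id) one t₁
    gt₁⁺ : GF (eT₁ suc) one t₁⁺
    gt₂⁺ : GF (eT₂ suc) one t₂⁺
    sum  : t₁ ⊞ t₁⁺ ≗ (t₂ ⊞ t₂⁺) ⊞ dil E

-- Let ⁰ and ⁺ mark the parts k = 0 and k > 0. `core` gives U₁⁺ + U₂ = T₂, and comparing D with g
-- gives U₂⁰ = U₁⁰ + T₂⁰. Hence the off-diagonal terms of the two `eT₁` classes add up to T₂ + T₂⁺.
-- The diagonals have multiplicities y + 1 and y, together the weight 2y + 1 of E(q²).
balanced : Balanced
balanced = record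
  { gt₁ = join-T₁ id gq (gf-join (rearrange (λ (A , G , J , k) → (A , G , J) , k) (λ ((A , G , J) , k) → A , G , J , k) (λ _ → refl) (λ _ → refl) (split-suc (ℕ × ℕ × ℕ)))
      {e₁ = λ (A , G , J) → eU₁ id (A , G , J , 0)} {v₁ = one} {e₂ = λ ((A , G , J) , k) → eU₁ suc (A , G , J , k)} {v₂ = one}
      (λ _ → refl) (λ _ → refl) (λ _ → refl) (λ _ → refl)
      (gf-↔ (λ (J , G , A) → A , G , J) (λ (A , G , J) → J , G , A) (λ _ → refl) (λ _ → refl) (λ _ → refl) (λ _ → refl) (Cut.gf₁ c₀))
      (gf-↔ (λ (A , G , J , k) → (A , G , J) , k) (λ ((A , G , J) , k) → A , G , J , k) (λ _ → refl) (λ _ → refl) (λ _ → refl) (λ _ → refl) gu₁)) gu₂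
  ; gt₁⁺ = join-T₁ suc gq⁺ gu₁ (gf-↔ (λ ((m , G , J) , k) → m , G , J , k) (λ (m , G , J , k) → (m , G , J) , k) (λ _ → refl) (λ _ → refl) (λ _ → refl) (λ _ → refl) (Cut.gf₂ cU))
  ; gt₂⁺ = gf-↔ (λ ((A , J , m) , k) → A , J , m , k) (λ (A , J , m , k) → (A , J , m) , k) (λ _ → refl) (λ _ → refl) (λ _ → refl) (λ _ → refl) (Cut.gf₂ cT)
  ; sum = λ n → linear (q₀ n) (q⁺ n) (Cut.part₁ c₀ n) (Cut.part₂ cU n) (Cut.part₂ cT n) (u₁ n) (u₂ n) (balance n) (Cut.sum cU n) (Cut.sum cT n)
      (trans (Cut.sum c₀ n) (cong (λ t → Cut.part₁ c₀ n + t) (gf-det (gf-↔ (λ (J , m , A) → A , J , m) (λ (A , J , m) → J , m , A) (λ _ → refl) (λ _ → refl) (λ ((J , m , A)) → upper (+ A) (+ m) (+ J)) (λ _ → refl) (Cut.gf₂ c₀)) (Cut.gf₁ cT) n)))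
      (gf-det (gf-vcong (λ xy → weight (+ proj₂ xy)) (gf-+ (proj₂ (gf-reweight (λ xy → + suc (proj₂ xy)) gdE)) (proj₂ (gf-reweight (λ xy → + proj₂ xy) gdE)))) gdE n)
  }
  where
  q₀ q⁺ : Series
  q₀ = proj₁ (gf-reweight (λ xy → + suc (proj₂ xy)) gdE)
  q⁺ = proj₁ (gf-reweight (λ xy → + proj₂ xy) gdE)
  gq : GF (eQ id) one q₀
  gq = gf-Q id suc (λ { (s≤s le) → le }) s≤s (proj₂ (gf-reweight (λ xy → + suc (proj₂ xy)) gdE))
  gq⁺ : GF (eQ suc) one q⁺
  gq⁺ = gf-Q suc id id id (proj₂ (gf-reweight (λ xy → + proj₂ xy) gdE))
  weight : ∀ y → 1ℤ + (y + y) ≡ 1ℤ + y + y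
  weight = solve-∀
  lower : ∀ A G J → let d = λ (x : ℤ) → x + x ; o = λ (x : ℤ) → 1ℤ + (x + x) in d (1ℤ + G) * d (1ℤ + G) + d ((o A + d (1ℤ + G)) * o J) + d (d (o A * + 0))
    ≡ d (1ℤ + G) * d (1ℤ + G) + d (o (1ℤ + (G + A)) * o J) + d (d ((o (1ℤ + (G + A)) + d (1ℤ + G)) * + 0))
  lower = solve-∀
  upper : ∀ A m J → let d = λ (x : ℤ) → x + x ; o = λ (x : ℤ) → 1ℤ + (x + x) in (o m + o A) * (o m + o A) + d (o m * o J) + d (d (o A * + 0))
    ≡ d (1ℤ + (m + A)) * d (1ℤ + (m + A)) + d (o m * o J) + d (d ((o m + d (1ℤ + (m + A))) * + 0))
  upper = solve-∀
  cU = gf-cut (rearrange (λ (m , G , J , k) → (m , G , J) , k) (λ ((m , G , J) , k) → m , G , J , k) (λ _ → refl) (λ _ → refl) (split-suc (ℕ × ℕ × ℕ)))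
    {e₁ = λ (m , G , J) → eU₂ id (m , G , J , 0)} {v₁ = one} {e₂ = λ ((m , G , J) , k) → eU₂ suc (m , G , J , k)} {v₂ = one}
    (λ _ → refl) (λ _ → refl) (λ _ → refl) (λ _ → refl) gu₂
  cT = gf-cut (rearrange (λ (A , J , m , k) → (A , J , m) , k) (λ ((A , J , m) , k) → A , J , m , k) (λ _ → refl) (λ _ → refl) (split-suc (ℕ × ℕ × ℕ)))
    {e₁ = λ (A , J , m) → eT₂ id (A , J , m , 0)} {v₁ = one} {e₂ = λ ((A , J , m) , k) → eT₂ suc (A , J , m , k)} {v₂ = one}
    (λ _ → refl) (λ _ → refl) (λ _ → refl) (λ _ → refl) gt₂
  c₀ = gf-cut (rearrange (λ (m , G , J) → J , G , m) (λ (J , G , m) → m , G , J) (λ _ → refl) (λ _ → refl) (split-< ℕ))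
    {e₁ = λ (J , G , A) → eU₁ id (A , G , J , 0)} {v₁ = one} {e₂ = λ (J , m , A) → eU₂ id (m , m ℕ.+ A , J , 0)} {v₂ = one}
    (λ (J , G , A) → lower (+ A) (+ G) (+ J)) (λ _ → refl) (λ _ → refl) (λ _ → refl) (Cut.gf₁ cU)
  linear : ∀ q₀ q⁺ u⁰ u₂⁺ t₂⁺ u₁ u₂ {u₂⁰ t₂ t₂⁰ e} → u₁ + u₂ ≡ t₂ → u₂ ≡ u₂⁰ + u₂⁺ → t₂ ≡ t₂⁰ + t₂⁺ → u₂⁰ ≡ u⁰ + t₂⁰ → q₀ + q⁺ ≡ e →
    (u₂ + (q₀ + (u⁰ + u₁))) + (u₂⁺ + (q⁺ + u₁)) ≡ (t₂ + t₂⁺) + e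
  linear q₀ q⁺ u⁰ u₂⁺ t₂⁺ u₁ _ {t₂⁰ = t₂⁰} refl refl eq refl refl = trans (lem₁ q₀ q⁺ u⁰ u₂⁺ t₂⁰ u₁)
    (trans (cong (λ t → t - t₂⁰ + (u₁ + (u⁰ + t₂⁰ + u₂⁺)) + (q₀ + q⁺)) eq) (lem₂ t₂⁰ t₂⁺ (u₁ + (u⁰ + t₂⁰ + u₂⁺)) (q₀ + q⁺)))
    where
    lem₁ : ∀ q₀ q⁺ u⁰ u₂⁺ t₂⁰ u₁ → u⁰ + t₂⁰ + u₂⁺ + (q₀ + (u⁰ + u₁)) + (u₂⁺ + (q⁺ + u₁))
      ≡ u₁ + (u⁰ + t₂⁰ + u₂⁺) - t₂⁰ + (u₁ + (u⁰ + t₂⁰ + u₂⁺)) + (q₀ + q⁺)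
    lem₁ = solve-∀
    lem₂ : ∀ t₂⁰ t₂⁺ t e → t₂⁰ + t₂⁺ - t₂⁰ + t + e ≡ t + t₂⁺ + e
    lem₂ = solve-∀

open Balanced balanced

cancel-⊞ : ∀ {s s⁺ t t⁺ u u⁺ e : ℤ} → t ≡ u + s → t⁺ ≡ u⁺ + s⁺ → t + t⁺ ≡ (u + u⁺) + e → s + s⁺ ≡ e
cancel-⊞ {s} {s⁺} {_} {_} {u} {u⁺} {e} refl refl h = ∙-cancelˡ (u + u⁺) _ _ (trans (lem s s⁺ u u⁺) h)
  where
  lem : ∀ s s⁺ u u⁺ → u + u⁺ + (s + s⁺) ≡ u + s + (u⁺ + s⁺)
  lem = solve-∀

-- Sums of three squares congruent to 1 modulo 4

module OneModFour (κ : ℕ → ℕ) (κ≥ : ∀ k → k ℕ.≤ κ k) where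

  -- forms a x² + 2b x y + c y² with a = 2|β| + o(i), b = 2β, c = a + 4κ(k), of determinant ac - b²
  eC : ℤ × ℕ × ℕ → ℤ
  eC (β , i , k) = let b = + ∣ β ∣ in o i * o i + d (d b) * o i + d (d ((d b + o i) * + κ k))

  eCℕ : ℤ × ℕ × ℕ → ℕ
  eCℕ (β , i , k) = let b = ∣ β ∣ ; c = ((b ℕ.+ b) ℕ.+ oℕ i) ℕ.* κ k in oℕ i ℕ.* oℕ i ℕ.+ ((b ℕ.+ b) ℕ.+ (b ℕ.+ b)) ℕ.* oℕ i ℕ.+ ((c ℕ.+ c) ℕ.+ (c ℕ.+ c))

  eCℕ≡ : ∀ x → + eCℕ x ≡ eC x
  eCℕ≡ (β , i , k) = let b = ∣ β ∣ ; c≡ = ℤₚ.pos-* ((b ℕ.+ b) ℕ.+ oℕ i) (κ k) in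
    cong₂ _+_ (cong₂ _+_ (ℤₚ.pos-* (oℕ i) (oℕ i)) (ℤₚ.pos-* ((b ℕ.+ b) ℕ.+ (b ℕ.+ b)) (oℕ i))) (cong (λ t → d (d t)) c≡)

  eC-≥0 : NonNeg eC
  eC-≥0 x = eCℕ x , sym (eCℕ≡ x)

  C : Series
  C = gfSum (boxℤ box× boxℕ box× boxℕ) eCℕ one

  gC : GF eC one C
  gC = gf-↔ id id (λ _ → refl) (λ _ → refl) (λ x → sym (eCℕ≡ x)) (λ _ → refl)
    (gf-box (boxℤ box× boxℕ box× boxℕ) eCℕ one (λ (β , i , k) → ℕₚ.⊔-lub (bβ β i k) (ℕₚ.⊔-lub (bi β i k) (bk β i k))))
    where
    bβ : ∀ β i k → ∣ β ∣ ℕ.≤ eCℕ (β , i , k)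
    bβ β i k = ℕₚ.≤-trans (ℕₚ.≤-trans (ℕₚ.≤-trans (ℕₚ.≤-trans (ℕₚ.m≤m+n _ _) (ℕₚ.m≤m+n _ _)) (ℕₚ.m≤m*n _ (oℕ i))) (ℕₚ.m≤n+m _ (oℕ i ℕ.* oℕ i))) (ℕₚ.m≤m+n _ _)
    bi : ∀ β i k → i ℕ.≤ eCℕ (β , i , k)
    bi β i k = ℕₚ.≤-trans (ℕₚ.≤-trans (ℕₚ.≤-trans (ℕₚ.m≤n⇒m≤1+n (ℕₚ.m≤m+n i i)) (ℕₚ.m≤m*n (oℕ i) (oℕ i))) (ℕₚ.m≤m+n _ _)) (ℕₚ.m≤m+n _ _)
    bk : ∀ β i k → k ℕ.≤ eCℕ (β , i , k)
    bk β i k = ℕₚ.≤-trans (ℕₚ.≤-trans (κ≥ k) (ℕₚ.≤-trans (ℕₚ.m≤n*m (κ k) _ {{ℕ.>-nonZero (ℕₚ.m≤n+m 1 _ ⟨≤⟩ pos β i)}}) (ℕₚ.≤-trans (ℕₚ.m≤m+n _ _) (ℕₚ.m≤m+n _ _)))) (ℕₚ.m≤n+m _ (oℕ i ℕ.* oℕ i ℕ.+ ((∣ β ∣ ℕ.+ ∣ β ∣) ℕ.+ (∣ β ∣ ℕ.+ ∣ β ∣)) ℕ.* oℕ i))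
      where
      _⟨≤⟩_ : ∀ {a b c} → a ℕ.≤ b → b ℕ.≤ c → a ℕ.≤ c
      _⟨≤⟩_ = ℕₚ.≤-trans
      pos : ∀ β i → ∣ β ∣ ℕ.+ ∣ β ∣ ℕ.+ (i ℕ.+ i) ℕ.+ 1 ℕ.≤ ∣ β ∣ ℕ.+ ∣ β ∣ ℕ.+ oℕ i
      pos β i = ℕₚ.≤-reflexive (trans (ℕₚ.+-assoc (∣ β ∣ ℕ.+ ∣ β ∣) (i ℕ.+ i) 1) (cong (∣ β ∣ ℕ.+ ∣ β ∣ ℕ.+_) (ℕₚ.+-comm (i ℕ.+ i) 1)))

  -- the pairs of w = 2(m + β) + 1 and a form, so that w - b = o(m) > 0
  eS : (ℤ × ℕ × ℕ) × ℕ → ℤ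
  eS ((β , r) , m) = sq h₂ (+ m + β) + eC (β , r)

  -- The number w - b is odd, hence nonzero, and (w, β) ↦ (-w, -β) exchanges its two signs.
  gS : Σ[ s ∈ Series ] GF eS one s × (θ₂ ⊛ C ≗ s ⊞ s)
  gS = finish (gf-cut (rearrange {A = ℤ × ℤ × ℕ × ℕ} (λ (w , β , r) → (β , r) , w - β) (λ ((β , r) , m) → m + β , β , r)
        (λ (w , β , r) → cong (_, (β , r)) (minus⁺minus w β)) (λ ((β , r) , m) → cong ((β , r) ,_) (plus⁻plus m β)) (split-sign (ℤ × ℕ × ℕ)))
      {e₁ = eS} {v₁ = one} {e₂ = λ ((β , r) , m) → sq h₂ (-[1+ m ] + β) + eC (β , r)} {v₂ = one}
      (λ _ → refl) (λ _ → refl) (λ _ → refl) (λ _ → refl) (gf-× {e = sq h₂} {e′ = eC} (sq-≥0 h₂) eC-≥0 gθ₂ gC))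
    where
    flip : (ℤ × ℕ × ℕ) × ℕ → (ℤ × ℕ × ℕ) × ℕ
    flip ((β , r) , m) = (- β , r) , m
    lem : ∀ m β → let sqr = λ (x : ℤ) → x * x in sqr (m + - β + (m + - β) + 1ℤ) ≡ sqr (- (1ℤ + m) + β + (- (1ℤ + m) + β) + 1ℤ)
    lem = solve-∀
    finish : Cut eS one (λ ((β , r) , m) → sq h₂ (-[1+ m ] + β) + eC (β , r)) one (θ₂ ⊛ C) → Σ[ s ∈ Series ] GF eS one s × (θ₂ ⊛ C ≗ s ⊞ s)
    finish (cut s s′ p p′ eq) = s , p , λ n → trans (eq n) (cong (λ t → s n + t) (gf-det
      (gf-↔ flip flip (λ ((β , r) , m) → cong (λ t → (t , r) , m) (ℤₚ.neg-involutive β)) (λ ((β , r) , m) → cong (λ t → (t , r) , m) (ℤₚ.neg-involutive β))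
        (λ ((β , i , k) , m) → cong₂ _+_ (lem (+ m) β) (cong (λ b → o i * o i + d (d (+ b)) * o i + d (d ((d (+ b) + o i) * + κ k))) (ℤₚ.∣-i∣≡∣i∣ β))) (λ _ → refl) p′) p n))

  -- The forms satisfy |b| < a, that is 0 < j < 2a for j = a + b. The members of `eT₁` with j > 2a
  -- become `eT₂` when 2a is subtracted from j.
  gT : ∀ {s t} → GF eS one s → GF (eT₂ κ) one t → GF (eT₁ κ) one (t ⊞ s)
  gT {s} {t} p q = finish (gf-cut (rearrange (λ ((β , i , k) , m) → (i , k , m) , β) (λ ((i , k , m) , β) → (β , i , k) , m) (λ _ → refl) (λ _ → refl) (split-sign (ℕ × ℕ × ℕ)))
      {e₁ = λ ((i , k , m) , n) → eS ((+ n , i , k) , m)} {v₁ = one} {e₂ = λ ((i , k , m) , n) → eS ((-[1+ n ] , i , k) , m)} {v₂ = one}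
      (λ _ → refl) (λ _ → refl) (λ _ → refl) (λ _ → refl) p)
    where
    neg-eq : ∀ m n i k → let d = λ (x : ℤ) → x + x ; o = λ (x : ℤ) → 1ℤ + (x + x) in
      (m + - (1ℤ + n) + (m + - (1ℤ + n)) + 1ℤ) * (m + - (1ℤ + n) + (m + - (1ℤ + n)) + 1ℤ) + (o i * o i + d (d (1ℤ + n)) * o i + d (d ((d (1ℤ + n) + o i) * k)))
      ≡ (o m - o (1ℤ + (i + n))) * (o m - o (1ℤ + (i + n))) + d (o m * o i) + d (d (o (1ℤ + (i + n)) * k))
    neg-eq = solve-∀
    pos-eq : ∀ m n i k → let d = λ (x : ℤ) → x + x ; o = λ (x : ℤ) → 1ℤ + (x + x) in
      (m + n + (m + n) + 1ℤ) * (m + n + (m + n) + 1ℤ) + (o i * o i + d (d n) * o i + d (d ((d n + o i) * k)))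
      ≡ (o m - o (n + i)) * (o m - o (n + i)) + d (o m * o (n + i + n)) + d (d (o (n + i) * k))
    pos-eq = solve-∀
    top-eq : ∀ A J m k → let d = λ (x : ℤ) → x + x ; o = λ (x : ℤ) → 1ℤ + (x + x) in (o m + o A) * (o m + o A) + d (o m * o J) + d (d (o A * k))
      ≡ (o m - o A) * (o m - o A) + d (o m * o (A + (1ℤ + (A + J)))) + d (d (o A * k))
    top-eq = solve-∀
    finish : Cut (λ ((i , k , m) , n) → eS ((+ n , i , k) , m)) one (λ ((i , k , m) , n) → eS ((-[1+ n ] , i , k) , m)) one s → GF (eT₁ κ) one (t ⊞ s)
    finish (cut s₀ s₁ p₀ p₁ eq) = gf-resp (λ n → trans (rearr (s₁ n) (t n) (s₀ n)) (cong (λ z → t n + z) (sym (eq n))))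
      (gf-join (rearrange (λ (A , J , m , k) → (m , k) , J , A) (λ ((m , k) , J , A) → A , J , m , k) (λ _ → refl) (λ _ → refl) (split-< (ℕ × ℕ)))
        {e₁ = λ ((m , k) , i , n) → eS ((-[1+ n ] , i , k) , m)} {v₁ = one} {e₂ = λ ((m , k) , A , n) → eT₁ κ (A , A ℕ.+ n , m , k)} {v₂ = one}
        (λ ((m , k) , i , n) → neg-eq (+ m) (+ n) (+ i) (+ κ k)) (λ _ → refl) (λ _ → refl) (λ _ → refl)
        (gf-↔ (λ ((i , k , m) , n) → (m , k) , i , n) (λ ((m , k) , i , n) → (i , k , m) , n) (λ _ → refl) (λ _ → refl) (λ _ → refl) (λ _ → refl) p₁)
        (gf-join (split-< (ℕ × ℕ))
          {e₁ = λ ((m , k) , A , J) → eT₂ κ (A , J , m , k)} {v₁ = one} {e₂ = λ ((m , k) , n , i) → eS ((+ n , i , k) , m)} {v₂ = one}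
          (λ ((m , k) , A , J) → top-eq (+ A) (+ J) (+ m) (+ κ k)) (λ ((m , k) , n , i) → pos-eq (+ m) (+ n) (+ i) (+ κ k)) (λ _ → refl) (λ _ → refl)
          (gf-↔ (λ (A , J , m , k) → (m , k) , A , J) (λ ((m , k) , A , J) → A , J , m , k) (λ _ → refl) (λ _ → refl) (λ _ → refl) (λ _ → refl) q)
          (gf-↔ (λ ((i , k , m) , n) → (m , k) , n , i) (λ ((m , k) , n , i) → (i , k , m) , n) (λ _ → refl) (λ _ → refl) (λ _ → refl) (λ _ → refl) p₀)))
      where
      rearr : ∀ a b c → a + (b + c) ≡ b + (c + a)
      rearr = solve-∀

private
  module C₀ = OneModFour id (λ _ → ℕₚ.≤-refl)
  module C₁ = OneModFour suc (λ k → ℕₚ.n≤1+n k)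

-- Both sides are doubled because θ₂ = 2ψ. The pairs with w > b number T₁ - T₂ for each boundary,
-- and `balanced` sums the two differences to E(q²).
ψC : ψ ⊛ (C₀.C ⊞ C₁.C) ≗ dil E
ψC n = ℤₚ.*-cancelˡ-≡ (+ 2) _ _ (trans (double ((ψ ⊛ (C₀.C ⊞ C₁.C)) n)) (trans (sym (⊛-distribʳ ψ ψ (C₀.C ⊞ C₁.C) n))
  (trans (⊛-cong {g = C₀.C ⊞ C₁.C} (λ m → sym (θ₂-split m)) (λ _ → refl) n) (trans (⊛-distribˡ θ₂ C₀.C C₁.C n)
  (trans (cong₂ _+_ (proj₂ (proj₂ C₀.gS) n) (proj₂ (proj₂ C₁.gS) n)) (trans (rearr (s₀ n) (s₁ n)) (trans (cong₂ _+_ half half) (sym (double (dil E n))))))))))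
  where
  s₀ = proj₁ C₀.gS
  s₁ = proj₁ C₁.gS
  double : ∀ a → + 2 * a ≡ a + a
  double = solve-∀
  rearr : ∀ a b → a + a + (b + b) ≡ a + b + (a + b)
  rearr = solve-∀
  half : s₀ n + s₁ n ≡ dil E n
  half = cancel-⊞ {s₀ n} {s₁ n} {t₁ n} {t₁⁺ n} {t₂ n} {t₂⁺ n} (gf-det gt₁ (C₀.gT (proj₁ (proj₂ C₀.gS)) gt₂) n) (gf-det gt₁⁺ (C₁.gT (proj₁ (proj₂ C₁.gS)) gt₂⁺) n) (Balanced.sum balanced n)

-- The series `ψ` starts with q, so the first nonzero coefficient of f - g would survive one index
-- higher.
ψ-cancel : ∀ f g → ψ ⊛ f ≗ ψ ⊛ g → f ≗ g
ψ-cancel f g h n = trans (lem (f n) (g n)) (trans (cong (_+ g n) (zero-diff n)) (ℤₚ.+-identityˡ (g n)))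
  where
  lem : ∀ a b → a ≡ a + -1ℤ * b + b
  lem = solve-∀
  self : ∀ a → a + -1ℤ * a ≡ 0ℤ
  self = solve-∀
  δ : Series
  δ = f ⊞ -1ℤ ⊙ g
  ψδ : ∀ n → (ψ ⊛ δ) n ≡ 0ℤ
  ψδ n = trans (⊛-distribˡ ψ f (-1ℤ ⊙ g) n) (trans (cong₂ _+_ (h n) (⊛-scaleʳ -1ℤ ψ g n)) (self ((ψ ⊛ g) n)))
  zero-diff : ∀ n → δ n ≡ 0ℤ
  zero-diff = <-rec (λ n → δ n ≡ 0ℤ) (λ n ih → trans (one-zero (δ (suc n)) (δ n)) (trans (sym (⊛-low₁ ψ δ n (λ i → ih {i}))) (ψδ (suc n))))
    where
    one-zero : ∀ a b → b ≡ 0ℤ * a + 1ℤ * b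
    one-zero = solve-∀

C≗ : C₀.C ⊞ C₁.C ≗ ψ ⊛ (θ ⊛ θ)
C≗ = ψ-cancel (C₀.C ⊞ C₁.C) (ψ ⊛ (θ ⊛ θ)) (λ n → trans (ψC n) (trans (dil-E n) (⊛-assoc ψ ψ (θ ⊛ θ) n)))

abstract
  -- The form x² + (4k + 1)y², with β = i = 0, is counted by `C₀.C`, and `C₁.C` cannot be negative.
  three-squares₁ : ∀ k → ∃[ p ] ∃[ s ] ∃[ t ] h₄ p * h₄ p + (d s * d s + d t * d t) ≡ + suc (q k)
  three-squares₁ k = go (enum-nonempty (λ h → positive (trans (C≗ (suc (q k))) h)) (gf-× {e = sq h₄} {e′ = sum2 d d} (sq-≥0 h₄) (≥0₂ d d) gψ (gf-sum2 {d} {d} gθ gθ) (suc (q k))))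
    where
    go : Σ[ x ∈ ℤ × ℤ × ℤ ] sq h₄ (proj₁ x) + sum2 d d (proj₂ x) ≡ + suc (q k) → ∃[ p ] ∃[ s ] ∃[ t ] h₄ p * h₄ p + (d s * d s + d t * d t) ≡ + suc (q k)
    go ((p , s , t) , e) = p , s , t , e
    sum≢0 : ∀ {a b} → a ≢ 0ℤ → Σ[ l ∈ ℕ ] a ≡ + l → Σ[ l ∈ ℕ ] b ≡ + l → a + b ≢ 0ℤ
    sum≢0 ne (zero , refl) _ _ = ne refl
    sum≢0 ne (suc l , refl) (l′ , refl) ()
    positive : (C₀.C ⊞ C₁.C) (suc (q k)) ≢ 0ℤ
    positive = sum≢0 (enum-count>0 {x = + 0 , 0 , k} (lem (+ k)) (C₀.gC (suc (q k)))) (enum-count (C₀.gC (suc (q k)))) (enum-count (C₁.gC (suc (q k))))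
      where
      lem : ∀ k → let d = λ (x : ℤ) → x + x in (1ℤ + (+ 0 + + 0)) * (1ℤ + (+ 0 + + 0)) + d (d (+ 0)) * (1ℤ + (+ 0 + + 0)) + d (d ((d (+ 0) + (1ℤ + (+ 0 + + 0))) * k))
        ≡ 1ℤ + (d k + d k)
      lem = solve-∀

-- Sums of three squares congruent to 2 modulo 4

-- forms with a = o(n + c), b = ± o(n), c = a + 2 o(J)
eY± : (ℕ → ℕ) → (ℕ × ℕ) × ℕ → ℤ
eY± c ((i , J) , n) = d (d (+ c i * (o n + + c i))) + d (o (n ℕ.+ c i) * o J)

eY : (ℕ × ℕ) × ℤ → ℤ
eY (r , + n)      = eY± suc (r , n)
eY (r , -[1+ n ]) = eY± id (r , n)

module _ (c : ℕ → ℕ) where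

  eYℕ : (ℕ × ℕ) × ℕ → ℕ
  eYℕ ((i , J) , n) = let x = c i ℕ.* (oℕ n ℕ.+ c i) ; y = oℕ (n ℕ.+ c i) ℕ.* oℕ J in ((x ℕ.+ x) ℕ.+ (x ℕ.+ x)) ℕ.+ (y ℕ.+ y)

  eYℕ≡ : ∀ z → + eYℕ z ≡ eY± c z
  eYℕ≡ ((i , J) , n) = cong₂ (λ x y → d (d x) + d y) (ℤₚ.pos-* (c i) (oℕ n ℕ.+ c i)) (ℤₚ.pos-* (oℕ (n ℕ.+ c i)) (oℕ J))

  gfY± : (∀ i → i ℕ.≤ c i) → Σ[ f ∈ Series ] GF (eY± c) one f
  gfY± le = _ , gf-↔ id id (λ _ → refl) (λ _ → refl) (λ z → sym (eYℕ≡ z)) (λ _ → refl)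
    (gf-box ((boxℕ box× boxℕ) box× boxℕ) eYℕ one (λ ((i , J) , n) → ℕₚ.⊔-lub (ℕₚ.⊔-lub
      (up i J n (ℕₚ.≤-trans (ℕₚ.≤-trans (ℕₚ.≤-trans (le i) (ℕₚ.m≤n+m (c i) n)) (k≤ok _)) (ℕₚ.m≤m*n _ (oℕ J))))
      (up i J n (ℕₚ.≤-trans (k≤ok J) (ℕₚ.m≤n*m (oℕ J) (oℕ (n ℕ.+ c i))))))
      (up i J n (ℕₚ.≤-trans (ℕₚ.≤-trans (ℕₚ.m≤m+n n (c i)) (k≤ok _)) (ℕₚ.m≤m*n _ (oℕ J))))))
    where
    k≤ok : ∀ k → k ℕ.≤ oℕ k
    k≤ok k = ℕₚ.m≤n⇒m≤1+n (ℕₚ.m≤m+n k k)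
    up : ∀ i J n {k} → k ℕ.≤ oℕ (n ℕ.+ c i) ℕ.* oℕ J → k ℕ.≤ eYℕ ((i , J) , n)
    up i J n h = ℕₚ.≤-trans h (ℕₚ.≤-trans (ℕₚ.m≤m+n _ _) (ℕₚ.m≤n+m _ _))

eY-≥0 : NonNeg eY
eY-≥0 (r , + n)      = eYℕ suc (r , n) , sym (eYℕ≡ suc (r , n))
eY-≥0 (r , -[1+ n ]) = eYℕ id (r , n) , sym (eYℕ≡ id (r , n))

gfY : Σ[ f ∈ Series ] GF eY one f
gfY = _ , gf-join (split-sign (ℕ × ℕ)) (λ _ → refl) (λ _ → refl) (λ _ → refl) (λ _ → refl)
  (proj₂ (gfY± suc (λ k → ℕₚ.n≤1+n k))) (proj₂ (gfY± id (λ _ → ℕₚ.≤-refl)))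

formsY : Series
formsY = proj₁ gfY

-- w - b = ± o(m)
eS⁺ eS⁻ : ((ℕ × ℕ) × ℤ) × ℕ → ℤ
eS⁺ ((r , β) , m) = sq d (+ m + 1ℤ + β) + eY (r , β)
eS⁻ ((r , β) , m) = sq d (-[1+ m ] + 1ℤ + β) + eY (r , β)

cut-Y : Cut eS⁺ one eS⁻ one (θ ⊛ formsY)
cut-Y = gf-cut (rearrange {A = ℤ × (ℕ × ℕ) × ℤ} (λ (w , r , β) → (r , β) , w - β - 1ℤ) (λ ((r , β) , t) → t + 1ℤ + β , r , β)
    (λ (w , r , β) → cong (_, (r , β)) (lem₁ w β)) (λ ((r , β) , t) → cong ((r , β) ,_) (lem₂ t β)) (split-sign ((ℕ × ℕ) × ℤ)))
  (λ _ → refl) (λ _ → refl) (λ _ → refl) (λ _ → refl) (gf-× {e = sq d} {e′ = eY} (sq-≥0 d) eY-≥0 gθ (proj₂ gfY))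
  where
  lem₁ : ∀ w β → w - β - 1ℤ + 1ℤ + β ≡ w
  lem₁ = solve-∀
  lem₂ : ∀ t β → t + 1ℤ + β - β - 1ℤ ≡ t
  lem₂ = solve-∀

private
  sign-cut : ∀ {e s} → GF e one s → Cut (λ ((i , J , m) , n) → e (((i , J) , + n) , m)) one (λ ((i , J , m) , n) → e (((i , J) , -[1+ n ]) , m)) one s
  sign-cut p = gf-cut (rearrange {A = ((ℕ × ℕ) × ℤ) × ℕ} (λ (((i , J) , β) , m) → (i , J , m) , β) (λ ((i , J , m) , β) → ((i , J) , β) , m) (λ _ → refl) (λ _ → refl) (split-sign (ℕ × ℕ × ℕ)))
    (λ _ → refl) (λ _ → refl) (λ _ → refl) (λ _ → refl) p

  rearr⁺ : ∀ p t n → p + t + n ≡ t + (p + n)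
  rearr⁺ = solve-∀

  rearr⁻ : ∀ p t n → p + (t + n) ≡ t + (p + n)
  rearr⁻ = solve-∀

-- For e = w - b > 0 and c = a + 2j the degree is (a - e)² + 2aj + 4eκ with κ = (a + b)/2. It is the
-- class `eT₁` restricted to 0 ≤ κ < a, where the coefficient a of the form plays the role of D; κ ≥
-- a gives `eT₂` after subtracting a.
gT⁺ : ∀ {s} → GF eS⁺ one s → GF (eT₁ id) one (t₂ ⊞ s)
gT⁺ {s} p = finish (sign-cut {e = eS⁺} p)
  where
  neg-eq : ∀ m n i J → let d = λ (x : ℤ) → x + x ; o = λ (x : ℤ) → 1ℤ + (x + x) in
    d (m + 1ℤ + - (1ℤ + n)) * d (m + 1ℤ + - (1ℤ + n)) + (d (d (i * (o n + i))) + d (o (n + i) * o J))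
    ≡ (o (i + n) - o m) * (o (i + n) - o m) + d (o (i + n) * o J) + d (d (o m * i))
  neg-eq = solve-∀
  pos-eq : ∀ m n i J → let d = λ (x : ℤ) → x + x ; o = λ (x : ℤ) → 1ℤ + (x + x) in
    d (m + 1ℤ + n) * d (m + 1ℤ + n) + (d (d ((1ℤ + i) * (o n + (1ℤ + i)))) + d (o (n + (1ℤ + i)) * o J))
    ≡ (o (1ℤ + (n + i)) - o m) * (o (1ℤ + (n + i)) - o m) + d (o (1ℤ + (n + i)) * o J) + d (d (o m * (1ℤ + (1ℤ + (n + i) + n))))
  pos-eq = solve-∀
  top-eq : ∀ m J A k → let d = λ (x : ℤ) → x + x ; o = λ (x : ℤ) → 1ℤ + (x + x) in (o A + o m) * (o A + o m) + d (o A * o J) + d (d (o m * k))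
    ≡ (o A - o m) * (o A - o m) + d (o A * o J) + d (d (o m * (1ℤ + (A + (A + k)))))
  top-eq = solve-∀
  finish : Cut (λ ((i , J , m) , n) → eS⁺ (((i , J) , + n) , m)) one (λ ((i , J , m) , n) → eS⁺ (((i , J) , -[1+ n ]) , m)) one s → GF (eT₁ id) one (t₂ ⊞ s)
  finish (cut s₀ s₁ p₀ p₁ eq) = gf-resp (λ n → trans (rearr⁺ (s₀ n) (t₂ n) (s₁ n)) (cong (λ z → t₂ n + z) (sym (eq n))))
    (gf-join (rearrange (λ (m , J , A , k) → (m , J) , A , k) (λ ((m , J) , A , k) → m , J , A , k) (λ _ → refl) (λ _ → refl) (split-< (ℕ × ℕ)))
      {e₁ = λ ((m , J) , A , n) → eT₁ id (m , J , A , suc (A ℕ.+ n))} {v₁ = one} {e₂ = λ ((m , J) , i , n) → eS⁺ (((i , J) , -[1+ n ]) , m)} {v₂ = one}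
      (λ _ → refl) (λ ((m , J) , i , n) → neg-eq (+ m) (+ n) (+ i) (+ J)) (λ _ → refl) (λ _ → refl)
      (gf-join (rearrange (λ ((m , J) , A , n) → (m , J) , n , A) (λ ((m , J) , n , A) → (m , J) , A , n) (λ _ → refl) (λ _ → refl) (split-< (ℕ × ℕ)))
        {e₁ = λ ((m , J) , n , i) → eS⁺ (((i , J) , + n) , m)} {v₁ = one} {e₂ = λ ((m , J) , A , k) → eT₂ id (m , J , A , k)} {v₂ = one}
        (λ ((m , J) , n , i) → pos-eq (+ m) (+ n) (+ i) (+ J)) (λ ((m , J) , A , k) → top-eq (+ m) (+ J) (+ A) (+ k)) (λ _ → refl) (λ _ → refl)
        (gf-↔ (λ ((i , J , m) , n) → (m , J) , n , i) (λ ((m , J) , n , i) → (i , J , m) , n) (λ _ → refl) (λ _ → refl) (λ _ → refl) (λ _ → refl) p₀)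
        (gf-↔ (λ (m , J , A , k) → (m , J) , A , k) (λ ((m , J) , A , k) → m , J , A , k) (λ _ → refl) (λ _ → refl) (λ _ → refl) (λ _ → refl) gt₂))
      (gf-↔ (λ ((i , J , m) , n) → (m , J) , i , n) (λ ((m , J) , i , n) → (i , J , m) , n) (λ _ → refl) (λ _ → refl) (λ _ → refl) (λ _ → refl) p₁))

-- For e = b - w > 0 the same computation has κ = (a - b)/2, whose range 1 ≤ κ ≤ a calls for `suc`;
-- what exceeds a is again positive after subtracting a.
gT⁻ : ∀ {s} → GF eS⁻ one s → GF (eT₁ suc) one (t₂⁺ ⊞ s)
gT⁻ {s} p = finish (sign-cut {e = eS⁻} p)
  where
  neg-eq : ∀ m n i J → let d = λ (x : ℤ) → x + x ; o = λ (x : ℤ) → 1ℤ + (x + x) in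
    d (- (1ℤ + m) + 1ℤ + - (1ℤ + n)) * d (- (1ℤ + m) + 1ℤ + - (1ℤ + n)) + (d (d (i * (o n + i))) + d (o (n + i) * o J))
    ≡ (o (n + i) - o m) * (o (n + i) - o m) + d (o (n + i) * o J) + d (d (o m * (1ℤ + (n + i + n))))
  neg-eq = solve-∀
  pos-eq : ∀ m n i J → let d = λ (x : ℤ) → x + x ; o = λ (x : ℤ) → 1ℤ + (x + x) in
    d (- (1ℤ + m) + 1ℤ + n) * d (- (1ℤ + m) + 1ℤ + n) + (d (d ((1ℤ + i) * (o n + (1ℤ + i)))) + d (o (n + (1ℤ + i)) * o J))
    ≡ (o (1ℤ + (i + n)) - o m) * (o (1ℤ + (i + n)) - o m) + d (o (1ℤ + (i + n)) * o J) + d (d (o m * (1ℤ + i)))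
  pos-eq = solve-∀
  top-eq : ∀ m J A k → let d = λ (x : ℤ) → x + x ; o = λ (x : ℤ) → 1ℤ + (x + x) in (o A + o m) * (o A + o m) + d (o A * o J) + d (d (o m * (1ℤ + k)))
    ≡ (o A - o m) * (o A - o m) + d (o A * o J) + d (d (o m * (1ℤ + (A + (1ℤ + (A + k))))))
  top-eq = solve-∀
  finish : Cut (λ ((i , J , m) , n) → eS⁻ (((i , J) , + n) , m)) one (λ ((i , J , m) , n) → eS⁻ (((i , J) , -[1+ n ]) , m)) one s → GF (eT₁ suc) one (t₂⁺ ⊞ s)
  finish (cut s₀ s₁ p₀ p₁ eq) = gf-resp (λ n → trans (rearr⁻ (s₀ n) (t₂⁺ n) (s₁ n)) (cong (λ z → t₂⁺ n + z) (sym (eq n))))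
    (gf-join (rearrange (λ (m , J , A , k) → (m , J) , k , A) (λ ((m , J) , k , A) → m , J , A , k) (λ _ → refl) (λ _ → refl) (split-< (ℕ × ℕ)))
      {e₁ = λ ((m , J) , i , n) → eS⁻ (((i , J) , + n) , m)} {v₁ = one} {e₂ = λ ((m , J) , A , n) → eT₁ suc (m , J , A , A ℕ.+ n)} {v₂ = one}
      (λ ((m , J) , i , n) → pos-eq (+ m) (+ n) (+ i) (+ J)) (λ _ → refl) (λ _ → refl) (λ _ → refl)
      (gf-↔ (λ ((i , J , m) , n) → (m , J) , i , n) (λ ((m , J) , i , n) → (i , J , m) , n) (λ _ → refl) (λ _ → refl) (λ _ → refl) (λ _ → refl) p₀)
      (gf-join (split-< (ℕ × ℕ))
        {e₁ = λ ((m , J) , A , k) → eT₂ suc (m , J , A , k)} {v₁ = one} {e₂ = λ ((m , J) , n , i) → eS⁻ (((i , J) , -[1+ n ]) , m)} {v₂ = one}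
        (λ ((m , J) , A , k) → top-eq (+ m) (+ J) (+ A) (+ k)) (λ ((m , J) , n , i) → neg-eq (+ m) (+ n) (+ i) (+ J)) (λ _ → refl) (λ _ → refl)
        (gf-↔ (λ (m , J , A , k) → (m , J) , A , k) (λ ((m , J) , A , k) → m , J , A , k) (λ _ → refl) (λ _ → refl) (λ _ → refl) (λ _ → refl) gt₂⁺)
        (gf-↔ (λ ((i , J , m) , n) → (m , J) , n , i) (λ ((m , J) , n , i) → (i , J , m) , n) (λ _ → refl) (λ _ → refl) (λ _ → refl) (λ _ → refl) p₁)))

θY : θ ⊛ formsY ≗ dil E
θY n = trans (Cut.sum cut-Y n) (cancel-⊞ {Cut.part₁ cut-Y n} {Cut.part₂ cut-Y n} {t₁ n} {t₁⁺ n} {t₂ n} {t₂⁺ n}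
  (gf-det gt₁ (gT⁺ (Cut.gf₁ cut-Y)) n) (gf-det gt₁⁺ (gT⁻ (Cut.gf₂ cut-Y)) n) (Balanced.sum balanced n))

θ-cancel : ∀ f g → θ ⊛ f ≗ θ ⊛ g → f ≗ g
θ-cancel f g h n = trans (lem (f n) (g n)) (trans (cong (_+ g n) (zero-diff n)) (ℤₚ.+-identityˡ (g n)))
  where
  lem : ∀ a b → a ≡ a + -1ℤ * b + b
  lem = solve-∀
  self : ∀ a → a + -1ℤ * a ≡ 0ℤ
  self = solve-∀
  δ : Series
  δ = f ⊞ -1ℤ ⊙ g
  θδ : ∀ n → (θ ⊛ δ) n ≡ 0ℤ
  θδ n = trans (⊛-distribˡ θ f (-1ℤ ⊙ g) n) (trans (cong₂ _+_ (h n) (⊛-scaleʳ -1ℤ θ g n)) (self ((θ ⊛ g) n)))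
  zero-diff : ∀ n → δ n ≡ 0ℤ
  zero-diff = <-rec (λ n → δ n ≡ 0ℤ) (λ n ih → trans (sym (ℤₚ.*-identityˡ (δ n))) (trans (sym (⊛-low₀ θ δ n (λ i → ih {i}))) (θδ n)))

Y≗ : formsY ≗ ψ ⊛ ψ ⊛ θ
Y≗ = θ-cancel formsY (ψ ⊛ ψ ⊛ θ) (λ n → trans (θY n) (trans (dil-E n) (solve 2 (λ p t → p :* p :* (t :* t) := t :* (p :* p :* t)) (λ _ → refl) ψ θ n)))

abstract
  three-squares₂ : ∀ k → ∃[ p ] ∃[ r ] ∃[ t ] (h₄ p * h₄ p + h₄ r * h₄ r) + d t * d t ≡ + suc (suc (q k))
  three-squares₂ k = go (enum-nonempty (λ h → positive (trans (Y≗ (2 ℕ.+ q k)) h)) (gf-× {e = sum2 h₄ h₄} {e′ = sq d} (≥0₂ h₄ h₄) (sq-≥0 d) (gf-sum2 {h₄} {h₄} gψ gψ) gθ (2 ℕ.+ q k)))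
    where
    go : Σ[ x ∈ (ℤ × ℤ) × ℤ ] sum2 h₄ h₄ (proj₁ x) + sq d (proj₂ x) ≡ + (2 ℕ.+ q k) → ∃[ p ] ∃[ r ] ∃[ t ] (h₄ p * h₄ p + h₄ r * h₄ r) + d t * d t ≡ + suc (suc (q k))
    go (((p , r) , t) , e) = p , r , t , e
    positive : formsY (2 ℕ.+ q k) ≢ 0ℤ
    positive = enum-count>0 {x = (0 , k) , -[1+ 0 ]} (lem (+ k)) (proj₂ gfY (2 ℕ.+ q k))
      where
      lem : ∀ k → let d = λ (x : ℤ) → x + x in d (d (+ 0 * (1ℤ + (+ 0 + + 0) + + 0))) + d ((1ℤ + (d (+ 0) + d (+ 0))) * (1ℤ + (k + k)))
        ≡ + 2 + d (d k)
      lem = solve-∀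

-- Residues modulo 3

not-multiple : ∀ m v {_ : False (m ∣? ∣ v ∣)} W → + m * W ≢ v
not-multiple m v {f} W e = toWitnessFalse f (divides ∣ W ∣ (trans (cong ∣_∣ (sym e)) (trans (ℤₚ.abs-* (+ m) W) (ℕₚ.*-comm m ∣ W ∣))))

-- S = N is refuted by a polynomial identity m W = S - N + v with m not dividing the constant v.
refute : ∀ m v {_ : False (m ∣? ∣ v ∣)} {S N} → S ≡ N → ∀ W → + m * W ≡ S - N + v → ⊥
refute m v {f} {S} refl W e = not-multiple m v {f} W (trans e (lem S v))
  where
  lem : ∀ S v → S - S + v ≡ v
  lem = solve-∀

-- Up to sign these are all numbers prime to 3 and all numbers prime to 6. Their squares arise on
-- completing the square in p₈ and p₅.
c₃ c₆ : ℤ → ℤ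
c₃ t = + 3 * t - 1ℤ
c₆ t = + 6 * t - 1ℤ

data SameUpToSign (z : ℤ) : ℤ → Set where
  same : SameUpToSign z z
  opp  : SameUpToSign z (- z)

same-sq : ∀ {z z′} → SameUpToSign z z′ → z′ * z′ ≡ z * z
same-sq same = refl
same-sq {z} opp = lem z
  where
  lem : ∀ z → - z * - z ≡ z * z
  lem = solve-∀

data Unit : ℤ → Set where
  unit⁺ : ∀ t → Unit (c₃ t)
  unit⁻ : ∀ t → Unit (- c₃ t)

data Mod₃ : ℤ → Set where
  third : ∀ t → Mod₃ (+ 3 * t)
  unit  : ∀ {z} → Unit z → Mod₃ z

mod₃ : ∀ z → Mod₃ z
mod₃ z = go (z %ℕ 3) (z /ℕ 3) (n%ℕd<d z 3) (a≡a%ℕn+[a/ℕn]*n z 3)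
  where
  lem₀ : ∀ k → + 3 * k ≡ + 0 + k * + 3
  lem₀ = solve-∀
  lem₁ : ∀ k → - (+ 3 * - k - 1ℤ) ≡ + 1 + k * + 3
  lem₁ = solve-∀
  lem₂ : ∀ k → + 3 * (k + 1ℤ) - 1ℤ ≡ + 2 + k * + 3
  lem₂ = solve-∀
  go : ∀ r k → r ℕ.< 3 → z ≡ + r + k * + 3 → Mod₃ z
  go 0 k _ e = subst Mod₃ (trans (lem₀ k) (sym e)) (third k)
  go 1 k _ e = subst Mod₃ (trans (lem₁ k) (sym e)) (unit (unit⁻ (- k)))
  go 2 k _ e = subst Mod₃ (trans (lem₂ k) (sym e)) (unit (unit⁺ (k + 1ℤ)))
  go (suc (suc (suc _))) k (s≤s (s≤s (s≤s ()))) _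

unit-norm : ∀ {z} → Unit z → ∃[ t ] SameUpToSign z (c₃ t)
unit-norm (unit⁺ t) = t , same
unit-norm (unit⁻ t) = t , subst (SameUpToSign (- c₃ t)) (ℤₚ.neg-involutive (c₃ t)) opp

unit-sq : ∀ {z} → Unit z → ∃[ t ] z * z ≡ c₃ t * c₃ t
unit-sq u = let t , s = unit-norm u in t , sym (same-sq s)

data Norm : ℤ → Set where
  zero₃ : ∀ t → Norm (+ 3 * t)
  unit₃ : ∀ t → Norm (c₃ t)

norm : ∀ z → ∃[ z′ ] SameUpToSign z z′ × Norm z′
norm z = go (mod₃ z)
  where
  go : ∀ {z} → Mod₃ z → ∃[ z′ ] SameUpToSign z z′ × Norm z′
  go (third t) = + 3 * t , same , zero₃ t
  go (unit u)  = let t , ± = unit-norm u in c₃ t , ± , unit₃ t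

residue : ∀ {z} → Norm z → ℤ
residue (zero₃ _) = 0ℤ
residue (unit₃ _) = 1ℤ

norm-sq : ∀ {z} (u : Norm z) → ∃[ s ] z * z ≡ + 3 * s + residue u
norm-sq (zero₃ t) = + 3 * (t * t) , lem t
  where
  lem : ∀ t → + 3 * t * (+ 3 * t) ≡ + 3 * (+ 3 * (t * t)) + 0ℤ
  lem = solve-∀
norm-sq (unit₃ t) = + 3 * (t * t) - + 2 * t , lem t
  where
  lem : ∀ t → (+ 3 * t - 1ℤ) * (+ 3 * t - 1ℤ) ≡ + 3 * (+ 3 * (t * t) - + 2 * t) + 1ℤ
  lem = solve-∀

cong₃ : {A B C D : Set} (f : A → B → C → D) {a a′ : A} {b b′ : B} {c c′ : C} → a ≡ a′ → b ≡ b′ → c ≡ c′ → f a b c ≡ f a′ b′ c′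
cong₃ f refl refl refl = refl

data Odd : ℤ → Set where
  odd : ∀ k → Odd (h₂ k)

odd-≡ : ∀ {z} k → z ≡ h₂ k → Odd z
odd-≡ k refl = odd k

odd-± : ∀ {z z′} → SameUpToSign z z′ → Odd z → Odd z′
odd-± same o = o
odd-± opp (odd k) = odd-≡ (- k - 1ℤ) (lem k)
  where
  lem : ∀ k → - (k + k + 1ℤ) ≡ - k - 1ℤ + (- k - 1ℤ) + 1ℤ
  lem = solve-∀

-- Only squares enter, so each variable may be replaced by its multiple of -1 of the form 3t or 3t -
-- 1.
normalised : ∀ (f : ℤ → ℤ → ℤ → ℤ) {N} {G : Set} x y z → Odd x → f (x * x) (y * y) (z * z) ≡ N →
  (∀ {x y z} → Norm x → Norm y → Norm z → Odd x → f (x * x) (y * y) (z * z) ≡ N → G) → G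
normalised f x y z o h k = let x′ , s , u = norm x ; y′ , s′ , v = norm y ; z′ , s″ , w = norm z in
  k u v w (odd-± s o) (trans (cong₃ f (same-sq s) (same-sq s′) (same-sq s″)) h)

-- Excludes one pattern of residues modulo 3; that the pattern contradicts τ is decided by
-- evaluation.
no-residue : ∀ b c T τ {x y z} (u : Norm x) (v : Norm y) (w : Norm z)
  {_ : False (3 ∣? ∣ τ - (residue u + b * residue v + c * residue w) ∣)} →
  x * x + b * (y * y) + c * (z * z) ≡ + 3 * T + τ → ⊥
no-residue b c T τ u v w {f} h with norm-sq u | norm-sq v | norm-sq w
... | r , ex | s , ey | t , ez = refute 3 (τ - (residue u + b * residue v + c * residue w)) {f}
  (trans (sym (cong₃ (λ x y z → x + b * y + c * z) ex ey ez)) h) (r + b * s + c * t - T) (lem b c T τ r s t (residue u) (residue v) (residue w))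
  where
  lem : ∀ b c T τ r s t e f g → + 3 * (r + b * s + c * t - T)
    ≡ + 3 * r + e + b * (+ 3 * s + f) + c * (+ 3 * t + g) - (+ 3 * T + τ) + (τ - (e + b * f + c * g))
  lem = solve-∀

odd-third : ∀ {a} → Odd (+ 3 * a) → Odd a
odd-third {a} o = go o refl (parityℤ a)
  where
  lem : ∀ k → + 3 * (k + k) ≡ + 3 * k + + 3 * k
  lem = solve-∀
  go : ∀ {z a} → Odd z → z ≡ + 3 * a → ℤParity a → Odd a
  go _ _ (oddℤ k) = odd k
  go (odd j) e (evenℤ k) = ⊥-elim (even≢odd {+ 3 * k} {j} (sym (trans e (lem k))))

odd-pos : ∀ {a} → Odd a → 0 ℕ.< ∣ a ∣
odd-pos (odd k) = ℕₚ.n≢0⇒n>0 (λ e → even≢odd {0ℤ} {k} (sym (ℤₚ.∣i∣≡0⇒i≡0 e)))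

odd-size : ∀ {a} → Odd a → ∣ a ∣ ℕ.< ∣ + 3 * a ∣
odd-size {a} o = subst (∣ a ∣ ℕ.<_) (sym (ℤₚ.abs-* (+ 3) a)) (ℕₚ.m<m+n ∣ a ∣ (ℕₚ.<-≤-trans (odd-pos o) (ℕₚ.m≤m+n ∣ a ∣ _)))

odd-neg+ : ∀ {x X} r → Odd x → X ≡ - x + (r + r) → Odd X
odd-neg+ r (odd k) refl = odd-≡ (r - k - 1ℤ) (lem r k)
  where
  lem : ∀ r k → - (k + k + 1ℤ) + (r + r) ≡ r - k - 1ℤ + (r - k - 1ℤ) + 1ℤ
  lem = solve-∀

odd-c₃ : ∀ t → Odd (c₃ t) → ∃[ s ] c₃ t ≡ c₆ s
odd-c₃ t o = go o refl (parityℤ t)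
  where
  lem₀ : ∀ k → + 3 * (k + k) - 1ℤ ≡ + 6 * k - 1ℤ
  lem₀ = solve-∀
  lem₁ : ∀ k → + 3 * (k + k + 1ℤ) - 1ℤ ≡ + 3 * k + 1ℤ + (+ 3 * k + 1ℤ)
  lem₁ = solve-∀
  go : ∀ {z t} → Odd z → z ≡ c₃ t → ℤParity t → ∃[ s ] c₃ t ≡ c₆ s
  go _ _ (evenℤ k) = k , lem₀ k
  go (odd j) e (oddℤ k) = ⊥-elim (even≢odd {+ 3 * k + 1ℤ} {j} (sym (trans e (lem₁ k))))

odd-unit-sq : ∀ {z} → Odd z → Unit z → ∃[ s ] z * z ≡ c₆ s * c₆ s
odd-unit-sq o u = let t , ± = unit-norm u ; s , e = odd-c₃ t (odd-± ± o) in s , trans (sym (same-sq ±)) (cong (λ x → x * x) e)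

unit-neg : ∀ {z} → Unit z → Unit (- z)
unit-neg (unit⁺ t) = unit⁻ t
unit-neg (unit⁻ t) = subst Unit (sym (ℤₚ.neg-involutive (c₃ t))) (unit⁺ t)

unit-shift : ∀ {z z′} k → Unit z → z′ ≡ z + + 3 * k → Unit z′
unit-shift k (unit⁺ t) refl = subst Unit (lem t k) (unit⁺ (t + k))
  where
  lem : ∀ t k → + 3 * (t + k) - 1ℤ ≡ + 3 * t - 1ℤ + + 3 * k
  lem = solve-∀
unit-shift k (unit⁻ t) refl = subst Unit (lem t k) (unit⁻ (t - k))
  where
  lem : ∀ t k → - (+ 3 * (t - k) - 1ℤ) ≡ - (+ 3 * t - 1ℤ) + + 3 * k
  lem = solve-∀

unit-near : ∀ {x y} → Unit x → Unit y → ∃[ y′ ] SameUpToSign y y′ × ∃[ k ] y′ ≡ x + + 3 * k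
unit-near u v = go u (unit-norm v)
  where
  lem₁ : ∀ s t → + 3 * t - 1ℤ ≡ + 3 * s - 1ℤ + + 3 * (t - s)
  lem₁ = solve-∀
  lem₂ : ∀ s t → - (+ 3 * t - 1ℤ) ≡ - (+ 3 * s - 1ℤ) + + 3 * (s - t)
  lem₂ = solve-∀
  flip : ∀ {y y′} → SameUpToSign y y′ → SameUpToSign y (- y′)
  flip same = opp
  flip {y} opp = subst (SameUpToSign y) (sym (ℤₚ.neg-involutive y)) same
  go : ∀ {x y} → Unit x → ∃[ t ] SameUpToSign y (c₃ t) → ∃[ y′ ] SameUpToSign y y′ × ∃[ k ] y′ ≡ x + + 3 * k
  go (unit⁺ s) (t , ±) = c₃ t , ± , t - s , lem₁ s t
  go (unit⁻ s) (t , ±) = - c₃ t , flip ± , s - t , lem₂ s t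

-- If y is prime to 3, one of ±y is congruent to x, and then the sum is 2x ≡ -x.
add-unit : ∀ {x y} → Unit x → Mod₃ y → ∃[ y′ ] SameUpToSign y y′ × Unit (x + y′)
add-unit u (third t) = + 3 * t , same , unit-shift t u refl
add-unit {x} u (unit v) = let y′ , ± , k , e = unit-near u v in y′ , ± , unit-shift (x + k) (unit-neg u) (trans (cong (_+_ x) e) (lem x k))
  where
  lem : ∀ x k → x + (x + + 3 * k) ≡ - x + + 3 * (x + k)
  lem = solve-∀

unit-third : ∀ {y} a → Unit y → Unit (+ 3 * a + y)
unit-third {y} a u = unit-shift a u (ℤₚ.+-comm (+ 3 * a) y)

-- Rotations with denominator 3

-- A rotation by a matrix M / 3 with M integral multiplies a value of Q by 9 when taken without its denominator,
-- and M v is prime to 3 unless v ≡ 0; descending through the vectors divisible by 3 removes the exception.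
module Rotation {V : Set} (Q first : V → ℤ) (Prime Good : V → Set)
  (prime⇒good : ∀ {v} → Prime v → Good v)
  (thirds : ∀ v → Good v ⊎ (Σ[ w ∈ V ] first v ≡ + 3 * first w × Q v ≡ + 9 * Q w))
  (turn : ∀ {v} → Good v → Odd (first v) → Σ[ w ∈ V ] Odd (first w) × Prime w × Q w ≡ + 9 * Q v)
  where

  -- An odd first coordinate is nonzero, so dividing it by 3 makes it strictly smaller.
  descend : ∀ n v → ∣ first v ∣ ℕ.≤ n → Odd (first v) → Σ[ w ∈ V ] Odd (first w) × Prime w × Q w ≡ + 9 * Q v
  descend zero v le o = ⊥-elim (ℕₚ.<⇒≱ (odd-pos o) le)
  descend (suc n) v le o = go (thirds v)
    where
    Result = Σ[ w ∈ V ] Odd (first w) × Prime w × Q w ≡ + 9 * Q v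
    -- The vector obtained from w has value 9 Q(w) = Q(v) and is prime to 3, so one more turn is
    -- possible and yields 9 Q(v).
    again : ∀ {w} → Q v ≡ + 9 * Q w → (Σ[ u ∈ V ] Odd (first u) × Prime u × Q u ≡ + 9 * Q w) → Result
    again e (_ , o′ , p′ , e′) = let t , o″ , p″ , e″ = turn (prime⇒good p′) o′ in t , o″ , p″ , trans e″ (cong (_*_ (+ 9)) (trans e′ (sym e)))
    go : _ → Result
    go (inj₁ g) = turn g o
    go (inj₂ (w , ew , e)) = again e (descend n w (ℕₚ.≤-pred (ℕₚ.<-≤-trans (subst (λ t → ∣ first w ∣ ℕ.< ∣ t ∣) (sym ew) (odd-size odd-w)) le)) odd-w)
      where
      odd-w : Odd (first w)
      odd-w = odd-third (subst Odd ew o)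

  rotate : ∀ v → Odd (first v) → Σ[ w ∈ V ] Odd (first w) × Prime w × Q w ≡ + 9 * Q v
  rotate v = descend ∣ first v ∣ v ℕₚ.≤-refl

record Units (q : ℤ → ℤ → ℤ → ℤ) (v : ℤ) : Set where
  constructor units
  field
    {X Y Z} : ℤ
    odd-X : Odd X
    unit-X : Unit X
    unit-Y : Unit Y
    unit-Z : Unit Z
    value : q X Y Z ≡ v

-- `turn` asks for a single condition because every row of the matrices used is ±(1, 1, 1) modulo 3.
-- Signs of y and z that meet it exist unless 3 divides all three variables.
module TernaryRotation (f : ℤ → ℤ → ℤ → ℤ)
  (nine : ∀ a b c → f ((+ 3 * a) * (+ 3 * a)) ((+ 3 * b) * (+ 3 * b)) ((+ 3 * c) * (+ 3 * c)) ≡ + 9 * f (a * a) (b * b) (c * c))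
  (turn : ∀ x y z → Odd x → Unit (x + y + z) → Units (λ X Y Z → f (X * X) (Y * Y) (Z * Z)) (+ 9 * f (x * x) (y * y) (z * z)))
  where

  private
    V = ℤ × ℤ × ℤ
    Q first : V → ℤ
    Q (x , y , z) = f (x * x) (y * y) (z * z)
    first (x , _) = x
    Prime Good : V → Set
    Prime (x , y , z) = Unit x × Unit y × Unit z
    Good (x , y , z) = ∃[ y′ ] SameUpToSign y y′ × ∃[ z′ ] SameUpToSign z z′ × Unit (x + y′ + z′)
    good : ∀ {x y z y′} → SameUpToSign y y′ → Unit (x + y′) → Mod₃ z → Good (x , y , z)
    good {y′ = y′} s u w = let z′ , s′ , u′ = add-unit u w in y′ , s , z′ , s′ , u′
    prime⇒good : ∀ {v} → Prime v → Good v
    prime⇒good {x , _} (u , v , w) = let _ , s , t = add-unit u (unit v) in good {x} s t (unit w)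
    thirds : ∀ v → Good v ⊎ (Σ[ w ∈ V ] first v ≡ + 3 * first w × Q v ≡ + 9 * Q w)
    thirds (x , y , z) = go (mod₃ x) (mod₃ y) (mod₃ z)
      where
      go : ∀ {x y z} → Mod₃ x → Mod₃ y → Mod₃ z → Good (x , y , z) ⊎ (Σ[ w ∈ V ] x ≡ + 3 * first w × f (x * x) (y * y) (z * z) ≡ + 9 * Q w)
      go {x} (unit u) v w = let _ , s , t = add-unit u v in inj₁ (good {x} s t w)
      go (third a) (unit v) w = inj₁ (good {+ 3 * a} same (unit-third a v) w)
      go {z = z} (third a) (third b) (unit w) = inj₁ (_ , same , _ , same , subst (λ t → Unit (t + z)) (ℤₚ.*-distribˡ-+ (+ 3) a b) (unit-third (a + b) w))
      go (third a) (third b) (third c) = inj₂ ((a , b , c) , refl , nine a b c)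
    turn′ : ∀ {v} → Good v → Odd (first v) → Σ[ w ∈ V ] Odd (first w) × Prime w × Q w ≡ + 9 * Q v
    turn′ {x , y , z} (y′ , s , z′ , s′ , u) o with turn x y′ z′ o u
    ... | units {X} {Y} {Z} oX uX uY uZ e = (X , Y , Z) , oX , (uX , uY , uZ) , trans e (cong (_*_ (+ 9)) (cong₂ (f (x * x)) (same-sq s) (same-sq s′)))

  rotate : ∀ x y z → Odd x → Units (λ X Y Z → f (X * X) (Y * Y) (Z * Z)) (+ 9 * f (x * x) (y * y) (z * z))
  rotate x y z o = let _ , oX , (uX , uY , uZ) , e = Rotation.rotate Q first Prime Good prime⇒good thirds turn′ (x , y , z) o in units oX uX uY uZ e

value₁₄₄ value₁₁₄ : ℤ → ℤ → ℤ → ℤ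
value₁₄₄ x y z = x * x + + 4 * (y * y) + + 4 * (z * z)
value₁₁₄ x y z = x * x + y * y + + 4 * (z * z)

Units₁₄₄ Units₁₁₄ : ℤ → Set
Units₁₄₄ = Units value₁₄₄
Units₁₁₄ = Units value₁₁₄

abstract
  rotate₁₄₄ : ∀ x y z → Odd x → Units₁₄₄ (+ 9 * value₁₄₄ x y z)
  rotate₁₄₄ = TernaryRotation.rotate (λ a b c → a + + 4 * b + + 4 * c) nine turn
    where
    nine : ∀ a b c → + 3 * a * (+ 3 * a) + + 4 * (+ 3 * b * (+ 3 * b)) + + 4 * (+ 3 * c * (+ 3 * c)) ≡ + 9 * (a * a + + 4 * (b * b) + + 4 * (c * c))
    nine = solve-∀
    odd-X : ∀ x y z → - x - + 4 * y - + 4 * z ≡ - x + (- + 2 * y - + 2 * z + (- + 2 * y - + 2 * z))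
    odd-X = solve-∀
    X≡ : ∀ x y z → - x - + 4 * y - + 4 * z ≡ - (x + y + z) + + 3 * (- y - z)
    X≡ = solve-∀
    Y≡ : ∀ x y z → - x - y + + 2 * z ≡ - (x + y + z) + + 3 * z
    Y≡ = solve-∀
    Z≡ : ∀ x y z → - x + + 2 * y - z ≡ - (x + y + z) + + 3 * y
    Z≡ = solve-∀
    value : ∀ x y z → (- x - + 4 * y - + 4 * z) * (- x - + 4 * y - + 4 * z) + + 4 * ((- x - y + + 2 * z) * (- x - y + + 2 * z)) + + 4 * ((- x + + 2 * y - z) * (- x + + 2 * y - z)) ≡ + 9 * (x * x + + 4 * (y * y) + + 4 * (z * z))
    value = solve-∀
    turn : ∀ x y z → Odd x → Unit (x + y + z) → Units₁₄₄ (+ 9 * value₁₄₄ x y z)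
    turn x y z o u = units (odd-neg+ (- + 2 * y - + 2 * z) o (odd-X x y z)) (unit-shift (- y - z) (unit-neg u) (X≡ x y z)) (unit-shift z (unit-neg u) (Y≡ x y z)) (unit-shift y (unit-neg u) (Z≡ x y z)) (value x y z)

  rotate₁₁₄ : ∀ x y z → Odd x → Units₁₁₄ (+ 9 * value₁₁₄ x y z)
  rotate₁₁₄ = TernaryRotation.rotate (λ a b c → a + b + + 4 * c) nine turn
    where
    nine : ∀ a b c → + 3 * a * (+ 3 * a) + + 3 * b * (+ 3 * b) + + 4 * (+ 3 * c * (+ 3 * c)) ≡ + 9 * (a * a + b * b + + 4 * (c * c))
    nine = solve-∀
    odd-X : ∀ x y z → - x + + 2 * y - + 4 * z ≡ - x + (y - + 2 * z + (y - + 2 * z))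
    odd-X = solve-∀
    X≡ : ∀ x y z → - x + + 2 * y - + 4 * z ≡ - (x + y + z) + + 3 * (y - z)
    X≡ = solve-∀
    Y≡ : ∀ x y z → + 2 * x - y - + 4 * z ≡ - (x + y + z) + + 3 * (x - z)
    Y≡ = solve-∀
    value : ∀ x y z → (- x + + 2 * y - + 4 * z) * (- x + + 2 * y - + 4 * z) + (+ 2 * x - y - + 4 * z) * (+ 2 * x - y - + 4 * z) + + 4 * ((x + y + z) * (x + y + z)) ≡ + 9 * (x * x + y * y + + 4 * (z * z))
    value = solve-∀
    turn : ∀ x y z → Odd x → Unit (x + y + z) → Units₁₁₄ (+ 9 * value₁₁₄ x y z)
    turn x y z o u = units (odd-neg+ (y - + 2 * z) o (odd-X x y z)) (unit-shift (y - z) (unit-neg u) (X≡ x y z)) (unit-shift (x - z) (unit-neg u) (Y≡ x y z)) u (value x y z)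

value₁₂ : ℤ → ℤ → ℤ
value₁₂ x y = x * x + + 2 * (y * y)

record Units₁₂ (v : ℤ) : Set where
  constructor units
  field
    {X Y} : ℤ
    odd-X : Odd X
    unit-X : Unit X
    unit-Y : Unit Y
    value : value₁₂ X Y ≡ v

-- The turn is multiplication of x + y√-2 by -1 + 2√-2 = (1 + √-2)², an element of norm 9 not
-- divisible by 3.
module BinaryRotation where

  V = ℤ × ℤ
  Q : V → ℤ
  Q (x , y) = value₁₂ x y
  Prime Good : V → Set
  Prime (x , y) = Unit x × Unit y
  Good (x , y) = ∃[ y′ ] SameUpToSign y y′ × Unit (x + y′)
  prime⇒good : ∀ {v} → Prime v → Good v
  prime⇒good (u , v) = add-unit u (unit v)
  nine : ∀ a b → + 3 * a * (+ 3 * a) + + 2 * (+ 3 * b * (+ 3 * b)) ≡ + 9 * (a * a + + 2 * (b * b))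
  nine = solve-∀
  odd-X : ∀ x y → - x - + 4 * y ≡ - x + (- + 2 * y + - + 2 * y)
  odd-X = solve-∀
  X≡ : ∀ x y → - x - + 4 * y ≡ - (x + y) + + 3 * - y
  X≡ = solve-∀
  Y≡ : ∀ x y → + 2 * x - y ≡ - (x + y) + + 3 * x
  Y≡ = solve-∀
  value : ∀ x y → (- x - + 4 * y) * (- x - + 4 * y) + + 2 * ((+ 2 * x - y) * (+ 2 * x - y)) ≡ + 9 * (x * x + + 2 * (y * y))
  value = solve-∀
  thirds : ∀ v → Good v ⊎ (Σ[ w ∈ V ] proj₁ v ≡ + 3 * proj₁ w × Q v ≡ + 9 * Q w)
  thirds (x , y) = go (mod₃ x) (mod₃ y)
    where
    go : ∀ {x y} → Mod₃ x → Mod₃ y → Good (x , y) ⊎ (Σ[ w ∈ V ] x ≡ + 3 * proj₁ w × value₁₂ x y ≡ + 9 * Q w)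
    go (unit u) v = inj₁ (add-unit u v)
    go (third a) (unit v) = inj₁ (_ , same , unit-third a v)
    go (third a) (third b) = inj₂ ((a , b) , refl , nine a b)
  turn : ∀ {v} → Good v → Odd (proj₁ v) → Σ[ w ∈ V ] Odd (proj₁ w) × Prime w × Q w ≡ + 9 * Q v
  turn {x , _} (y , s , u) o = (- x - + 4 * y , + 2 * x - y) , odd-neg+ (- + 2 * y) o (odd-X x y) ,
    (unit-shift (- y) (unit-neg u) (X≡ x y) , unit-shift x (unit-neg u) (Y≡ x y)) ,
    trans (value x y) (cong (λ t → + 9 * (x * x + + 2 * t)) (same-sq s))

abstract
  rotate₁₂ : ∀ x y → Odd x → Units₁₂ (+ 9 * value₁₂ x y)
  rotate₁₂ x y o = let _ , oX , (uX , uY) , e = Rotation.rotate Q proj₁ Prime Good prime⇒good thirds turn (x , y) o in units oX uX uY e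
    where open BinaryRotation

odd-sq : ∀ {x} → Odd x → ∃[ m ] x * x ≡ + 8 * m + + 1
odd-sq (odd k) = go (parityℤ k)
  where
  lem₀ : ∀ j → (j + j + (j + j) + 1ℤ) * (j + j + (j + j) + 1ℤ) ≡ + 8 * (+ 2 * (j * j) + j) + + 1
  lem₀ = solve-∀
  lem₁ : ∀ j → (j + j + 1ℤ + (j + j + 1ℤ) + 1ℤ) * (j + j + 1ℤ + (j + j + 1ℤ) + 1ℤ) ≡ + 8 * (+ 2 * (j * j) + + 3 * j + + 1) + + 1
  lem₁ = solve-∀
  go : ∀ {k} → ℤParity k → ∃[ m ] h₂ k * h₂ k ≡ + 8 * m + + 1
  go (evenℤ j) = + 2 * (j * j) + j , lem₀ j
  go (oddℤ j)  = + 2 * (j * j) + + 3 * j + + 1 , lem₁ j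

-- Three squares prime to 3

sq₃ sq₆ : ℤ → ℤ
sq₃ t = c₃ t * c₃ t
sq₆ t = c₆ t * c₆ t

-- The number is 12n + 9 = 4(3n + 2) + 1. As it is 0 modulo 3 and squares are 0 or 1, the variables
-- are all prime to 3 or all divisible by 3. In the second case divide by 3 and let the rotation
-- restore the factor 9.
three₉ : ∀ n → ∃[ x ] ∃[ y ] ∃[ z ] sq₆ x + + 4 * sq₃ y + + 4 * sq₃ z ≡ + 3 * (+ 4 * + n + + 3) + + 0
three₉ n = start (three-squares₁ (2 ℕ.+ (n ℕ.+ n ℕ.+ n)))
  where
  N = + 3 * (+ 4 * + n + + 3) + + 0
  Goal = ∃[ x ] ∃[ y ] ∃[ z ] sq₆ x + + 4 * sq₃ y + + 4 * sq₃ z ≡ N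
  finish : ∀ {v} → v ≡ N → Units₁₄₄ v → Goal
  finish e (units o u v w h) = let x , ex = odd-unit-sq o u ; y , ey = unit-sq v ; z , ez = unit-sq w in
    x , y , z , trans (sym (cong₃ (λ a b c → a + + 4 * b + + 4 * c) ex ey ez)) (trans h e)
  nine : ∀ a b c → + 9 * (a * a + + 4 * (b * b) + + 4 * (c * c)) ≡ + 3 * a * (+ 3 * a) + + 4 * (+ 3 * b * (+ 3 * b)) + + 4 * (+ 3 * c * (+ 3 * c))
  nine = solve-∀
  go : ∀ {x y z} → Norm x → Norm y → Norm z → Odd x → value₁₄₄ x y z ≡ N → Goal
  go (zero₃ a) (zero₃ b) (zero₃ c) o h = finish (trans (nine a b c) h) (rotate₁₄₄ a b c (odd-third o))
  go (unit₃ a) (unit₃ b) (unit₃ c) o h = finish h (units o (unit⁺ a) (unit⁺ b) (unit⁺ c) refl)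
  go (zero₃ a) (zero₃ b) (unit₃ c) o h = ⊥-elim (no-residue (+ 4) (+ 4) (+ 4 * + n + + 3) (+ 0) (zero₃ a) (zero₃ b) (unit₃ c) h)
  go (zero₃ a) (unit₃ b) (zero₃ c) o h = ⊥-elim (no-residue (+ 4) (+ 4) (+ 4 * + n + + 3) (+ 0) (zero₃ a) (unit₃ b) (zero₃ c) h)
  go (zero₃ a) (unit₃ b) (unit₃ c) o h = ⊥-elim (no-residue (+ 4) (+ 4) (+ 4 * + n + + 3) (+ 0) (zero₃ a) (unit₃ b) (unit₃ c) h)
  go (unit₃ a) (zero₃ b) (zero₃ c) o h = ⊥-elim (no-residue (+ 4) (+ 4) (+ 4 * + n + + 3) (+ 0) (unit₃ a) (zero₃ b) (zero₃ c) h)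
  go (unit₃ a) (zero₃ b) (unit₃ c) o h = ⊥-elim (no-residue (+ 4) (+ 4) (+ 4 * + n + + 3) (+ 0) (unit₃ a) (zero₃ b) (unit₃ c) h)
  go (unit₃ a) (unit₃ b) (zero₃ c) o h = ⊥-elim (no-residue (+ 4) (+ 4) (+ 4 * + n + + 3) (+ 0) (unit₃ a) (unit₃ b) (zero₃ c) h)
  lhs : ∀ p s t → (p + p + (p + p) + 1ℤ) * (p + p + (p + p) + 1ℤ) + + 4 * (s * s) + + 4 * (t * t)
    ≡ (p + p + (p + p) + 1ℤ) * (p + p + (p + p) + 1ℤ) + ((s + s) * (s + s) + (t + t) * (t + t))
  lhs = solve-∀
  rhs : ∀ n → (let k = + 2 + (n + n + n) in 1ℤ + ((k + k) + (k + k)))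
    ≡ + 3 * (+ 4 * n + + 3) + + 0
  rhs = solve-∀
  start : _ → Goal
  start (p , s , t , h) = normalised (λ a b c → a + + 4 * b + + 4 * c) (h₄ p) s t (odd (d p)) (trans (lhs p s t) (trans h (rhs (+ n)))) go

three₆ : ∀ n → ∃[ x ] ∃[ y ] ∃[ z ] sq₆ x + sq₆ y + + 4 * sq₃ z ≡ + 3 * (+ 4 * + n + + 2) + + 0
three₆ n = start (three-squares₂ (1 ℕ.+ (n ℕ.+ n ℕ.+ n)))
  where
  N = + 3 * (+ 4 * + n + + 2) + + 0
  Goal = ∃[ x ] ∃[ y ] ∃[ z ] sq₆ x + sq₆ y + + 4 * sq₃ z ≡ N
  -- the second summand is odd because the sum is even
  even-lem : ∀ b m c n → + 2 * (+ 2 * (b * b) + + 2 * (c * c) + + 4 * m - + 6 * n - + 2)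
    ≡ + 8 * m + + 1 + (b + b) * (b + b) + + 4 * (c * c) - (+ 3 * (+ 4 * n + + 2) + + 0) + + 1
  even-lem = solve-∀
  second-odd : ∀ {x y z} → Odd x → value₁₁₄ x y z ≡ N → Odd y
  second-odd {x} {y} {z} o h = by (parityℤ y) refl
    where
    by : ∀ {w} → ℤParity w → y ≡ w → Odd y
    by (oddℤ k) refl = odd k
    by (evenℤ k) refl = ⊥-elim (refute 2 (+ 1) (trans (cong (λ a → a + d k * d k + + 4 * (z * z)) (sym (proj₂ (odd-sq o)))) h) _ (even-lem k (proj₁ (odd-sq o)) z (+ n)))
  finish : ∀ {v} → v ≡ N → Units₁₁₄ v → Goal
  finish e (units {X} {Y} {Z} o u v w h) = let x , ex = odd-unit-sq o u ; y , ey = odd-unit-sq (second-odd {X} {Y} {Z} o (trans h e)) v ; z , ez = unit-sq w in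
    x , y , z , trans (sym (cong₃ (λ a b c → a + b + + 4 * c) ex ey ez)) (trans h e)
  ones : ∀ x y z → x + 1ℤ * y + + 4 * z ≡ x + y + + 4 * z
  ones = solve-∀
  nine : ∀ a b c → + 9 * (a * a + b * b + + 4 * (c * c)) ≡ + 3 * a * (+ 3 * a) + + 3 * b * (+ 3 * b) + + 4 * (+ 3 * c * (+ 3 * c))
  nine = solve-∀
  go : ∀ {x y z} → Norm x → Norm y → Norm z → Odd x → value₁₁₄ x y z ≡ N → Goal
  go (zero₃ a) (zero₃ b) (zero₃ c) o h = finish (trans (nine a b c) h) (rotate₁₁₄ a b c (odd-third o))
  go (unit₃ a) (unit₃ b) (unit₃ c) o h = finish h (units o (unit⁺ a) (unit⁺ b) (unit⁺ c) refl)
  go (zero₃ a) (zero₃ b) (unit₃ c) o h = ⊥-elim (no-residue (+ 1) (+ 4) (+ 4 * + n + + 2) (+ 0) (zero₃ a) (zero₃ b) (unit₃ c) (trans (ones (+ 3 * a * (+ 3 * a)) (+ 3 * b * (+ 3 * b)) (sq₃ c)) h))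
  go (zero₃ a) (unit₃ b) (zero₃ c) o h = ⊥-elim (no-residue (+ 1) (+ 4) (+ 4 * + n + + 2) (+ 0) (zero₃ a) (unit₃ b) (zero₃ c) (trans (ones (+ 3 * a * (+ 3 * a)) (sq₃ b) (+ 3 * c * (+ 3 * c))) h))
  go (zero₃ a) (unit₃ b) (unit₃ c) o h = ⊥-elim (no-residue (+ 1) (+ 4) (+ 4 * + n + + 2) (+ 0) (zero₃ a) (unit₃ b) (unit₃ c) (trans (ones (+ 3 * a * (+ 3 * a)) (sq₃ b) (sq₃ c)) h))
  go (unit₃ a) (zero₃ b) (zero₃ c) o h = ⊥-elim (no-residue (+ 1) (+ 4) (+ 4 * + n + + 2) (+ 0) (unit₃ a) (zero₃ b) (zero₃ c) (trans (ones (sq₃ a) (+ 3 * b * (+ 3 * b)) (+ 3 * c * (+ 3 * c))) h))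
  go (unit₃ a) (zero₃ b) (unit₃ c) o h = ⊥-elim (no-residue (+ 1) (+ 4) (+ 4 * + n + + 2) (+ 0) (unit₃ a) (zero₃ b) (unit₃ c) (trans (ones (sq₃ a) (+ 3 * b * (+ 3 * b)) (sq₃ c)) h))
  go (unit₃ a) (unit₃ b) (zero₃ c) o h = ⊥-elim (no-residue (+ 1) (+ 4) (+ 4 * + n + + 2) (+ 0) (unit₃ a) (unit₃ b) (zero₃ c) (trans (ones (sq₃ a) (sq₃ b) (+ 3 * c * (+ 3 * c))) h))
  lhs : ∀ p s t → p * p + s * s + + 4 * (t * t) ≡ p * p + s * s + (t + t) * (t + t)
  lhs = solve-∀
  rhs : ∀ n → (let k = + 1 + (n + n + n) in + 2 + ((k + k) + (k + k)))
    ≡ + 3 * (+ 4 * n + + 2) + + 0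
  rhs = solve-∀
  start : _ → Goal
  start (p , s , t , h) = normalised (λ a b c → a + b + + 4 * c) (h₄ p) (h₄ s) t (odd (d p)) (trans (lhs (h₄ p) (h₄ s) t) (trans h (rhs (+ n)))) go

-- For values congruent to 2 modulo 3 exactly one of the three squares is divisible by 3.
one-multiple : ∀ x y z T → x * x + y * y + z * z ≡ + 3 * T + + 2 → ∃[ a ] ∃[ b ] ∃[ c ] + 9 * (a * a) + sq₃ b + sq₃ c ≡ + 3 * T + + 2
one-multiple x y z T h = go (proj₂ (proj₂ (norm x))) (proj₂ (proj₂ (norm y))) (proj₂ (proj₂ (norm z)))
    (trans (cong₃ (λ a b c → a + b + c) (same-sq (proj₁ (proj₂ (norm x)))) (same-sq (proj₁ (proj₂ (norm y)))) (same-sq (proj₁ (proj₂ (norm z))))) h)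
  where
  Goal = ∃[ a ] ∃[ b ] ∃[ c ] + 9 * (a * a) + sq₃ b + sq₃ c ≡ + 3 * T + + 2
  ones : ∀ x y z → x + 1ℤ * y + 1ℤ * z ≡ x + y + z
  ones = solve-∀
  p₁ : ∀ a v w → + 9 * (a * a) + v + w ≡ + 3 * a * (+ 3 * a) + v + w
  p₁ = solve-∀
  p₂ : ∀ a v w → + 9 * (a * a) + v + w ≡ v + + 3 * a * (+ 3 * a) + w
  p₂ = solve-∀
  p₃ : ∀ a v w → + 9 * (a * a) + v + w ≡ v + w + + 3 * a * (+ 3 * a)
  p₃ = solve-∀
  go : ∀ {x y z} → Norm x → Norm y → Norm z → x * x + y * y + z * z ≡ + 3 * T + + 2 → Goal
  go (zero₃ a) (unit₃ b) (unit₃ c) h = a , b , c , trans (p₁ a (sq₃ b) (sq₃ c)) h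
  go (unit₃ b) (zero₃ a) (unit₃ c) h = a , b , c , trans (p₂ a (sq₃ b) (sq₃ c)) h
  go (unit₃ b) (unit₃ c) (zero₃ a) h = a , b , c , trans (p₃ a (sq₃ b) (sq₃ c)) h
  go (zero₃ a) (zero₃ b) (zero₃ c) h = ⊥-elim (no-residue (+ 1) (+ 1) T (+ 2) (zero₃ a) (zero₃ b) (zero₃ c) (trans (ones (+ 3 * a * (+ 3 * a)) (+ 3 * b * (+ 3 * b)) (+ 3 * c * (+ 3 * c))) h))
  go (zero₃ a) (zero₃ b) (unit₃ c) h = ⊥-elim (no-residue (+ 1) (+ 1) T (+ 2) (zero₃ a) (zero₃ b) (unit₃ c) (trans (ones (+ 3 * a * (+ 3 * a)) (+ 3 * b * (+ 3 * b)) (sq₃ c)) h))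
  go (zero₃ a) (unit₃ b) (zero₃ c) h = ⊥-elim (no-residue (+ 1) (+ 1) T (+ 2) (zero₃ a) (unit₃ b) (zero₃ c) (trans (ones (+ 3 * a * (+ 3 * a)) (sq₃ b) (+ 3 * c * (+ 3 * c))) h))
  go (unit₃ a) (zero₃ b) (zero₃ c) h = ⊥-elim (no-residue (+ 1) (+ 1) T (+ 2) (unit₃ a) (zero₃ b) (zero₃ c) (trans (ones (sq₃ a) (+ 3 * b * (+ 3 * b)) (+ 3 * c * (+ 3 * c))) h))
  go (unit₃ a) (unit₃ b) (unit₃ c) h = ⊥-elim (no-residue (+ 1) (+ 1) T (+ 2) (unit₃ a) (unit₃ b) (unit₃ c) (trans (ones (sq₃ a) (sq₃ b) (sq₃ c)) h))

three₅ : ∀ n → ∃[ a ] ∃[ b ] ∃[ c ] + 9 * (a * a) + sq₃ b + sq₃ c ≡ + 3 * (+ 4 * + n + + 1) + + 2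
three₅ n with three-squares₁ (1 ℕ.+ (n ℕ.+ n ℕ.+ n))
... | p , s , t , h = one-multiple (h₄ p) (d s) (d t) (+ 4 * + n + + 1) (trans (ℤₚ.+-assoc (h₄ p * h₄ p) _ _) (trans h (rhs (+ n))))
  where
  rhs : ∀ n → (let k = + 1 + (n + n + n) in 1ℤ + ((k + k) + (k + k)))
    ≡ + 3 * (+ 4 * n + + 1) + + 2
  rhs = solve-∀

three₂ : ∀ n → ∃[ a ] ∃[ b ] ∃[ c ] + 9 * (a * a) + sq₃ b + sq₃ c ≡ + 3 * (+ 4 * + n) + + 2
three₂ n with three-squares₂ (n ℕ.+ n ℕ.+ n)
... | p , s , t , h = one-multiple (h₄ p) (h₄ s) (d t) (+ 4 * + n) (trans h (rhs (+ n)))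
  where
  rhs : ∀ n → (let k = n + n + n in + 2 + ((k + k) + (k + k)))
    ≡ + 3 * (+ 4 * n) + + 2
  rhs = solve-∀

-- Ternary forms x² + 2y² + 2z², x² + 2y² + 4z² and x² + 4y² + 8z²

-- Start from (2s)² + (2t)² = 2(s + t)² + 2(s - t)². The residue 2 modulo 3 leaves only the pattern
-- prime to 3 and those where 3 divides x and exactly one other variable, a pair on which `rotate₁₂`
-- acts.
form₁₂₂ : ∀ n → ∃[ x ] ∃[ y ] ∃[ z ] sq₆ x + + 2 * sq₃ y + + 2 * sq₃ z ≡ + 3 * (+ 4 * + n + + 1) + + 2
form₁₂₂ n = start (three-squares₁ (1 ℕ.+ (n ℕ.+ n ℕ.+ n)))
  where
  N = + 3 * (+ 4 * + n + + 1) + + 2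
  Goal = ∃[ x ] ∃[ y ] ∃[ z ] sq₆ x + + 2 * sq₃ y + + 2 * sq₃ z ≡ N
  units-goal : ∀ {x y z} → Odd x → Unit x → Unit y → Unit z → x * x + + 2 * (y * y) + + 2 * (z * z) ≡ N → Goal
  units-goal o u v w h = let x , ex = odd-unit-sq o u ; y , ey = unit-sq v ; z , ez = unit-sq w in
    x , y , z , trans (sym (cong₃ (λ a b c → a + + 2 * b + + 2 * c) ex ey ez)) h
  turn-z : ∀ a w c → + 9 * (a * a + + 2 * (c * c)) + + 2 * w ≡ + 3 * a * (+ 3 * a) + + 2 * w + + 2 * (+ 3 * c * (+ 3 * c))
  turn-z = solve-∀
  turn-y : ∀ a w c → + 9 * (a * a + + 2 * (c * c)) + + 2 * w ≡ + 3 * a * (+ 3 * a) + + 2 * (+ 3 * c * (+ 3 * c)) + + 2 * w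
  turn-y = solve-∀
  swap : ∀ x y z → x + + 2 * y + + 2 * z ≡ x + + 2 * z + + 2 * y
  swap = solve-∀
  go : ∀ {x y z} → Norm x → Norm y → Norm z → Odd x → x * x + + 2 * (y * y) + + 2 * (z * z) ≡ N → Goal
  go (unit₃ a) (unit₃ b) (unit₃ c) o h = units-goal o (unit⁺ a) (unit⁺ b) (unit⁺ c) h
  go (zero₃ a) (unit₃ b) (zero₃ c) o h with rotate₁₂ a c (odd-third o)
  ... | units {X} {Y} oX uX uY e = units-goal oX uX (unit⁺ b) uY (trans (swap (X * X) (sq₃ b) (Y * Y)) (trans (cong (_+ + 2 * sq₃ b) e) (trans (turn-z a (sq₃ b) c) h)))
  go (zero₃ a) (zero₃ c) (unit₃ b) o h with rotate₁₂ a c (odd-third o)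
  ... | units {X} {Y} oX uX uY e = units-goal oX uX uY (unit⁺ b) (trans (cong (_+ + 2 * sq₃ b) e) (trans (turn-y a (sq₃ b) c) h))
  go (zero₃ a) (zero₃ b) (zero₃ c) o h = ⊥-elim (no-residue (+ 2) (+ 2) (+ 4 * + n + + 1) (+ 2) (zero₃ a) (zero₃ b) (zero₃ c) h)
  go (zero₃ a) (unit₃ b) (unit₃ c) o h = ⊥-elim (no-residue (+ 2) (+ 2) (+ 4 * + n + + 1) (+ 2) (zero₃ a) (unit₃ b) (unit₃ c) h)
  go (unit₃ a) (zero₃ b) (zero₃ c) o h = ⊥-elim (no-residue (+ 2) (+ 2) (+ 4 * + n + + 1) (+ 2) (unit₃ a) (zero₃ b) (zero₃ c) h)
  go (unit₃ a) (zero₃ b) (unit₃ c) o h = ⊥-elim (no-residue (+ 2) (+ 2) (+ 4 * + n + + 1) (+ 2) (unit₃ a) (zero₃ b) (unit₃ c) h)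
  go (unit₃ a) (unit₃ b) (zero₃ c) o h = ⊥-elim (no-residue (+ 2) (+ 2) (+ 4 * + n + + 1) (+ 2) (unit₃ a) (unit₃ b) (zero₃ c) h)
  lhs : ∀ x s t → x + + 2 * ((s + t) * (s + t)) + + 2 * ((s - t) * (s - t)) ≡ x + ((s + s) * (s + s) + (t + t) * (t + t))
  lhs = solve-∀
  rhs : ∀ n → (let k = + 1 + (n + n + n) in 1ℤ + ((k + k) + (k + k)))
    ≡ + 3 * (+ 4 * n + + 1) + + 2
  rhs = solve-∀
  start : _ → Goal
  start (p , s , t , h) = normalised (λ a b c → a + + 2 * b + + 2 * c) (h₄ p) (s + t) (s - t) (odd (d p)) (trans (lhs (h₄ p * h₄ p) s t) (trans h (rhs (+ n)))) go

-- Halve a² + b² + (2t)² = 4k + 2 with a, b ≡ 1 modulo 4: the half-sum of a and b is odd and their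
-- half-difference even.
odd-by-124 : ∀ k → ∃[ x ] ∃[ y ] ∃[ z ] Odd x × (x * x + + 2 * (y * y) + + 4 * (z * z) ≡ + 2 * + k + + 1)
odd-by-124 k with three-squares₂ k
... | p , r , t , h = h₂ (p + r) , t , p - r , odd (p + r) , ℤₚ.*-cancelˡ-≡ (+ 2) _ _ (trans (lhs p r t) (trans h (rhs (+ k))))
  where
  lhs : ∀ p r t → (let x = (p + r) + (p + r) + 1ℤ in + 2 * (x * x + + 2 * (t * t) + + 4 * ((p - r) * (p - r))))
    ≡ (let a = p + p + (p + p) + 1ℤ ; b = r + r + (r + r) + 1ℤ in a * a + b * b + (t + t) * (t + t))
  lhs = solve-∀
  rhs : ∀ k → + 2 + (k + k + (k + k)) ≡ + 2 * (+ 2 * k + + 1)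
  rhs = solve-∀

-- As 12n + 7 ≡ 3 modulo 4, also y is odd. So both x² + 2y² and y² + 2z² have the odd first variable
-- that `rotate₁₂` needs.
form₁₂₄ : ∀ n → ∃[ x ] ∃[ y ] ∃[ z ] sq₆ x + + 2 * sq₆ y + + 4 * sq₃ z ≡ + 3 * (+ 4 * + n + + 2) + + 1
form₁₂₄ n = start (odd-by-124 (6 ℕ.* n ℕ.+ 3))
  where
  N = + 3 * (+ 4 * + n + + 2) + + 1
  Goal = ∃[ x ] ∃[ y ] ∃[ z ] sq₆ x + + 2 * sq₆ y + + 4 * sq₃ z ≡ N
  even-lem : ∀ b m c n → + 4 * (+ 2 * m + + 2 * (b * b) + c * c - + 3 * n - + 1)
    ≡ + 8 * m + + 1 + + 2 * ((b + b) * (b + b)) + + 4 * (c * c) - (+ 3 * (+ 4 * n + + 2) + + 1) + + 2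
  even-lem = solve-∀
  second-odd : ∀ {x y z} → Odd x → x * x + + 2 * (y * y) + + 4 * (z * z) ≡ N → Odd y
  second-odd {x} {y} {z} o h = by (parityℤ y) refl
    where
    by : ∀ {w} → ℤParity w → y ≡ w → Odd y
    by (oddℤ k) refl = odd k
    by (evenℤ k) refl = ⊥-elim (refute 4 (+ 2) (trans (cong (λ a → a + + 2 * (d k * d k) + + 4 * (z * z)) (sym (proj₂ (odd-sq o)))) h) _ (even-lem k (proj₁ (odd-sq o)) z (+ n)))
  units-goal : ∀ {x y z} → Odd x → Unit x → Unit y → Unit z → x * x + + 2 * (y * y) + + 4 * (z * z) ≡ N → Goal
  units-goal {z = z} o u v w h = let x , ex = odd-unit-sq o u ; y , ey = odd-unit-sq (second-odd {z = z} o h) v ; z , ez = unit-sq w in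
    x , y , z , trans (sym (cong₃ (λ a b c → a + + 2 * b + + 4 * c) ex ey ez)) h
  turn-yz : ∀ w b c → w + + 2 * (+ 9 * (b * b + + 2 * (c * c))) ≡ w + + 2 * (+ 3 * b * (+ 3 * b)) + + 4 * (+ 3 * c * (+ 3 * c))
  turn-yz = solve-∀
  turn-xy : ∀ a b w → + 9 * (a * a + + 2 * (b * b)) + + 4 * w ≡ + 3 * a * (+ 3 * a) + + 2 * (+ 3 * b * (+ 3 * b)) + + 4 * w
  turn-xy = solve-∀
  split : ∀ w y z → w + + 2 * y + + 4 * z ≡ w + + 2 * (y + + 2 * z)
  split = solve-∀
  go : ∀ {x y z} → Norm x → Norm y → Norm z → Odd x → x * x + + 2 * (y * y) + + 4 * (z * z) ≡ N → Goal
  go (unit₃ a) (unit₃ b) (unit₃ c) o h = units-goal o (unit⁺ a) (unit⁺ b) (unit⁺ c) h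
  go (unit₃ a) (zero₃ b) (zero₃ c) o h with rotate₁₂ b c (odd-third (second-odd {z = + 3 * c} o h))
  ... | units {X} {Y} oX uX uY e = units-goal o (unit⁺ a) uX uY (trans (split (sq₃ a) (X * X) (Y * Y)) (trans (cong (λ t → sq₃ a + + 2 * t) e) (trans (turn-yz (sq₃ a) b c) h)))
  go (zero₃ a) (zero₃ b) (unit₃ c) o h with rotate₁₂ a b (odd-third o)
  ... | units {X} {Y} oX uX uY e = units-goal oX uX uY (unit⁺ c) (trans (cong (_+ + 4 * sq₃ c) e) (trans (turn-xy a b (sq₃ c)) h))
  go (zero₃ a) (zero₃ b) (zero₃ c) o h = ⊥-elim (no-residue (+ 2) (+ 4) (+ 4 * + n + + 2) (+ 1) (zero₃ a) (zero₃ b) (zero₃ c) h)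
  go (zero₃ a) (unit₃ b) (zero₃ c) o h = ⊥-elim (no-residue (+ 2) (+ 4) (+ 4 * + n + + 2) (+ 1) (zero₃ a) (unit₃ b) (zero₃ c) h)
  go (zero₃ a) (unit₃ b) (unit₃ c) o h = ⊥-elim (no-residue (+ 2) (+ 4) (+ 4 * + n + + 2) (+ 1) (zero₃ a) (unit₃ b) (unit₃ c) h)
  go (unit₃ a) (zero₃ b) (unit₃ c) o h = ⊥-elim (no-residue (+ 2) (+ 4) (+ 4 * + n + + 2) (+ 1) (unit₃ a) (zero₃ b) (unit₃ c) h)
  go (unit₃ a) (unit₃ b) (zero₃ c) o h = ⊥-elim (no-residue (+ 2) (+ 4) (+ 4 * + n + + 2) (+ 1) (unit₃ a) (unit₃ b) (zero₃ c) h)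
  rhs : ∀ n → + 2 * (+ 6 * n + + 3) + + 1 ≡ + 3 * (+ 4 * n + + 2) + + 1
  rhs = solve-∀
  start : _ → Goal
  start (x , y , z , o , h) = normalised (λ a b c → a + + 2 * b + + 4 * c) x y z o (trans h (trans (cong (λ t → + 2 * (t + + 3) + + 1) (ℤₚ.pos-* 6 n)) (rhs (+ n)))) go

-- As 24n + 13 ≡ 1 modulo 4, the variable with coefficient 2 in `odd-by-124` is even, which gives
-- the coefficient 8. As it is 5 modulo 8, the variable with coefficient 4 is odd.
form₁₄₈ : ∀ n → ∃[ x ] ∃[ y ] ∃[ z ] sq₆ x + + 4 * sq₃ y + + 8 * sq₃ z ≡ + 3 * (+ 8 * + n + + 4) + + 1
form₁₄₈ n = start (odd-by-124 (12 ℕ.* n ℕ.+ 6))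
  where
  N = + 3 * (+ 8 * + n + + 4) + + 1
  Goal = ∃[ x ] ∃[ y ] ∃[ z ] sq₆ x + + 4 * sq₃ y + + 8 * sq₃ z ≡ N
  odd-lem : ∀ b m c n → + 4 * (+ 2 * m + + 2 * (b * b) + + 2 * b + c * c - + 6 * n - + 2)
    ≡ + 8 * m + + 1 + + 2 * ((b + b + 1ℤ) * (b + b + 1ℤ)) + + 4 * (c * c) - (+ 3 * (+ 8 * n + + 4) + + 1) + + 2
  odd-lem = solve-∀
  even-lem : ∀ b m c n → + 8 * (m + b * b + + 2 * (c * c) - + 3 * n - + 1)
    ≡ + 8 * m + + 1 + + 4 * ((c + c) * (c + c)) + + 8 * (b * b) - (+ 3 * (+ 8 * n + + 4) + + 1) + + 4
  even-lem = solve-∀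
  eight : ∀ x y z → x + + 4 * y + + 8 * (z * z) ≡ x + + 2 * ((z + z) * (z + z)) + + 4 * y
  eight = solve-∀
  halved : ∀ {x y z} → Odd x → x * x + + 2 * (y * y) + + 4 * (z * z) ≡ N → ∃[ t ] y ≡ d t
  halved {x} {y} {z} o h = by (parityℤ y) refl
    where
    by : ∀ {w} → ℤParity w → y ≡ w → ∃[ t ] y ≡ d t
    by (evenℤ k) e = k , e
    by (oddℤ k) refl = ⊥-elim (refute 4 (+ 2) (trans (cong (λ a → a + + 2 * (h₂ k * h₂ k) + + 4 * (z * z)) (sym (proj₂ (odd-sq o)))) h) _ (odd-lem k (proj₁ (odd-sq o)) z (+ n)))
  second-odd : ∀ {x y z} → Odd x → x * x + + 4 * (y * y) + + 8 * (z * z) ≡ N → Odd y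
  second-odd {x} {y} {z} o h = by (parityℤ y) refl
    where
    by : ∀ {w} → ℤParity w → y ≡ w → Odd y
    by (oddℤ k) refl = odd k
    by (evenℤ k) refl = ⊥-elim (refute 8 (+ 4) (trans (cong (λ a → a + + 4 * (d k * d k) + + 8 * (z * z)) (sym (proj₂ (odd-sq o)))) h) _ (even-lem z (proj₁ (odd-sq o)) k (+ n)))
  units-goal : ∀ {x y z} → Odd x → Unit x → Unit y → Unit z → x * x + + 4 * (y * y) + + 8 * (z * z) ≡ N → Goal
  units-goal o u v w h = let x , ex = odd-unit-sq o u ; y , ey = unit-sq v ; z , ez = unit-sq w in
    x , y , z , trans (sym (cong₃ (λ a b c → a + + 4 * b + + 8 * c) ex ey ez)) h
  unit-half : ∀ {y t} → Unit y → y ≡ d t → Unit t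
  unit-half {t = t} u refl = unit-shift t (unit-neg u) (lem t)
    where
    lem : ∀ t → t ≡ - (t + t) + + 3 * t
    lem = solve-∀
  turn-yz : ∀ w b c → w + + 4 * (+ 9 * (b * b + + 2 * (c * c))) ≡ w + + 4 * (+ 3 * b * (+ 3 * b)) + + 8 * (+ 3 * c * (+ 3 * c))
  turn-yz = solve-∀
  turn-xz : ∀ a c w → + 9 * (a * a + + 2 * ((c + c) * (c + c))) + + 4 * w ≡ + 3 * a * (+ 3 * a) + + 4 * w + + 8 * (+ 3 * c * (+ 3 * c))
  turn-xz = solve-∀
  split : ∀ w y z → w + + 4 * y + + 8 * z ≡ w + + 4 * (y + + 2 * z)
  split = solve-∀
  go : ∀ {x y z} → Norm x → Norm y → Norm z → Odd x → x * x + + 4 * (y * y) + + 8 * (z * z) ≡ N → Goal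
  go (unit₃ a) (unit₃ b) (unit₃ c) o h = units-goal o (unit⁺ a) (unit⁺ b) (unit⁺ c) h
  go (unit₃ a) (zero₃ b) (zero₃ c) o h with rotate₁₂ b c (odd-third (second-odd {z = + 3 * c} o h))
  ... | units {X} {Y} oX uX uY e = units-goal o (unit⁺ a) uX uY (trans (split (sq₃ a) (X * X) (Y * Y)) (trans (cong (λ t → sq₃ a + + 4 * t) e) (trans (turn-yz (sq₃ a) b c) h)))
  -- The rotation acts on x² + 2(2z)²; the congruence modulo 4 makes the new second variable even
  -- again.
  go (zero₃ a) (unit₃ b) (zero₃ c) o h with rotate₁₂ a (d c) (odd-third o)
  ... | units {X} {Y} oX uX uY e = last (halved {y = Y} {z = c₃ b} oX h′)
    where
    h′ : X * X + + 2 * (Y * Y) + + 4 * sq₃ b ≡ N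
    h′ = trans (cong (_+ + 4 * sq₃ b) e) (trans (turn-xz a c (sq₃ b)) h)
    last : ∃[ t ] Y ≡ d t → Goal
    last (t , eY) = units-goal {z = t} oX uX (unit⁺ b) (unit-half {t = t} uY eY) (trans (eight (X * X) (sq₃ b) t) (trans (cong (λ y → X * X + + 2 * (y * y) + + 4 * sq₃ b) (sym eY)) h′))
  go (zero₃ a) (zero₃ b) (zero₃ c) o h = ⊥-elim (no-residue (+ 4) (+ 8) (+ 8 * + n + + 4) (+ 1) (zero₃ a) (zero₃ b) (zero₃ c) h)
  go (zero₃ a) (zero₃ b) (unit₃ c) o h = ⊥-elim (no-residue (+ 4) (+ 8) (+ 8 * + n + + 4) (+ 1) (zero₃ a) (zero₃ b) (unit₃ c) h)
  go (zero₃ a) (unit₃ b) (unit₃ c) o h = ⊥-elim (no-residue (+ 4) (+ 8) (+ 8 * + n + + 4) (+ 1) (zero₃ a) (unit₃ b) (unit₃ c) h)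
  go (unit₃ a) (zero₃ b) (unit₃ c) o h = ⊥-elim (no-residue (+ 4) (+ 8) (+ 8 * + n + + 4) (+ 1) (unit₃ a) (zero₃ b) (unit₃ c) h)
  go (unit₃ a) (unit₃ b) (zero₃ c) o h = ⊥-elim (no-residue (+ 4) (+ 8) (+ 8 * + n + + 4) (+ 1) (unit₃ a) (unit₃ b) (zero₃ c) h)
  rhs : ∀ n → + 2 * (+ 12 * n + + 6) + + 1 ≡ + 3 * (+ 8 * n + + 4) + + 1
  rhs = solve-∀
  start : _ → Goal
  start (x , y , z , o , h) = next (halved {z = z} o h′)
    where
    h′ : x * x + + 2 * (y * y) + + 4 * (z * z) ≡ N
    h′ = trans h (trans (cong (λ t → + 2 * (t + + 6) + + 1) (ℤₚ.pos-* 12 n)) (rhs (+ n)))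
    next : ∃[ t ] y ≡ d t → Goal
    next (t , eY) = normalised (λ a b c → a + + 4 * b + + 8 * c) x z t o
      (trans (eight (x * x) (z * z) t) (trans (cong (λ y → x * x + + 2 * (y * y) + + 4 * (z * z)) (sym eY)) h′)) go

-- Refinements by parity, modulo 24

sq₆-residue : ∀ x → ∃[ p ] sq₆ x ≡ + 24 * p + 1ℤ
sq₆-residue x = go (parityℤ x)
  where
  lem₀ : ∀ k → (+ 6 * (k + k) - 1ℤ) * (+ 6 * (k + k) - 1ℤ) ≡ + 24 * (k * (+ 6 * k - 1ℤ)) + 1ℤ
  lem₀ = solve-∀
  lem₁ : ∀ k → (+ 6 * (k + k + 1ℤ) - 1ℤ) * (+ 6 * (k + k + 1ℤ) - 1ℤ) ≡ + 24 * ((+ 2 * k + 1ℤ) * (+ 3 * k + 1ℤ)) + 1ℤ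
  lem₁ = solve-∀
  go : ∀ {x} → ℤParity x → ∃[ p ] sq₆ x ≡ + 24 * p + 1ℤ
  go (evenℤ k) = k * (+ 6 * k - 1ℤ) , lem₀ k
  go (oddℤ k)  = (+ 2 * k + 1ℤ) * (+ 3 * k + 1ℤ) , lem₁ k

sq₃-even : ∀ k → sq₃ (d k) ≡ sq₆ k
sq₃-even = lem
  where
  lem : ∀ k → (+ 3 * (k + k) - 1ℤ) * (+ 3 * (k + k) - 1ℤ) ≡ (+ 6 * k - 1ℤ) * (+ 6 * k - 1ℤ)
  lem = solve-∀

sq₃-odd : ∀ k → sq₃ (h₂ k) ≡ + 4 * sq₃ (- k)
sq₃-odd = lem
  where
  lem : ∀ k → (+ 3 * (k + k + 1ℤ) - 1ℤ) * (+ 3 * (k + k + 1ℤ) - 1ℤ) ≡ + 4 * ((+ 3 * - k - 1ℤ) * (+ 3 * - k - 1ℤ))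
  lem = solve-∀

data Square₃ : ℤ → Set where
  oddSquare  : ∀ k → Square₃ (sq₆ k)
  evenSquare : ∀ k → Square₃ (+ 4 * sq₃ k)

square₃ : ∀ t → Square₃ (sq₃ t)
square₃ t = go (parityℤ t)
  where
  go : ∀ {t} → ℤParity t → Square₃ (sq₃ t)
  go (evenℤ k) = subst Square₃ (sym (sq₃-even k)) (oddSquare k)
  go (oddℤ k)  = subst Square₃ (sym (sq₃-odd k)) (evenSquare (- k))

-- In `form₁₂₂` an odd y or z would give 3 or 5 modulo 8 instead of 1, so both are even.
form₁₈₈ : ∀ n → ∃[ x ] ∃[ y ] ∃[ z ] sq₆ x + + 8 * sq₃ y + + 8 * sq₃ z ≡ + 24 * + n + + 17
form₁₈₈ n = start (form₁₂₂ (suc (n ℕ.+ n)))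
  where
  N = + 24 * + n + + 17
  Goal = ∃[ x ] ∃[ y ] ∃[ z ] sq₆ x + + 8 * sq₃ y + + 8 * sq₃ z ≡ N
  rhs : ∀ n → + 3 * (+ 4 * (1ℤ + (n + n)) + + 1) + + 2 ≡ + 24 * n + + 17
  rhs = solve-∀
  eight : ∀ x y z → x + + 8 * y + + 8 * z ≡ x + + 2 * (+ 4 * y) + + 2 * (+ 4 * z)
  eight = solve-∀
  oo : ∀ p q r n → + 24 * (p + + 2 * q + + 2 * r - n) ≡ + 24 * p + 1ℤ + + 2 * (+ 24 * q + 1ℤ) + + 2 * (+ 24 * r + 1ℤ) - (+ 24 * n + + 17) + + 12
  oo = solve-∀
  oe : ∀ p q r n → + 8 * (+ 3 * p + + 6 * q + r - + 3 * n) ≡ + 24 * p + 1ℤ + + 2 * (+ 24 * q + 1ℤ) + + 2 * (+ 4 * r) - (+ 24 * n + + 17) + + 14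
  oe = solve-∀
  eo : ∀ p q r n → + 8 * (+ 3 * p + q + + 6 * r - + 3 * n) ≡ + 24 * p + 1ℤ + + 2 * (+ 4 * q) + + 2 * (+ 24 * r + 1ℤ) - (+ 24 * n + + 17) + + 14
  eo = solve-∀
  go : ∀ x {Y Z} → Square₃ Y → Square₃ Z → sq₆ x + + 2 * Y + + 2 * Z ≡ N → Goal
  go x (evenSquare y) (evenSquare z) h = x , y , z , trans (eight (sq₆ x) (sq₃ y) (sq₃ z)) h
  go x (oddSquare y) (oddSquare z) h with sq₆-residue x | sq₆-residue y | sq₆-residue z
  ... | p , ex | q , ey | r , ez = ⊥-elim (refute 24 (+ 12) (trans (sym (cong₃ (λ a b c → a + + 2 * b + + 2 * c) ex ey ez)) h) _ (oo p q r (+ n)))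
  go x (oddSquare y) (evenSquare z) h with sq₆-residue x | sq₆-residue y
  ... | p , ex | q , ey = ⊥-elim (refute 8 (+ 14) (trans (sym (cong₃ (λ a b c → a + + 2 * b + + 2 * c) ex ey refl)) h) _ (oe p q (sq₃ z) (+ n)))
  go x (evenSquare y) (oddSquare z) h with sq₆-residue x | sq₆-residue z
  ... | p , ex | r , ez = ⊥-elim (refute 8 (+ 14) (trans (sym (cong₃ (λ a b c → a + + 2 * b + + 2 * c) ex refl ez)) h) _ (eo p (sq₃ y) r (+ n)))
  start : _ → Goal
  start (x , y , z , h) = go x (square₃ y) (square₃ z) (trans h (rhs (+ n)))

-- Modulo 8, y and z have equal parity in `three₉`. In 4y² + 4z² = 2(y - z)² + 2(y + z)² the
-- difference is then a multiple of 6 and the sum is even, whence 72 and 8.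
form₁₈,₇₂ : ∀ n → ∃[ x ] ∃[ y ] ∃[ z ] + 72 * (x * x) + sq₆ y + + 8 * sq₃ z ≡ + 24 * + n + + 9
form₁₈,₇₂ n = start (three₉ (n ℕ.+ n))
  where
  N = + 24 * + n + + 9
  Goal = ∃[ x ] ∃[ y ] ∃[ z ] + 72 * (x * x) + sq₆ y + + 8 * sq₃ z ≡ N
  rhs : ∀ n → + 3 * (+ 4 * (n + n) + + 3) + + 0 ≡ + 24 * n + + 9
  rhs = solve-∀
  evens : ∀ x j k → let sqr = λ (x : ℤ) → x * x in + 72 * sqr (j - k) + x + + 8 * sqr (+ 3 * (j + k) - 1ℤ)
    ≡ x + + 4 * sqr (+ 3 * (j + j) - 1ℤ) + + 4 * sqr (+ 3 * (k + k) - 1ℤ)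
  evens = solve-∀
  odds : ∀ x j k → let sqr = λ (x : ℤ) → x * x in + 72 * sqr (j - k) + x + + 8 * sqr (+ 3 * (j + k + 1ℤ) - 1ℤ)
    ≡ x + + 4 * sqr (+ 3 * (j + j + 1ℤ) - 1ℤ) + + 4 * sqr (+ 3 * (k + k + 1ℤ) - 1ℤ)
  odds = solve-∀
  eo : ∀ p q r n → + 8 * (+ 3 * p + + 12 * q + + 2 * r - + 3 * n) ≡ + 24 * p + 1ℤ + + 4 * (+ 24 * q + 1ℤ) + + 4 * (+ 4 * r) - (+ 24 * n + + 9) + + 4
  eo = solve-∀
  oe : ∀ p q r n → + 8 * (+ 3 * p + + 2 * q + + 12 * r - + 3 * n) ≡ + 24 * p + 1ℤ + + 4 * (+ 4 * q) + + 4 * (+ 24 * r + 1ℤ) - (+ 24 * n + + 9) + + 4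
  oe = solve-∀
  go : ∀ x {y z} → ℤParity y → ℤParity z → sq₆ x + + 4 * sq₃ y + + 4 * sq₃ z ≡ N → Goal
  go x (evenℤ j) (evenℤ k) h = j - k , x , j + k , trans (evens (sq₆ x) j k) h
  go x (oddℤ j) (oddℤ k) h = j - k , x , j + k + 1ℤ , trans (odds (sq₆ x) j k) h
  go x (evenℤ j) (oddℤ k) h with sq₆-residue x | sq₆-residue j
  ... | p , ex | q , ey = ⊥-elim (refute 8 (+ 4) (trans (sym (cong₃ (λ a b c → a + + 4 * b + + 4 * c) ex (trans (sq₃-even j) ey) (sq₃-odd k))) h) _ (eo p q (sq₃ (- k)) (+ n)))
  go x (oddℤ j) (evenℤ k) h with sq₆-residue x | sq₆-residue k
  ... | p , ex | r , ez = ⊥-elim (refute 8 (+ 4) (trans (sym (cong₃ (λ a b c → a + + 4 * b + + 4 * c) ex (sq₃-odd j) (trans (sq₃-even k) ez))) h) _ (oe p (sq₃ (- j)) r (+ n)))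
  start : _ → Goal
  start (x , y , z , h) = go x (parityℤ y) (parityℤ z) (trans h (rhs (+ n)))

-- Here y and z have opposite parity, so y - z is an odd multiple of 3 and y + z is odd, whence 18
-- and 2.
form₁₂,₁₈ : ∀ n → ∃[ x ] ∃[ y ] ∃[ z ] + 18 * (h₂ x * h₂ x) + sq₆ y + + 2 * sq₆ z ≡ + 24 * + n + + 21
form₁₂,₁₈ n = start (three₉ (suc (n ℕ.+ n)))
  where
  N = + 24 * + n + + 21
  Goal = ∃[ x ] ∃[ y ] ∃[ z ] + 18 * (h₂ x * h₂ x) + sq₆ y + + 2 * sq₆ z ≡ N
  rhs : ∀ n → + 3 * (+ 4 * (1ℤ + (n + n)) + + 3) + + 0 ≡ + 24 * n + + 21
  rhs = solve-∀
  eo : ∀ x j k → let sqr = λ (x : ℤ) → x * x in + 18 * sqr (j - k - 1ℤ + (j - k - 1ℤ) + 1ℤ) + x + + 2 * sqr (+ 6 * (- j - k) - 1ℤ)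
    ≡ x + + 4 * sqr (+ 3 * (j + j) - 1ℤ) + + 4 * sqr (+ 3 * (k + k + 1ℤ) - 1ℤ)
  eo = solve-∀
  oe : ∀ x j k → let sqr = λ (x : ℤ) → x * x in + 18 * sqr (j - k + (j - k) + 1ℤ) + x + + 2 * sqr (+ 6 * (- j - k) - 1ℤ)
    ≡ x + + 4 * sqr (+ 3 * (j + j + 1ℤ) - 1ℤ) + + 4 * sqr (+ 3 * (k + k) - 1ℤ)
  oe = solve-∀
  evens : ∀ p q r n → + 24 * (p + + 4 * q + + 4 * r - n) ≡ + 24 * p + 1ℤ + + 4 * (+ 24 * q + 1ℤ) + + 4 * (+ 24 * r + 1ℤ) - (+ 24 * n + + 21) + + 12
  evens = solve-∀
  odds : ∀ p q r n → + 8 * (+ 3 * p + + 2 * q + + 2 * r - + 3 * n) ≡ + 24 * p + 1ℤ + + 4 * (+ 4 * q) + + 4 * (+ 4 * r) - (+ 24 * n + + 21) + + 20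
  odds = solve-∀
  go : ∀ x {y z} → ℤParity y → ℤParity z → sq₆ x + + 4 * sq₃ y + + 4 * sq₃ z ≡ N → Goal
  go x (evenℤ j) (oddℤ k) h = j - k - 1ℤ , x , - j - k , trans (eo (sq₆ x) j k) h
  go x (oddℤ j) (evenℤ k) h = j - k , x , - j - k , trans (oe (sq₆ x) j k) h
  go x (evenℤ j) (evenℤ k) h with sq₆-residue x | sq₆-residue j | sq₆-residue k
  ... | p , ex | q , ey | r , ez = ⊥-elim (refute 24 (+ 12) (trans (sym (cong₃ (λ a b c → a + + 4 * b + + 4 * c) ex (trans (sq₃-even j) ey) (trans (sq₃-even k) ez))) h) _ (evens p q r (+ n)))
  go x (oddℤ j) (oddℤ k) h with sq₆-residue x
  ... | p , ex = ⊥-elim (refute 8 (+ 20) (trans (sym (cong₃ (λ a b c → a + + 4 * b + + 4 * c) ex (sq₃-odd j) (sq₃-odd k))) h) _ (odds p (sq₃ (- j)) (sq₃ (- k)) (+ n)))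
  start : _ → Goal
  start (x , y , z , h) = go x (parityℤ y) (parityℤ z) (trans h (rhs (+ n)))

-- As x and y are odd, the residue 7 modulo 8 makes z odd, while the residue 3 in `form₁₂,₁₆` makes
-- it even.
form₁₂₄-odd : ∀ n → ∃[ x ] ∃[ y ] ∃[ z ] sq₆ x + + 2 * sq₆ y + + 4 * sq₆ z ≡ + 24 * + n + + 7
form₁₂₄-odd n = start (form₁₂₄ (n ℕ.+ n))
  where
  N = + 24 * + n + + 7
  Goal = ∃[ x ] ∃[ y ] ∃[ z ] sq₆ x + + 2 * sq₆ y + + 4 * sq₆ z ≡ N
  rhs : ∀ n → + 3 * (+ 4 * (n + n) + + 2) + + 1 ≡ + 24 * n + + 7
  rhs = solve-∀
  z-even : ∀ p q r n → + 8 * (+ 3 * p + + 6 * q + + 2 * r - + 3 * n)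
    ≡ + 24 * p + 1ℤ + + 2 * (+ 24 * q + 1ℤ) + + 4 * (+ 4 * r) - (+ 24 * n + + 7) + + 4
  z-even = solve-∀
  go : ∀ x y {Z} → Square₃ Z → sq₆ x + + 2 * sq₆ y + + 4 * Z ≡ N → Goal
  go x y (oddSquare z) h = x , y , z , h
  go x y (evenSquare z) h with sq₆-residue x | sq₆-residue y
  ... | p , ex | q , ey = ⊥-elim (refute 8 (+ 4) (trans (sym (cong₃ (λ a b c → a + + 2 * b + + 4 * c) ex ey refl)) h) _ (z-even p q (sq₃ z) (+ n)))
  start : _ → Goal
  start (x , y , z , h) = go x y (square₃ z) (trans h (rhs (+ n)))

form₁₂,₁₆ : ∀ n → ∃[ x ] ∃[ y ] ∃[ z ] sq₆ x + + 2 * sq₆ y + + 16 * sq₃ z ≡ + 24 * + n + + 19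
form₁₂,₁₆ n = start (form₁₂₄ (suc (n ℕ.+ n)))
  where
  N = + 24 * + n + + 19
  Goal = ∃[ x ] ∃[ y ] ∃[ z ] sq₆ x + + 2 * sq₆ y + + 16 * sq₃ z ≡ N
  rhs : ∀ n → + 3 * (+ 4 * (1ℤ + (n + n)) + + 2) + + 1 ≡ + 24 * n + + 19
  rhs = solve-∀
  sixteen : ∀ x y z → x + + 2 * y + + 16 * z ≡ x + + 2 * y + + 4 * (+ 4 * z)
  sixteen = solve-∀
  odds : ∀ p q r n → + 24 * (p + + 2 * q + + 4 * r - n) ≡ + 24 * p + 1ℤ + + 2 * (+ 24 * q + 1ℤ) + + 4 * (+ 24 * r + 1ℤ) - (+ 24 * n + + 19) + + 12
  odds = solve-∀
  go : ∀ x y {Z} → Square₃ Z → sq₆ x + + 2 * sq₆ y + + 4 * Z ≡ N → Goal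
  go x y (evenSquare z) h = x , y , z , trans (sixteen (sq₆ x) (sq₆ y) (sq₃ z)) h
  go x y (oddSquare z) h with sq₆-residue x | sq₆-residue y | sq₆-residue z
  ... | p , ex | q , ey | r , ez = ⊥-elim (refute 24 (+ 12) (trans (sym (cong₃ (λ a b c → a + + 2 * b + + 4 * c) ex ey ez)) h) _ (odds p q r (+ n)))
  start : _ → Goal
  start (x , y , z , h) = go x y (square₃ z) (trans h (rhs (+ n)))

-- (α - 2β)² + 2 (α + β)² = 3 (α² + 2β²)
form₃₂₄ : ∀ m → ∃[ x ] ∃[ y ] ∃[ z ] Odd x × (+ 3 * (x * x) + + 2 * sq₃ y + + 4 * sq₃ z ≡ + 3 * (+ 4 * + m + + 3))
form₃₂₄ m = start (odd-by-124 (suc (m ℕ.+ m)))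
  where
  N = + 4 * + m + + 3
  Goal = ∃[ x ] ∃[ y ] ∃[ z ] Odd x × (+ 3 * (x * x) + + 2 * sq₃ y + + 4 * sq₃ z ≡ + 3 * N)
  rhs : ∀ m → + 2 * (1ℤ + (m + m)) + 1ℤ ≡ + 4 * m + + 3
  rhs = solve-∀
  y-even : ∀ k p b m → + 4 * (+ 2 * p + + 2 * (k * k) + b - m) ≡ + 8 * p + + 1 + + 2 * ((k + k) * (k + k)) + + 4 * b - (+ 4 * m + + 3) + + 2
  y-even = solve-∀
  uu : ∀ x a b → let sqr = λ (x : ℤ) → x * x in + 3 * x + + 2 * sqr (+ 3 * (+ 2 * b - a) - 1ℤ) + + 4 * sqr (+ 3 * (1ℤ - a - b) - 1ℤ)
    ≡ + 3 * (x + + 2 * sqr (+ 3 * a - 1ℤ) + + 4 * sqr (+ 3 * b - 1ℤ))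
  uu = solve-∀
  zu : ∀ x a b → let sqr = λ (x : ℤ) → x * x in + 3 * x + + 2 * sqr (+ 3 * (a - + 2 * b + 1ℤ) - 1ℤ) + + 4 * sqr (+ 3 * (a + b) - 1ℤ)
    ≡ + 3 * (x + + 2 * sqr (+ 3 * a) + + 4 * sqr (+ 3 * b - 1ℤ))
  zu = solve-∀
  uz : ∀ x a b → let sqr = λ (x : ℤ) → x * x in + 3 * x + + 2 * sqr (+ 3 * (a - + 2 * b) - 1ℤ) + + 4 * sqr (+ 3 * (a + b) - 1ℤ)
    ≡ + 3 * (x + + 2 * sqr (+ 3 * a - 1ℤ) + + 4 * sqr (+ 3 * b))
  uz = solve-∀
  turn : ∀ w a b → w + + 2 * (+ 9 * (a * a + + 2 * (b * b))) ≡ w + + 2 * (+ 3 * a * (+ 3 * a)) + + 4 * (+ 3 * b * (+ 3 * b))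
  turn = solve-∀
  split : ∀ w y z → w + + 2 * y + + 4 * z ≡ w + + 2 * (y + + 2 * z)
  split = solve-∀
  second-odd : ∀ {x y z} → Odd x → x * x + + 2 * (y * y) + + 4 * (z * z) ≡ N → Odd y
  second-odd {x} {y} {z} o h = by (parityℤ y) refl
    where
    by : ∀ {w} → ℤParity w → y ≡ w → Odd y
    by (oddℤ k) refl = odd k
    by (evenℤ k) refl = ⊥-elim (refute 4 (+ 2) (trans (cong (λ a → a + + 2 * (d k * d k) + + 4 * (z * z)) (sym (proj₂ (odd-sq o)))) h) _ (y-even k (proj₁ (odd-sq o)) (z * z) (+ m)))
  prime : ∀ {x} a b → Odd x → x * x + + 2 * sq₃ a + + 4 * sq₃ b ≡ N → Goal
  prime {x} a b o h = x , + 2 * b - a , 1ℤ - a - b , o , trans (uu (x * x) a b) (cong (_*_ (+ 3)) h)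
  go : ∀ {x y z} → Norm y → Norm z → Odd x → Odd y → x * x + + 2 * (y * y) + + 4 * (z * z) ≡ N → Goal
  go (unit₃ a) (unit₃ b) o _ h = prime a b o h
  go {x} (zero₃ a) (unit₃ b) o _ h = x , a - + 2 * b + 1ℤ , a + b , o , trans (zu (x * x) a b) (cong (_*_ (+ 3)) h)
  go {x} (unit₃ a) (zero₃ b) o _ h = x , a - + 2 * b , a + b , o , trans (uz (x * x) a b) (cong (_*_ (+ 3)) h)
  -- The identity would give multiples of 3, so `rotate₁₂` first makes y and z prime to 3; y is odd
  -- because 4m + 3 ≡ 3 modulo 4.
  go {x} (zero₃ a) (zero₃ b) o o′ h with rotate₁₂ a b (odd-third o′)
  ... | units {X} {Y} _ uX uY e = let s , es = unit-sq uX ; t , et = unit-sq uY in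
    prime s t o (trans (sym (cong₂ (λ u v → x * x + + 2 * u + + 4 * v) es et)) (trans (split (x * x) (X * X) (Y * Y)) (trans (cong (λ t → x * x + + 2 * t) e) (trans (turn (x * x) a b) h))))
  start : _ → Goal
  start (x , y , z , o , h) = go (proj₂ (proj₂ (norm y))) (proj₂ (proj₂ (norm z))) o (odd-± (proj₁ (proj₂ (norm y))) (second-odd {x} {y} {z} o h′))
    (trans (cong₂ (λ b c → x * x + + 2 * b + + 4 * c) (same-sq (proj₁ (proj₂ (norm y)))) (same-sq (proj₁ (proj₂ (norm z))))) h′)
    where
    h′ : x * x + + 2 * (y * y) + + 4 * (z * z) ≡ N
    h′ = trans h (rhs (+ m))

form₃₂₄-odd : ∀ n → ∃[ x ] ∃[ y ] ∃[ z ] + 3 * (h₂ x * h₂ x) + + 2 * sq₆ y + + 4 * sq₆ z ≡ + 24 * + n + + 9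
form₃₂₄-odd n = start (form₃₂₄ (n ℕ.+ n))
  where
  N = + 24 * + n + + 9
  Goal = ∃[ x ] ∃[ y ] ∃[ z ] + 3 * (h₂ x * h₂ x) + + 2 * sq₆ y + + 4 * sq₆ z ≡ N
  rhs : ∀ n → + 3 * (+ 4 * (n + n) + + 3) ≡ + 24 * n + + 9
  rhs = solve-∀
  y-even : ∀ p q r n → + 4 * (+ 6 * p + + 2 * q + r - + 6 * n) ≡ + 3 * (+ 8 * p + + 1) + + 2 * (+ 4 * q) + + 4 * r - (+ 24 * n + + 9) + + 6
  y-even = solve-∀
  z-even : ∀ p q r n → + 8 * (+ 3 * p + + 6 * q + + 2 * r - + 3 * n)
    ≡ + 3 * (+ 8 * p + + 1) + + 2 * (+ 24 * q + 1ℤ) + + 4 * (+ 4 * r) - (+ 24 * n + + 9) + + 4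
  z-even = solve-∀
  go : ∀ {x Y Z} → Odd x → Square₃ Y → Square₃ Z → + 3 * (x * x) + + 2 * Y + + 4 * Z ≡ N → Goal
  go (odd x) (oddSquare y) (oddSquare z) h = x , y , z , h
  go {Z = Z} o (evenSquare y) _ h with odd-sq o
  ... | p , ex = ⊥-elim (refute 4 (+ 6) (trans (cong (λ a → + 3 * a + + 2 * (+ 4 * sq₃ y) + + 4 * Z) (sym ex)) h) _ (y-even p (sq₃ y) Z (+ n)))
  go o (oddSquare y) (evenSquare z) h with odd-sq o | sq₆-residue y
  ... | p , ex | q , ey = ⊥-elim (refute 8 (+ 4) (trans (sym (cong₂ (λ a b → + 3 * a + + 2 * b + + 4 * (+ 4 * sq₃ z)) ex ey)) h) _ (z-even p q (sq₃ z) (+ n)))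
  start : _ → Goal
  start (x , y , z , o , h) = go o (square₃ y) (square₃ z) (trans h (rhs (+ n)))

form₃₂,₁₆ : ∀ n → ∃[ x ] ∃[ y ] ∃[ z ] + 3 * (h₂ x * h₂ x) + + 2 * sq₆ y + + 16 * sq₃ z ≡ + 24 * + n + + 21
form₃₂,₁₆ n = start (form₃₂₄ (suc (n ℕ.+ n)))
  where
  N = + 24 * + n + + 21
  Goal = ∃[ x ] ∃[ y ] ∃[ z ] + 3 * (h₂ x * h₂ x) + + 2 * sq₆ y + + 16 * sq₃ z ≡ N
  rhs : ∀ n → + 3 * (+ 4 * (1ℤ + (n + n)) + + 3) ≡ + 24 * n + + 21
  rhs = solve-∀
  sixteen : ∀ x y z → x + + 2 * y + + 16 * z ≡ x + + 2 * y + + 4 * (+ 4 * z)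
  sixteen = solve-∀
  y-even : ∀ p q r n → + 4 * (+ 6 * p + + 2 * q + r - + 6 * n) ≡ + 3 * (+ 8 * p + + 1) + + 2 * (+ 4 * q) + + 4 * r - (+ 24 * n + + 21) + + 18
  y-even = solve-∀
  z-odd : ∀ p q r n → + 24 * (p + + 2 * q + + 4 * r - n)
    ≡ + 3 * (+ 8 * p + + 1) + + 2 * (+ 24 * q + 1ℤ) + + 4 * (+ 24 * r + 1ℤ) - (+ 24 * n + + 21) + + 12
  z-odd = solve-∀
  go : ∀ {x Y Z} → Odd x → Square₃ Y → Square₃ Z → + 3 * (x * x) + + 2 * Y + + 4 * Z ≡ N → Goal
  go (odd x) (oddSquare y) (evenSquare z) h = x , y , z , trans (sixteen (+ 3 * (h₂ x * h₂ x)) (sq₆ y) (sq₃ z)) h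
  go {Z = Z} o (evenSquare y) _ h with odd-sq o
  ... | p , ex = ⊥-elim (refute 4 (+ 18) (trans (cong (λ a → + 3 * a + + 2 * (+ 4 * sq₃ y) + + 4 * Z) (sym ex)) h) _ (y-even p (sq₃ y) Z (+ n)))
  go o (oddSquare y) (oddSquare z) h with odd-sq o | sq₆-residue y | sq₆-residue z
  ... | p , ex | q , ey | r , ez = ⊥-elim (refute 24 (+ 12) (trans (sym (cong₃ (λ a b c → + 3 * a + + 2 * b + + 4 * c) ex ey ez)) h) _ (z-odd p q r (+ n)))
  start : _ → Goal
  start (x , y , z , o , h) = go o (square₃ y) (square₃ z) (trans h (rhs (+ n)))

-- Sums of polygonal numbers, as multisets of terms (a , r) standing for a p r

Term : Set
Term = ℕ × ℕ

-- 24 p r x for r ∈ {3, 4, 5, 8}; meaningless for other r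
scaled : ℕ → ℤ → ℤ
scaled 3 x = + 12 * (x * x) + + 12 * x
scaled 4 x = + 24 * (x * x)
scaled 5 x = sq₆ x - 1ℤ
scaled _ x = + 8 * sq₃ x - + 8

⟦_⟧ : Term → ℤ → ℤ
⟦ a , r ⟧ x = + a * scaled r x

data Value : List Term → ℤ → Set where
  []   : Value [] 0ℤ
  _∷_  : ∀ {t F v} x → Value F v → Value (t ∷ F) (⟦ t ⟧ x + v)

-- The record exposes `F` and `n` to unification, which the product 24 n would hide.
record _represents_ (F : List Term) (n : ℕ) : Set where
  constructor scale
  field value : Value F (+ 24 * + n)
open _represents_

zeros : ∀ F → Value F 0ℤ
zeros [] = []
zeros ((a , r) ∷ F) = subst (Value _) (trans (cong (_+ 0ℤ) (trans (cong (_*_ (+ a)) (at-zero r)) (ℤₚ.*-zeroʳ (+ a)))) refl) (0ℤ ∷ zeros F)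
  where
  at-zero : ∀ r → scaled r 0ℤ ≡ 0ℤ
  at-zero 0 = refl
  at-zero 1 = refl
  at-zero 2 = refl
  at-zero 3 = refl
  at-zero 4 = refl
  at-zero 5 = refl
  at-zero (suc (suc (suc (suc (suc (suc _)))))) = refl

-- The search returns with the remaining terms the way to put the found term back, so its success is
-- already the proof.
extract : ∀ t G → Maybe (Σ[ H ∈ List Term ] (∀ {v} x → Value H v → Value G (⟦ t ⟧ x + v)))
extract t [] = nothing
extract t (s ∷ G) with ≡-dec ℕ._≟_ ℕ._≟_ t s
... | yes refl = just (G , _∷_)
... | no _ = Maybe.map (λ (H , f) → s ∷ H , λ { x (y ∷ r) → subst (Value (s ∷ G)) (swap (⟦ s ⟧ y) (⟦ t ⟧ x) _) (y ∷ f x r) }) (extract t G)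
  where
  swap : ∀ a b c → a + (b + c) ≡ b + (a + c)
  swap = solve-∀

widen? : ∀ F G → Maybe (∀ {v} → Value F v → Value G v)
widen? [] G = just λ { [] → zeros G }
widen? (t ∷ F) G = extract t G >>= λ (H , f) → Maybe.map (λ g → λ { (x ∷ r) → f x (g r) }) (widen? F H)

to-witness : {A : Set} (m : Maybe A) → T (is-just m) → A
to-witness (just a) _ = a

-- F is a sub-multiset of G; the remaining terms of G are evaluated at 0
widen : ∀ {F G n} {_ : T (is-just (widen? F G))} → F represents n → G represents n
widen {F} {G} {_} {w} (scale r) = scale (to-witness (widen? F G) w r)

adjoin : ∀ {F n} t x c → ⟦ t ⟧ x ≡ + 24 * + c → F represents n → (t ∷ F) represents (c ℕ.+ n)
adjoin {F} {n} t x c e (scale r) = scale (subst (Value (t ∷ F)) (trans (cong (_+ + 24 * + n) e) (sym (ℤₚ.*-distribˡ-+ (+ 24) (+ c) (+ n)))) (x ∷ r))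

cast : ∀ {F m n} → m ≡ n → F represents m → F represents n
cast {F} = subst (F represents_)

record Exchange (t₁ t₂ s₁ s₂ : Term) (c : ℕ) : Set where
  field
    first second : ℤ → ℤ → ℤ
    preserves    : ∀ x y → ⟦ s₁ ⟧ (first x y) + ⟦ s₂ ⟧ (second x y) ≡ + 24 * + c + (⟦ t₁ ⟧ x + ⟦ t₂ ⟧ y)
open Exchange

exchange? : ∀ {t₁ t₂ s₁ s₂ c} → Exchange t₁ t₂ s₁ s₂ c → ∀ F G → Maybe (∀ {v} → Value F v → Value G (+ 24 * + c + v))
exchange? {t₁} {t₂} {s₁} {s₂} {c} E F G =
  extract s₁ G >>= λ (G₁ , f₁) → extract s₂ G₁ >>= λ (G₂ , f₂) →
  Maybe.map (λ w r → swap G₂ f₁ f₂ (w r)) (widen? F (t₁ ∷ t₂ ∷ G₂))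
  where
  lem₁ : ∀ a b v → a + (b + v) ≡ a + b + v
  lem₁ = solve-∀
  lem₂ : ∀ c a b v → c + (a + b) + v ≡ c + (a + (b + v))
  lem₂ = solve-∀
  swap : ∀ {G₁} G₂ {v} → (∀ {v} x → Value G₁ v → Value G (⟦ s₁ ⟧ x + v)) → (∀ {v} x → Value G₂ v → Value G₁ (⟦ s₂ ⟧ x + v)) →
    Value (t₁ ∷ t₂ ∷ G₂) v → Value G (+ 24 * + c + v)
  swap G₂ f₁ f₂ (_∷_ x (_∷_ {v = v} y r)) = subst (Value G)
    (trans (lem₁ (⟦ s₁ ⟧ (first E x y)) (⟦ s₂ ⟧ (second E x y)) v) (trans (cong (_+ v) (preserves E x y)) (lem₂ (+ 24 * + c) (⟦ t₁ ⟧ x) (⟦ t₂ ⟧ y) v)))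
    (f₁ (first E x y) (f₂ (second E x y) r))

exchange : ∀ {t₁ t₂ s₁ s₂ c F G n} (E : Exchange t₁ t₂ s₁ s₂ c) {_ : T (is-just (exchange? E F G))} → F represents n → G represents (c ℕ.+ n)
exchange {c = c} {F} {G} {n} E {w} (scale r) = scale (subst (Value G) (sym (ℤₚ.*-distribˡ-+ (+ 24) (+ c) (+ n))) (to-witness (exchange? E F G) w r))

-- A single polynomial identity carries a known equation a = b over to the value of a sum.
at : ∀ {F v v′} → Value F v → ∀ k {a b} → a ≡ b → v - v′ ≡ k * (a - b) → Value F v′
at {F} {v} {v′} r k h e = subst (Value F) (ℤₚ.i-j≡0⇒i≡j v v′ (trans e (trans (cong (_*_ k) (ℤₚ.i≡j⇒i-j≡0 h)) (ℤₚ.*-zeroʳ k)))) r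

class : ∀ {F} r q m → Value F (+ 24 * (+ r + + q * + m)) → F represents (r ℕ.+ q ℕ.* m)
class {F} r q m v = scale (subst (λ t → Value F (+ 24 * (+ r + t))) (sym (ℤₚ.pos-* q m)) v)

-- The modulus is bracketed as two nested uses of `modulo` produce it.
class² : ∀ {F} r q m m′ → Value F (+ 24 * (+ r + + q * + m * + m′)) → F represents (r ℕ.+ q ℕ.* m ℕ.* m′)
class² {F} r q m m′ v = class r (q ℕ.* m) m′ (subst (λ t → Value F (+ 24 * (+ r + t * + m′))) (sym (ℤₚ.pos-* q m)) v)

solution : ∀ {t₁ t₂ t₃ t₄ n} x y z w → ⟦ t₁ ⟧ x + (⟦ t₂ ⟧ y + (⟦ t₃ ⟧ z + (⟦ t₄ ⟧ w + 0ℤ))) ≡ + 24 * + n → (t₁ ∷ t₂ ∷ t₃ ∷ t₄ ∷ []) represents n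
solution x y z w e = scale (subst (Value _) e (x ∷ y ∷ z ∷ w ∷ []))

arguments : ∀ {t₁ t₂ t₃ t₄ v} → Value (t₁ ∷ t₂ ∷ t₃ ∷ t₄ ∷ []) v →
  ∃[ x ] ∃[ y ] ∃[ z ] ∃[ w ] ⟦ t₁ ⟧ x + (⟦ t₂ ⟧ y + (⟦ t₃ ⟧ z + (⟦ t₄ ⟧ w + 0ℤ))) ≡ v
arguments (x ∷ y ∷ z ∷ w ∷ []) = x , y , z , w , refl

modulo : ∀ m .{{_ : ℕ.NonZero m}} {P : ℕ → Set} → (∀ (r : Fin m) q → P (toℕ r ℕ.+ q ℕ.* m)) → ∀ n → P n
modulo m {P} f n with n divMod m
... | result q r e = subst P (sym e) (f r q)

descent : ∀ {F} m .{{_ : ℕ.NonZero m}} →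
  (∀ (r : Fin m) q → (∀ {k} → k ℕ.< toℕ r ℕ.+ q ℕ.* m → F represents k) → F represents (toℕ r ℕ.+ q ℕ.* m)) → ∀ n → F represents n
descent {F} m f = <-rec (F represents_) λ n → modulo m {λ n → (∀ {k} → k ℕ.< n → F represents k) → F represents n} f n

-- Ternary sums that represent all natural numbers

3p₄+p₅+p₈ : ∀ n → ((3 , 4) ∷ (1 , 5) ∷ (1 , 8) ∷ []) represents n
3p₄+p₅+p₈ n = case form₁₈,₇₂ n of λ (x , y , z , h) → scale (at (x ∷ y ∷ z ∷ []) (+ 1) h (lem x y z (+ n)))
  where
  lem : ∀ x y z n → + 3 * (+ 24 * (x * x)) + (+ 1 * ((+ 6 * y - 1ℤ) * (+ 6 * y - 1ℤ) - 1ℤ) + (+ 1 * (+ 8 * ((+ 3 * z - 1ℤ) * (+ 3 * z - 1ℤ)) - + 8) + 0ℤ)) - + 24 * n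
    ≡ + 1 * (+ 72 * (x * x) + (+ 6 * y - 1ℤ) * (+ 6 * y - 1ℤ) + + 8 * ((+ 3 * z - 1ℤ) * (+ 3 * z - 1ℤ)) - (+ 24 * n + + 9))
  lem = solve-∀

6p₃+p₅+2p₅ : ∀ n → ((6 , 3) ∷ (1 , 5) ∷ (2 , 5) ∷ []) represents n
6p₃+p₅+2p₅ n = case form₁₂,₁₈ n of λ (x , y , z , h) → scale (at (x ∷ y ∷ z ∷ []) (+ 1) h (lem x y z (+ n)))
  where
  lem : ∀ x y z n → + 6 * (+ 12 * (x * x) + + 12 * x) + (+ 1 * ((+ 6 * y - 1ℤ) * (+ 6 * y - 1ℤ) - 1ℤ) + (+ 2 * ((+ 6 * z - 1ℤ) * (+ 6 * z - 1ℤ) - 1ℤ) + 0ℤ)) - + 24 * n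
    ≡ + 1 * (+ 18 * ((x + x + 1ℤ) * (x + x + 1ℤ)) + (+ 6 * y - 1ℤ) * (+ 6 * y - 1ℤ) + + 2 * ((+ 6 * z - 1ℤ) * (+ 6 * z - 1ℤ)) - (+ 24 * n + + 21))
  lem = solve-∀

2p₅+4p₅+p₈ : ∀ n → ((2 , 5) ∷ (4 , 5) ∷ (1 , 8) ∷ []) represents n
2p₅+4p₅+p₈ n = case form₁₂₄ n of λ (x , y , z , h) → scale (at (x ∷ y ∷ z ∷ []) (+ 2) h (lem (sq₆ x) (sq₆ y) (sq₃ z) (+ n)))
  where
  lem : ∀ x y z n → + 2 * (x - 1ℤ) + (+ 4 * (y - 1ℤ) + (+ 1 * (+ 8 * z - + 8) + 0ℤ)) - + 24 * n
    ≡ + 2 * (x + + 2 * y + + 4 * z - (+ 3 * (+ 4 * n + + 2) + + 1))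
  lem = solve-∀

2p₅+p₈+p₈ : ∀ n → ((2 , 5) ∷ (1 , 8) ∷ (1 , 8) ∷ []) represents n
2p₅+p₈+p₈ n = case three₉ n of λ (x , y , z , h) → scale (at (x ∷ y ∷ z ∷ []) (+ 2) h (lem (sq₆ x) (sq₃ y) (sq₃ z) (+ n)))
  where
  lem : ∀ x y z n → + 2 * (x - 1ℤ) + (+ 1 * (+ 8 * y - + 8) + (+ 1 * (+ 8 * z - + 8) + 0ℤ)) - + 24 * n
    ≡ + 2 * (x + + 4 * y + + 4 * z - (+ 3 * (+ 4 * n + + 3) + + 0))
  lem = solve-∀

2p₅+2p₅+p₈ : ∀ n → ((2 , 5) ∷ (2 , 5) ∷ (1 , 8) ∷ []) represents n
2p₅+2p₅+p₈ n = case three₆ n of λ (x , y , z , h) → scale (at (x ∷ y ∷ z ∷ []) (+ 2) h (lem (sq₆ x) (sq₆ y) (sq₃ z) (+ n)))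
  where
  lem : ∀ x y z n → + 2 * (x - 1ℤ) + (+ 2 * (y - 1ℤ) + (+ 1 * (+ 8 * z - + 8) + 0ℤ)) - + 24 * n
    ≡ + 2 * (x + y + + 4 * z - (+ 3 * (+ 4 * n + + 2) + + 0))
  lem = solve-∀

p₅+p₈+p₈ : ∀ n → ((1 , 5) ∷ (1 , 8) ∷ (1 , 8) ∷ []) represents n
p₅+p₈+p₈ n = case form₁₈₈ n of λ (x , y , z , h) → scale (at (x ∷ y ∷ z ∷ []) (+ 1) h (lem (sq₆ x) (sq₃ y) (sq₃ z) (+ n)))
  where
  lem : ∀ x y z n → + 1 * (x - 1ℤ) + (+ 1 * (+ 8 * y - + 8) + (+ 1 * (+ 8 * z - + 8) + 0ℤ)) - + 24 * n
    ≡ + 1 * (x + + 8 * y + + 8 * z - (+ 24 * n + + 17))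
  lem = solve-∀

p₃+2p₅+4p₅ : ∀ n → ((1 , 3) ∷ (2 , 5) ∷ (4 , 5) ∷ []) represents n
p₃+2p₅+4p₅ n = case form₃₂₄-odd n of λ (x , y , z , h) → scale (at (x ∷ y ∷ z ∷ []) (+ 1) h (lem x y z (+ n)))
  where
  lem : ∀ x y z n → + 1 * (+ 12 * (x * x) + + 12 * x) + (+ 2 * ((+ 6 * y - 1ℤ) * (+ 6 * y - 1ℤ) - 1ℤ) + (+ 4 * ((+ 6 * z - 1ℤ) * (+ 6 * z - 1ℤ) - 1ℤ) + 0ℤ)) - + 24 * n
    ≡ + 1 * (+ 3 * ((x + x + 1ℤ) * (x + x + 1ℤ)) + + 2 * ((+ 6 * y - 1ℤ) * (+ 6 * y - 1ℤ)) + + 4 * ((+ 6 * z - 1ℤ) * (+ 6 * z - 1ℤ)) - (+ 24 * n + + 9))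
  lem = solve-∀

p₃+2p₅+2p₈ : ∀ n → ((1 , 3) ∷ (2 , 5) ∷ (2 , 8) ∷ []) represents n
p₃+2p₅+2p₈ n = case form₃₂,₁₆ n of λ (x , y , z , h) → scale (at (x ∷ y ∷ z ∷ []) (+ 1) h (lem x y z (+ n)))
  where
  lem : ∀ x y z n → + 1 * (+ 12 * (x * x) + + 12 * x) + (+ 2 * ((+ 6 * y - 1ℤ) * (+ 6 * y - 1ℤ) - 1ℤ) + (+ 2 * (+ 8 * ((+ 3 * z - 1ℤ) * (+ 3 * z - 1ℤ)) - + 8) + 0ℤ)) - + 24 * n
    ≡ + 1 * (+ 3 * ((x + x + 1ℤ) * (x + x + 1ℤ)) + + 2 * ((+ 6 * y - 1ℤ) * (+ 6 * y - 1ℤ)) + + 16 * ((+ 3 * z - 1ℤ) * (+ 3 * z - 1ℤ)) - (+ 24 * n + + 21))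
  lem = solve-∀

p₅+2p₅+4p₅ : ∀ n → ((1 , 5) ∷ (2 , 5) ∷ (4 , 5) ∷ []) represents n
p₅+2p₅+4p₅ n = case form₁₂₄-odd n of λ (x , y , z , h) → scale (at (x ∷ y ∷ z ∷ []) (+ 1) h (lem (sq₆ x) (sq₆ y) (sq₆ z) (+ n)))
  where
  lem : ∀ x y z n → + 1 * (x - 1ℤ) + (+ 2 * (y - 1ℤ) + (+ 4 * (z - 1ℤ) + 0ℤ)) - + 24 * n ≡ + 1 * (x + + 2 * y + + 4 * z - (+ 24 * n + + 7))
  lem = solve-∀

p₅+2p₅+2p₈ : ∀ n → ((1 , 5) ∷ (2 , 5) ∷ (2 , 8) ∷ []) represents n
p₅+2p₅+2p₈ n = case form₁₂,₁₆ n of λ (x , y , z , h) → scale (at (x ∷ y ∷ z ∷ []) (+ 1) h (lem (sq₆ x) (sq₆ y) (sq₃ z) (+ n)))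
  where
  lem : ∀ x y z n → + 1 * (x - 1ℤ) + (+ 2 * (y - 1ℤ) + (+ 2 * (+ 8 * z - + 8) + 0ℤ)) - + 24 * n ≡ + 1 * (x + + 2 * y + + 16 * z - (+ 24 * n + + 19))
  lem = solve-∀

-- Ternary sums on residue classes

4p₅+p₈+p₈-0mod2 : ∀ q → ((4 , 5) ∷ (1 , 8) ∷ (1 , 8) ∷ []) represents (0 ℕ.+ q ℕ.* 2)
4p₅+p₈+p₈-0mod2 q = case form₁₂₂ q of λ (x , y , z , h) → class 0 q 2 (at (x ∷ y ∷ z ∷ []) (+ 4) h (lem (sq₆ x) (sq₃ y) (sq₃ z) (+ q)))
  where
  lem : ∀ x y z q → + 4 * (x - 1ℤ) + (+ 1 * (+ 8 * y - + 8) + (+ 1 * (+ 8 * z - + 8) + 0ℤ)) - + 24 * (+ 0 + q * + 2)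
    ≡ + 4 * (x + + 2 * y + + 2 * z - (+ 3 * (+ 4 * q + + 1) + + 2))
  lem = solve-∀

-- Divided by 4 the equation is x² + 4y² + 4z² = 6n + 9, and 6n + 9 is the number 12q + 9 of
-- `three₉` for n = 2q.
4p₅+2p₈+2p₈-0mod2 : ∀ q → ((4 , 5) ∷ (2 , 8) ∷ (2 , 8) ∷ []) represents (0 ℕ.+ q ℕ.* 2)
4p₅+2p₈+2p₈-0mod2 q = case three₉ q of λ (x , y , z , h) → class 0 q 2 (at (x ∷ y ∷ z ∷ []) (+ 4) h (lem (sq₆ x) (sq₃ y) (sq₃ z) (+ q)))
  where
  lem : ∀ x y z q → + 4 * (x - 1ℤ) + (+ 2 * (+ 8 * y - + 8) + (+ 2 * (+ 8 * z - + 8) + 0ℤ)) - + 24 * (+ 0 + q * + 2)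
    ≡ + 4 * (x + + 4 * y + + 4 * z - (+ 3 * (+ 4 * q + + 3) + + 0))
  lem = solve-∀

2p₅+2p₈+2p₈-0mod2 : ∀ q → ((2 , 5) ∷ (2 , 8) ∷ (2 , 8) ∷ []) represents (0 ℕ.+ q ℕ.* 2)
2p₅+2p₈+2p₈-0mod2 q = case form₁₈₈ q of λ (x , y , z , h) → class 0 q 2 (at (x ∷ y ∷ z ∷ []) (+ 2) h (lem (sq₆ x) (sq₃ y) (sq₃ z) (+ q)))
  where
  lem : ∀ x y z q → + 2 * (x - 1ℤ) + (+ 2 * (+ 8 * y - + 8) + (+ 2 * (+ 8 * z - + 8) + 0ℤ)) - + 24 * (+ 0 + q * + 2)
    ≡ + 2 * (x + + 8 * y + + 8 * z - (+ 24 * q + + 17))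
  lem = solve-∀

2p₅+p₈+2p₈-0mod2 : ∀ q → ((2 , 5) ∷ (1 , 8) ∷ (2 , 8) ∷ []) represents (0 ℕ.+ q ℕ.* 2)
2p₅+p₈+2p₈-0mod2 q = case form₁₄₈ q of λ (x , y , z , h) → class 0 q 2 (at (x ∷ y ∷ z ∷ []) (+ 2) h (lem (sq₆ x) (sq₃ y) (sq₃ z) (+ q)))
  where
  lem : ∀ x y z q → + 2 * (x - 1ℤ) + (+ 1 * (+ 8 * y - + 8) + (+ 2 * (+ 8 * z - + 8) + 0ℤ)) - + 24 * (+ 0 + q * + 2)
    ≡ + 2 * (x + + 4 * y + + 8 * z - (+ 3 * (+ 8 * q + + 4) + + 1))
  lem = solve-∀

4p₅+p₈+2p₈-0mod4 : ∀ q → ((4 , 5) ∷ (1 , 8) ∷ (2 , 8) ∷ []) represents (0 ℕ.+ q ℕ.* 4)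
4p₅+p₈+2p₈-0mod4 q = case form₁₂₄ (q ℕ.+ q) of λ (x , y , z , h) → class 0 q 4 (at (x ∷ (y + y) ∷ z ∷ []) (+ 4) h (lem x y z (+ q)))
  where
  lem : ∀ x y z q → let sqr = λ (x : ℤ) → x * x in
    + 4 * (sqr (+ 6 * x - 1ℤ) - 1ℤ) + (+ 1 * (+ 8 * sqr (+ 3 * (y + y) - 1ℤ) - + 8) + (+ 2 * (+ 8 * sqr (+ 3 * z - 1ℤ) - + 8) + 0ℤ)) - + 24 * (+ 0 + q * + 4)
    ≡ + 4 * (sqr (+ 6 * x - 1ℤ) + + 2 * sqr (+ 6 * y - 1ℤ) + + 4 * sqr (+ 3 * z - 1ℤ) - (+ 3 * (+ 4 * (q + q) + + 2) + + 1))
  lem = solve-∀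

-- The arguments come from c₃(1 - 2z) = -2 c₃(z); together with c₃(2y) = c₆(y) this makes an
-- octagonal variable even or odd at will.
4p₅+p₈+2p₈-1mod4 : ∀ q → ((4 , 5) ∷ (1 , 8) ∷ (2 , 8) ∷ []) represents (1 ℕ.+ q ℕ.* 4)
4p₅+p₈+2p₈-1mod4 q = case form₁₄₈ q of λ (x , y , z , h) → class 1 q 4 (at (x ∷ (1ℤ - (z + z)) ∷ y ∷ []) (+ 4) h (lem x y z (+ q)))
  where
  lem : ∀ x y z q → let sqr = λ (x : ℤ) → x * x in
    + 4 * (sqr (+ 6 * x - 1ℤ) - 1ℤ) + (+ 1 * (+ 8 * sqr (+ 3 * (1ℤ - (z + z)) - 1ℤ) - + 8) + (+ 2 * (+ 8 * sqr (+ 3 * y - 1ℤ) - + 8) + 0ℤ)) - + 24 * (+ 1 + q * + 4)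
    ≡ + 4 * (sqr (+ 6 * x - 1ℤ) + + 4 * sqr (+ 3 * y - 1ℤ) + + 8 * sqr (+ 3 * z - 1ℤ) - (+ 3 * (+ 8 * q + + 4) + + 1))
  lem = solve-∀

4p₅+p₈+2p₈-2mod4 : ∀ q → ((4 , 5) ∷ (1 , 8) ∷ (2 , 8) ∷ []) represents (2 ℕ.+ q ℕ.* 4)
4p₅+p₈+2p₈-2mod4 q = case form₁₂₄ (suc (q ℕ.+ q)) of λ (x , y , z , h) → class 2 q 4 (at (x ∷ (y + y) ∷ z ∷ []) (+ 4) h (lem x y z (+ q)))
  where
  lem : ∀ x y z q → let sqr = λ (x : ℤ) → x * x in
    + 4 * (sqr (+ 6 * x - 1ℤ) - 1ℤ) + (+ 1 * (+ 8 * sqr (+ 3 * (y + y) - 1ℤ) - + 8) + (+ 2 * (+ 8 * sqr (+ 3 * z - 1ℤ) - + 8) + 0ℤ)) - + 24 * (+ 2 + q * + 4)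
    ≡ + 4 * (sqr (+ 6 * x - 1ℤ) + + 2 * sqr (+ 6 * y - 1ℤ) + + 4 * sqr (+ 3 * z - 1ℤ) - (+ 3 * (+ 4 * (1ℤ + (q + q)) + + 2) + + 1))
  lem = solve-∀

4p₅+p₈+4p₈-1mod4 : ∀ q → ((4 , 5) ∷ (1 , 8) ∷ (4 , 8) ∷ []) represents (1 ℕ.+ q ℕ.* 4)
4p₅+p₈+4p₈-1mod4 q = case form₁₈₈ q of λ (x , y , z , h) → class 1 q 4 (at (x ∷ (1ℤ - (y + y)) ∷ z ∷ []) (+ 4) h (lem x y z (+ q)))
  where
  lem : ∀ x y z q → let sqr = λ (x : ℤ) → x * x in
    + 4 * (sqr (+ 6 * x - 1ℤ) - 1ℤ) + (+ 1 * (+ 8 * sqr (+ 3 * (1ℤ - (y + y)) - 1ℤ) - + 8) + (+ 4 * (+ 8 * sqr (+ 3 * z - 1ℤ) - + 8) + 0ℤ)) - + 24 * (+ 1 + q * + 4)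
    ≡ + 4 * (sqr (+ 6 * x - 1ℤ) + + 8 * sqr (+ 3 * y - 1ℤ) + + 8 * sqr (+ 3 * z - 1ℤ) - (+ 24 * q + + 17))
  lem = solve-∀

3p₄+p₈+p₈-0mod4 : ∀ q → ((3 , 4) ∷ (1 , 8) ∷ (1 , 8) ∷ []) represents (0 ℕ.+ q ℕ.* 4)
3p₄+p₈+p₈-0mod4 q = case three₂ q of λ (x , y , z , h) → class 0 q 4 (at (x ∷ y ∷ z ∷ []) (+ 8) h (lem x y z (+ q)))
  where
  lem : ∀ x y z q → + 3 * (+ 24 * (x * x)) + (+ 1 * (+ 8 * ((+ 3 * y - 1ℤ) * (+ 3 * y - 1ℤ)) - + 8) + (+ 1 * (+ 8 * ((+ 3 * z - 1ℤ) * (+ 3 * z - 1ℤ)) - + 8) + 0ℤ)) - + 24 * (+ 0 + q * + 4)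
    ≡ + 8 * (+ 9 * (x * x) + (+ 3 * y - 1ℤ) * (+ 3 * y - 1ℤ) + (+ 3 * z - 1ℤ) * (+ 3 * z - 1ℤ) - (+ 3 * (+ 4 * q) + + 2))
  lem = solve-∀

3p₄+p₈+p₈-1mod4 : ∀ q → ((3 , 4) ∷ (1 , 8) ∷ (1 , 8) ∷ []) represents (1 ℕ.+ q ℕ.* 4)
3p₄+p₈+p₈-1mod4 q = case three₅ q of λ (x , y , z , h) → class 1 q 4 (at (x ∷ y ∷ z ∷ []) (+ 8) h (lem x y z (+ q)))
  where
  lem : ∀ x y z q → + 3 * (+ 24 * (x * x)) + (+ 1 * (+ 8 * ((+ 3 * y - 1ℤ) * (+ 3 * y - 1ℤ)) - + 8) + (+ 1 * (+ 8 * ((+ 3 * z - 1ℤ) * (+ 3 * z - 1ℤ)) - + 8) + 0ℤ)) - + 24 * (+ 1 + q * + 4)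
    ≡ + 8 * (+ 9 * (x * x) + (+ 3 * y - 1ℤ) * (+ 3 * y - 1ℤ) + (+ 3 * z - 1ℤ) * (+ 3 * z - 1ℤ) - (+ 3 * (+ 4 * q + + 1) + + 2))
  lem = solve-∀

p₈+p₈+4p₈-0mod4 : ∀ q → ((1 , 8) ∷ (1 , 8) ∷ (4 , 8) ∷ []) represents (0 ℕ.+ q ℕ.* 4)
p₈+p₈+4p₈-0mod4 q = case three₆ q of λ (x , y , z , h) → class 0 q 4 (at ((x + x) ∷ (y + y) ∷ z ∷ []) (+ 8) h (lem x y z (+ q)))
  where
  lem : ∀ x y z q → let sqr = λ (x : ℤ) → x * x in
    + 1 * (+ 8 * sqr (+ 3 * (x + x) - 1ℤ) - + 8) + (+ 1 * (+ 8 * sqr (+ 3 * (y + y) - 1ℤ) - + 8) + (+ 4 * (+ 8 * sqr (+ 3 * z - 1ℤ) - + 8) + 0ℤ)) - + 24 * (+ 0 + q * + 4)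
    ≡ + 8 * (sqr (+ 6 * x - 1ℤ) + sqr (+ 6 * y - 1ℤ) + + 4 * sqr (+ 3 * z - 1ℤ) - (+ 3 * (+ 4 * q + + 2) + + 0))
  lem = solve-∀

p₈+p₈+p₈-1mod4 : ∀ q → ((1 , 8) ∷ (1 , 8) ∷ (1 , 8) ∷ []) represents (1 ℕ.+ q ℕ.* 4)
p₈+p₈+p₈-1mod4 q = case three₆ q of λ (x , y , z , h) → class 1 q 4 (at ((x + x) ∷ (y + y) ∷ (1ℤ - (z + z)) ∷ []) (+ 8) h (lem x y z (+ q)))
  where
  lem : ∀ x y z q → let sqr = λ (x : ℤ) → x * x in
    + 1 * (+ 8 * sqr (+ 3 * (x + x) - 1ℤ) - + 8) + (+ 1 * (+ 8 * sqr (+ 3 * (y + y) - 1ℤ) - + 8) + (+ 1 * (+ 8 * sqr (+ 3 * (1ℤ - (z + z)) - 1ℤ) - + 8) + 0ℤ)) - + 24 * (+ 1 + q * + 4)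
    ≡ + 8 * (sqr (+ 6 * x - 1ℤ) + sqr (+ 6 * y - 1ℤ) + + 4 * sqr (+ 3 * z - 1ℤ) - (+ 3 * (+ 4 * q + + 2) + + 0))
  lem = solve-∀

p₈+p₈+p₈-2mod4 : ∀ q → ((1 , 8) ∷ (1 , 8) ∷ (1 , 8) ∷ []) represents (2 ℕ.+ q ℕ.* 4)
p₈+p₈+p₈-2mod4 q = case three₉ q of λ (x , y , z , h) → class 2 q 4 (at ((x + x) ∷ (1ℤ - (y + y)) ∷ (1ℤ - (z + z)) ∷ []) (+ 8) h (lem x y z (+ q)))
  where
  lem : ∀ x y z q → let sqr = λ (x : ℤ) → x * x in
    + 1 * (+ 8 * sqr (+ 3 * (x + x) - 1ℤ) - + 8) + (+ 1 * (+ 8 * sqr (+ 3 * (1ℤ - (y + y)) - 1ℤ) - + 8) + (+ 1 * (+ 8 * sqr (+ 3 * (1ℤ - (z + z)) - 1ℤ) - + 8) + 0ℤ)) - + 24 * (+ 2 + q * + 4)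
    ≡ + 8 * (sqr (+ 6 * x - 1ℤ) + + 4 * sqr (+ 3 * y - 1ℤ) + + 4 * sqr (+ 3 * z - 1ℤ) - (+ 3 * (+ 4 * q + + 3) + + 0))
  lem = solve-∀

p₈+p₈+2p₈-1mod4 : ∀ q → ((1 , 8) ∷ (1 , 8) ∷ (2 , 8) ∷ []) represents (1 ℕ.+ q ℕ.* 4)
p₈+p₈+2p₈-1mod4 q = case form₁₂₄ q of λ (x , y , z , h) → class 1 q 4 (at ((x + x) ∷ (1ℤ - (z + z)) ∷ (y + y) ∷ []) (+ 8) h (lem x y z (+ q)))
  where
  lem : ∀ x y z q → let sqr = λ (x : ℤ) → x * x in
    + 1 * (+ 8 * sqr (+ 3 * (x + x) - 1ℤ) - + 8) + (+ 1 * (+ 8 * sqr (+ 3 * (1ℤ - (z + z)) - 1ℤ) - + 8) + (+ 2 * (+ 8 * sqr (+ 3 * (y + y) - 1ℤ) - + 8) + 0ℤ)) - + 24 * (+ 1 + q * + 4)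
    ≡ + 8 * (sqr (+ 6 * x - 1ℤ) + + 2 * sqr (+ 6 * y - 1ℤ) + + 4 * sqr (+ 3 * z - 1ℤ) - (+ 3 * (+ 4 * q + + 2) + + 1))
  lem = solve-∀

-- Since c₃(y ± x) = c₃(y) ± 3x, the first two squares add up to 2(9x² + c₃(y)²).
p₈+p₈+2p₈-0mod8 : ∀ q → ((1 , 8) ∷ (1 , 8) ∷ (2 , 8) ∷ []) represents (0 ℕ.+ q ℕ.* 2 ℕ.* 4)
p₈+p₈+2p₈-0mod8 q = case three₂ q of λ (x , y , z , h) → class² 0 q 2 4 (at ((x + y) ∷ (y - x) ∷ z ∷ []) (+ 16) h (lem x y z (+ q)))
  where
  lem : ∀ x y z q → let c₃ = λ (x : ℤ) → + 3 * x - 1ℤ in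
    + 1 * (+ 8 * (c₃ (x + y) * c₃ (x + y)) - + 8) + (+ 1 * (+ 8 * (c₃ (y - x) * c₃ (y - x)) - + 8) + (+ 2 * (+ 8 * (c₃ z * c₃ z) - + 8) + 0ℤ)) - + 24 * (+ 0 + q * + 2 * + 4)
    ≡ + 16 * (+ 9 * (x * x) + c₃ y * c₃ y + c₃ z * c₃ z - (+ 3 * (+ 4 * q) + + 2))
  lem = solve-∀

p₈+p₈+2p₈-2mod8 : ∀ q → ((1 , 8) ∷ (1 , 8) ∷ (2 , 8) ∷ []) represents (2 ℕ.+ q ℕ.* 2 ℕ.* 4)
p₈+p₈+2p₈-2mod8 q = case three₅ q of λ (x , y , z , h) → class² 2 q 2 4 (at ((x + y) ∷ (y - x) ∷ z ∷ []) (+ 16) h (lem x y z (+ q)))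
  where
  lem : ∀ x y z q → let c₃ = λ (x : ℤ) → + 3 * x - 1ℤ in
    + 1 * (+ 8 * (c₃ (x + y) * c₃ (x + y)) - + 8) + (+ 1 * (+ 8 * (c₃ (y - x) * c₃ (y - x)) - + 8) + (+ 2 * (+ 8 * (c₃ z * c₃ z) - + 8) + 0ℤ)) - + 24 * (+ 2 + q * + 2 * + 4)
    ≡ + 16 * (+ 9 * (x * x) + c₃ y * c₃ y + c₃ z * c₃ z - (+ 3 * (+ 4 * q + + 1) + + 2))
  lem = solve-∀

p₈+p₈+2p₈-3mod8 : ∀ q → ((1 , 8) ∷ (1 , 8) ∷ (2 , 8) ∷ []) represents (3 ℕ.+ q ℕ.* 2 ℕ.* 4)
p₈+p₈+2p₈-3mod8 q = case form₁₄₈ q of λ (x , y , z , h) → class² 3 q 2 4 (at ((x + x) ∷ (1ℤ - (y + y)) ∷ (1ℤ - (z + z)) ∷ []) (+ 8) h (lem x y z (+ q)))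
  where
  lem : ∀ x y z q → let sqr = λ (x : ℤ) → x * x in
    + 1 * (+ 8 * sqr (+ 3 * (x + x) - 1ℤ) - + 8) + (+ 1 * (+ 8 * sqr (+ 3 * (1ℤ - (y + y)) - 1ℤ) - + 8) + (+ 2 * (+ 8 * sqr (+ 3 * (1ℤ - (z + z)) - 1ℤ) - + 8) + 0ℤ)) - + 24 * (+ 3 + q * + 2 * + 4)
    ≡ + 8 * (sqr (+ 6 * x - 1ℤ) + + 4 * sqr (+ 3 * y - 1ℤ) + + 8 * sqr (+ 3 * z - 1ℤ) - (+ 3 * (+ 8 * q + + 4) + + 1))
  lem = solve-∀

p₈+2p₈+2p₈-0mod4 : ∀ q → ((1 , 8) ∷ (2 , 8) ∷ (2 , 8) ∷ []) represents (0 ℕ.+ q ℕ.* 4)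
p₈+2p₈+2p₈-0mod4 q = case form₁₂₂ q of λ (x , y , z , h) → class 0 q 4 (at ((x + x) ∷ y ∷ z ∷ []) (+ 8) h (lem x y z (+ q)))
  where
  lem : ∀ x y z q → let c₃ = λ (x : ℤ) → + 3 * x - 1ℤ in
    + 1 * (+ 8 * (c₃ (x + x) * c₃ (x + x)) - + 8) + (+ 2 * (+ 8 * (c₃ y * c₃ y) - + 8) + (+ 2 * (+ 8 * (c₃ z * c₃ z) - + 8) + 0ℤ)) - + 24 * (+ 0 + q * + 4)
    ≡ + 8 * ((+ 6 * x - 1ℤ) * (+ 6 * x - 1ℤ) + + 2 * (c₃ y * c₃ y) + + 2 * (c₃ z * c₃ z) - (+ 3 * (+ 4 * q + + 1) + + 2))
  lem = solve-∀

-- The argument 1 - 4y comes from c₃(1 - 4y) = -2 c₆(y).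
p₈+2p₈+2p₈-3mod16 : ∀ q → ((1 , 8) ∷ (2 , 8) ∷ (2 , 8) ∷ []) represents (3 ℕ.+ q ℕ.* 4 ℕ.* 4)
p₈+2p₈+2p₈-3mod16 q = case form₁₂₄ (q ℕ.+ q) of λ (x , y , z , h) → class² 3 q 4 4 (at ((1ℤ - + 4 * y) ∷ (x + x) ∷ (1ℤ - (z + z)) ∷ []) (+ 16) h (lem x y z (+ q)))
  where
  lem : ∀ x y z q → let sqr = λ (x : ℤ) → x * x in
    + 1 * (+ 8 * sqr (+ 3 * (1ℤ - + 4 * y) - 1ℤ) - + 8) + (+ 2 * (+ 8 * sqr (+ 3 * (x + x) - 1ℤ) - + 8) + (+ 2 * (+ 8 * sqr (+ 3 * (1ℤ - (z + z)) - 1ℤ) - + 8) + 0ℤ)) - + 24 * (+ 3 + q * + 4 * + 4)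
    ≡ + 16 * (sqr (+ 6 * x - 1ℤ) + + 2 * sqr (+ 6 * y - 1ℤ) + + 4 * sqr (+ 3 * z - 1ℤ) - (+ 3 * (+ 4 * (q + q) + + 2) + + 1))
  lem = solve-∀

p₈+2p₈+2p₈-11mod16 : ∀ q → ((1 , 8) ∷ (2 , 8) ∷ (2 , 8) ∷ []) represents (11 ℕ.+ q ℕ.* 4 ℕ.* 4)
p₈+2p₈+2p₈-11mod16 q = case form₁₂₄ (suc (q ℕ.+ q)) of λ (x , y , z , h) → class² 11 q 4 4 (at ((1ℤ - + 4 * y) ∷ (x + x) ∷ (1ℤ - (z + z)) ∷ []) (+ 16) h (lem x y z (+ q)))
  where
  lem : ∀ x y z q → let sqr = λ (x : ℤ) → x * x in
    + 1 * (+ 8 * sqr (+ 3 * (1ℤ - + 4 * y) - 1ℤ) - + 8) + (+ 2 * (+ 8 * sqr (+ 3 * (x + x) - 1ℤ) - + 8) + (+ 2 * (+ 8 * sqr (+ 3 * (1ℤ - (z + z)) - 1ℤ) - + 8) + 0ℤ)) - + 24 * (+ 11 + q * + 4 * + 4)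
    ≡ + 16 * (sqr (+ 6 * x - 1ℤ) + + 2 * sqr (+ 6 * y - 1ℤ) + + 4 * sqr (+ 3 * z - 1ℤ) - (+ 3 * (+ 4 * (1ℤ + (q + q)) + + 2) + + 1))
  lem = solve-∀

p₈+2p₈+2p₈-1mod16 : ∀ q → ((1 , 8) ∷ (2 , 8) ∷ (2 , 8) ∷ []) represents (1 ℕ.+ q ℕ.* 4 ℕ.* 4)
p₈+2p₈+2p₈-1mod16 q = case three₂ q of λ (x , y , z , h) → class² 1 q 4 4 (at ((1ℤ - (z + z)) ∷ (x + y) ∷ (y - x) ∷ []) (+ 32) h (lem x y z (+ q)))
  where
  lem : ∀ x y z q → let c₃ = λ (x : ℤ) → + 3 * x - 1ℤ in
    + 1 * (+ 8 * (c₃ (1ℤ - (z + z)) * c₃ (1ℤ - (z + z))) - + 8) + (+ 2 * (+ 8 * (c₃ (x + y) * c₃ (x + y)) - + 8) + (+ 2 * (+ 8 * (c₃ (y - x) * c₃ (y - x)) - + 8) + 0ℤ)) - + 24 * (+ 1 + q * + 4 * + 4)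
    ≡ + 32 * (+ 9 * (x * x) + c₃ y * c₃ y + c₃ z * c₃ z - (+ 3 * (+ 4 * q) + + 2))
  lem = solve-∀

p₈+2p₈+2p₈-5mod16 : ∀ q → ((1 , 8) ∷ (2 , 8) ∷ (2 , 8) ∷ []) represents (5 ℕ.+ q ℕ.* 4 ℕ.* 4)
p₈+2p₈+2p₈-5mod16 q = case three₅ q of λ (x , y , z , h) → class² 5 q 4 4 (at ((1ℤ - (z + z)) ∷ (x + y) ∷ (y - x) ∷ []) (+ 32) h (lem x y z (+ q)))
  where
  lem : ∀ x y z q → let c₃ = λ (x : ℤ) → + 3 * x - 1ℤ in
    + 1 * (+ 8 * (c₃ (1ℤ - (z + z)) * c₃ (1ℤ - (z + z))) - + 8) + (+ 2 * (+ 8 * (c₃ (x + y) * c₃ (x + y)) - + 8) + (+ 2 * (+ 8 * (c₃ (y - x) * c₃ (y - x)) - + 8) + 0ℤ)) - + 24 * (+ 5 + q * + 4 * + 4)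
    ≡ + 32 * (+ 9 * (x * x) + c₃ y * c₃ y + c₃ z * c₃ z - (+ 3 * (+ 4 * q + + 1) + + 2))
  lem = solve-∀

-- The argument 4z - 1 comes from c₃(4z - 1) = 4 c₃(z).
p₈+2p₈+2p₈-7mod16 : ∀ q → ((1 , 8) ∷ (2 , 8) ∷ (2 , 8) ∷ []) represents (7 ℕ.+ q ℕ.* 4 ℕ.* 4)
p₈+2p₈+2p₈-7mod16 q = case form₁₄₈ q of λ (x , y , z , h) → class² 7 q 4 4 (at ((+ 4 * z - 1ℤ) ∷ (x + x) ∷ (1ℤ - (y + y)) ∷ []) (+ 16) h (lem x y z (+ q)))
  where
  lem : ∀ x y z q → let sqr = λ (x : ℤ) → x * x in
    + 1 * (+ 8 * sqr (+ 3 * (+ 4 * z - 1ℤ) - 1ℤ) - + 8) + (+ 2 * (+ 8 * sqr (+ 3 * (x + x) - 1ℤ) - + 8) + (+ 2 * (+ 8 * sqr (+ 3 * (1ℤ - (y + y)) - 1ℤ) - + 8) + 0ℤ)) - + 24 * (+ 7 + q * + 4 * + 4)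
    ≡ + 16 * (sqr (+ 6 * x - 1ℤ) + + 4 * sqr (+ 3 * y - 1ℤ) + + 8 * sqr (+ 3 * z - 1ℤ) - (+ 3 * (+ 8 * q + + 4) + + 1))
  lem = solve-∀

p₈+p₈+2p₈+2p₈-0mod4 : ∀ q → ((1 , 8) ∷ (1 , 8) ∷ (2 , 8) ∷ (2 , 8) ∷ []) represents (0 ℕ.+ q ℕ.* 4)
p₈+p₈+2p₈+2p₈-0mod4 q = case three₆ q of λ (x , y , z , h) → class 0 q 4 (at ((x + x) ∷ (y + y) ∷ z ∷ z ∷ []) (+ 8) h (lem x y z (+ q)))
  where
  lem : ∀ x y z q → let s₈ = λ (x : ℤ) → + 8 * ((+ 3 * x - 1ℤ) * (+ 3 * x - 1ℤ)) - + 8 in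
    + 1 * s₈ (x + x) + (+ 1 * s₈ (y + y) + (+ 2 * s₈ z + (+ 2 * s₈ z + 0ℤ))) - + 24 * (+ 0 + q * + 4)
    ≡ + 8 * ((+ 6 * x - 1ℤ) * (+ 6 * x - 1ℤ) + (+ 6 * y - 1ℤ) * (+ 6 * y - 1ℤ) + + 4 * ((+ 3 * z - 1ℤ) * (+ 3 * z - 1ℤ)) - (+ 3 * (+ 4 * q + + 2) + + 0))
  lem = solve-∀

-- These follow from X² + 2Y² = 3 (A² + 2B²) with A = (X + 2Y) / 3, B = (X - Y) / 3 and from 2 (s² + t²) = (s + t)² + (s - t)².

p₃+p₄ : Exchange (1 , 5) (2 , 5) (1 , 3) (1 , 4) 0
p₃+p₄ = record { first = λ x y → x + + 2 * y - 1ℤ ; second = λ x y → x - y ; preserves = lem }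
  where
  lem : ∀ x y → + 1 * (+ 12 * ((x + + 2 * y - 1ℤ) * (x + + 2 * y - 1ℤ)) + + 12 * (x + + 2 * y - 1ℤ)) + + 1 * (+ 24 * ((x - y) * (x - y)))
    ≡ + 24 * + 0 + (+ 1 * ((+ 6 * x - 1ℤ) * (+ 6 * x - 1ℤ) - 1ℤ) + + 2 * ((+ 6 * y - 1ℤ) * (+ 6 * y - 1ℤ) - 1ℤ))
  lem = solve-∀

2p₃+2p₄ : Exchange (2 , 5) (4 , 5) (2 , 3) (2 , 4) 0
2p₃+2p₄ = record { first = λ x y → x + + 2 * y - 1ℤ ; second = λ x y → x - y ; preserves = lem }
  where
  lem : ∀ x y → + 2 * (+ 12 * ((x + + 2 * y - 1ℤ) * (x + + 2 * y - 1ℤ)) + + 12 * (x + + 2 * y - 1ℤ)) + + 2 * (+ 24 * ((x - y) * (x - y)))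
    ≡ + 24 * + 0 + (+ 2 * ((+ 6 * x - 1ℤ) * (+ 6 * x - 1ℤ) - 1ℤ) + + 4 * ((+ 6 * y - 1ℤ) * (+ 6 * y - 1ℤ) - 1ℤ))
  lem = solve-∀

p₃+2p₃ : Exchange (1 , 5) (1 , 8) (1 , 3) (2 , 3) 0
p₃+2p₃ = record { first = λ x y → x - + 2 * y ; second = λ x y → x + y - 1ℤ ; preserves = lem }
  where
  lem : ∀ x y → + 1 * (+ 12 * ((x - + 2 * y) * (x - + 2 * y)) + + 12 * (x - + 2 * y)) + + 2 * (+ 12 * ((x + y - 1ℤ) * (x + y - 1ℤ)) + + 12 * (x + y - 1ℤ))
    ≡ + 24 * + 0 + (+ 1 * ((+ 6 * x - 1ℤ) * (+ 6 * x - 1ℤ) - 1ℤ) + + 1 * (+ 8 * ((+ 3 * y - 1ℤ) * (+ 3 * y - 1ℤ)) - + 8))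
  lem = solve-∀

2p₃+4p₃ : Exchange (2 , 5) (2 , 8) (2 , 3) (4 , 3) 0
2p₃+4p₃ = record { first = λ x y → x - + 2 * y ; second = λ x y → x + y - 1ℤ ; preserves = lem }
  where
  lem : ∀ x y → + 2 * (+ 12 * ((x - + 2 * y) * (x - + 2 * y)) + + 12 * (x - + 2 * y)) + + 4 * (+ 12 * ((x + y - 1ℤ) * (x + y - 1ℤ)) + + 12 * (x + y - 1ℤ))
    ≡ + 24 * + 0 + (+ 2 * ((+ 6 * x - 1ℤ) * (+ 6 * x - 1ℤ) - 1ℤ) + + 2 * (+ 8 * ((+ 3 * y - 1ℤ) * (+ 3 * y - 1ℤ)) - + 8))
  lem = solve-∀

3p₃+p₅ : Exchange (2 , 5) (1 , 8) (3 , 3) (1 , 5) 0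
3p₃+p₅ = record { first = λ x y → - x - y ; second = λ x y → y - x ; preserves = lem }
  where
  lem : ∀ x y → + 3 * (+ 12 * ((- x - y) * (- x - y)) + + 12 * (- x - y)) + + 1 * ((+ 6 * (y - x) - 1ℤ) * (+ 6 * (y - x) - 1ℤ) - 1ℤ)
    ≡ + 24 * + 0 + (+ 2 * ((+ 6 * x - 1ℤ) * (+ 6 * x - 1ℤ) - 1ℤ) + + 1 * (+ 8 * ((+ 3 * y - 1ℤ) * (+ 3 * y - 1ℤ)) - + 8))
  lem = solve-∀

6p₃+2p₅ : Exchange (4 , 5) (2 , 8) (6 , 3) (2 , 5) 0
6p₃+2p₅ = record { first = λ x y → - x - y ; second = λ x y → y - x ; preserves = lem }
  where
  lem : ∀ x y → + 6 * (+ 12 * ((- x - y) * (- x - y)) + + 12 * (- x - y)) + + 2 * ((+ 6 * (y - x) - 1ℤ) * (+ 6 * (y - x) - 1ℤ) - 1ℤ)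
    ≡ + 24 * + 0 + (+ 4 * ((+ 6 * x - 1ℤ) * (+ 6 * x - 1ℤ) - 1ℤ) + + 2 * (+ 8 * ((+ 3 * y - 1ℤ) * (+ 3 * y - 1ℤ)) - + 8))
  lem = solve-∀

-- Completing the square costs 8 per unit coefficient of p₈, so 32 for the old pair and 8 for the
-- new one; the difference 24 is the shift c = 1.
3p₄+p₈ : Exchange (2 , 8) (2 , 8) (3 , 4) (1 , 8) 1
3p₄+p₈ = record { first = λ x y → x - y ; second = λ x y → 1ℤ - x - y ; preserves = lem }
  where
  lem : ∀ x y → let s₈ = λ (x : ℤ) → + 8 * ((+ 3 * x - 1ℤ) * (+ 3 * x - 1ℤ)) - + 8 in + 3 * (+ 24 * ((x - y) * (x - y))) + + 1 * s₈ (1ℤ - x - y)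
    ≡ + 24 * + 1 + (+ 2 * s₈ x + + 2 * s₈ y)
  lem = solve-∀

-- From q to 2q + c or 4q + c by doubling variables

quadruple-3p₄+p₈+p₈+p₈ : ∀ {q} → ((3 , 4) ∷ (1 , 8) ∷ (1 , 8) ∷ (1 , 8) ∷ []) represents q → ((3 , 4) ∷ (1 , 8) ∷ (1 , 8) ∷ (1 , 8) ∷ []) represents (3 ℕ.+ q ℕ.* 4)
quadruple-3p₄+p₈+p₈+p₈ {q} (scale v) = case arguments v of λ (x , y , z , w , h) → class 3 q 4 (at ((x + x) ∷ (1ℤ - (y + y)) ∷ (1ℤ - (z + z)) ∷ (1ℤ - (w + w)) ∷ []) (+ 4) h (lem x y z w (+ q)))
  where
  lem : ∀ x y z w q → let s₈ = λ (x : ℤ) → + 8 * ((+ 3 * x - 1ℤ) * (+ 3 * x - 1ℤ)) - + 8 in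
    + 3 * (+ 24 * ((x + x) * (x + x))) + (+ 1 * s₈ (1ℤ - (y + y)) + (+ 1 * s₈ (1ℤ - (z + z)) + (+ 1 * s₈ (1ℤ - (w + w)) + 0ℤ))) - + 24 * (+ 3 + q * + 4)
    ≡ + 4 * (+ 3 * (+ 24 * (x * x)) + (+ 1 * s₈ y + (+ 1 * s₈ z + (+ 1 * s₈ w + 0ℤ))) - + 24 * q)
  lem = solve-∀

-- Multiply 9x² + y² + z² + w² = 3q + 3 by 4 and write 4(9x² + y²) as 2(y + 3x)² + 2(y - 3x)².
3p₄+p₈+p₈+p₈⇒p₈+p₈+2p₈+2p₈ : ∀ {q} → ((3 , 4) ∷ (1 , 8) ∷ (1 , 8) ∷ (1 , 8) ∷ []) represents q → ((1 , 8) ∷ (1 , 8) ∷ (2 , 8) ∷ (2 , 8) ∷ []) represents (2 ℕ.+ q ℕ.* 4)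
3p₄+p₈+p₈+p₈⇒p₈+p₈+2p₈+2p₈ {q} (scale v) = case arguments v of λ (x , y , z , w , h) → class 2 q 4 (at ((1ℤ - (z + z)) ∷ (1ℤ - (w + w)) ∷ (x + y) ∷ (y - x) ∷ []) (+ 4) h (lem x y z w (+ q)))
  where
  lem : ∀ x y z w q → let s₈ = λ (x : ℤ) → + 8 * ((+ 3 * x - 1ℤ) * (+ 3 * x - 1ℤ)) - + 8 in
    + 1 * s₈ (1ℤ - (z + z)) + (+ 1 * s₈ (1ℤ - (w + w)) + (+ 2 * s₈ (x + y) + (+ 2 * s₈ (y - x) + 0ℤ))) - + 24 * (+ 2 + q * + 4)
    ≡ + 4 * (+ 3 * (+ 24 * (x * x)) + (+ 1 * s₈ y + (+ 1 * s₈ z + (+ 1 * s₈ w + 0ℤ))) - + 24 * q)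
  lem = solve-∀

-- Multiply x² + y² + z² + 2w² = 3q + 5 by 2 and read 4w² as the square of an even variable.
p₈+p₈+p₈+2p₈⇒p₈+2p₈+2p₈+2p₈ : ∀ {q} → ((1 , 8) ∷ (1 , 8) ∷ (1 , 8) ∷ (2 , 8) ∷ []) represents q → ((1 , 8) ∷ (2 , 8) ∷ (2 , 8) ∷ (2 , 8) ∷ []) represents (1 ℕ.+ q ℕ.* 2)
p₈+p₈+p₈+2p₈⇒p₈+2p₈+2p₈+2p₈ {q} (scale v) = case arguments v of λ (x , y , z , w , h) → class 1 q 2 (at ((1ℤ - (w + w)) ∷ x ∷ y ∷ z ∷ []) (+ 2) h (lem x y z w (+ q)))
  where
  lem : ∀ x y z w q → let s₈ = λ (x : ℤ) → + 8 * ((+ 3 * x - 1ℤ) * (+ 3 * x - 1ℤ)) - + 8 in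
    + 1 * s₈ (1ℤ - (w + w)) + (+ 2 * s₈ x + (+ 2 * s₈ y + (+ 2 * s₈ z + 0ℤ))) - + 24 * (+ 1 + q * + 2)
    ≡ + 2 * (+ 1 * s₈ x + (+ 1 * s₈ y + (+ 1 * s₈ z + (+ 2 * s₈ w + 0ℤ))) - + 24 * q)
  lem = solve-∀

p₈+p₈+2p₈+3p₈⇒p₈+2p₈+2p₈+6p₈ : ∀ {q} → ((1 , 8) ∷ (1 , 8) ∷ (2 , 8) ∷ (3 , 8) ∷ []) represents q → ((1 , 8) ∷ (2 , 8) ∷ (2 , 8) ∷ (6 , 8) ∷ []) represents (1 ℕ.+ q ℕ.* 2)
p₈+p₈+2p₈+3p₈⇒p₈+2p₈+2p₈+6p₈ {q} (scale v) = case arguments v of λ (x , y , z , w , h) → class 1 q 2 (at ((1ℤ - (z + z)) ∷ x ∷ y ∷ w ∷ []) (+ 2) h (lem x y z w (+ q)))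
  where
  lem : ∀ x y z w q → let s₈ = λ (x : ℤ) → + 8 * ((+ 3 * x - 1ℤ) * (+ 3 * x - 1ℤ)) - + 8 in
    + 1 * s₈ (1ℤ - (z + z)) + (+ 2 * s₈ x + (+ 2 * s₈ y + (+ 6 * s₈ w + 0ℤ))) - + 24 * (+ 1 + q * + 2)
    ≡ + 2 * (+ 1 * s₈ x + (+ 1 * s₈ y + (+ 2 * s₈ z + (+ 3 * s₈ w + 0ℤ))) - + 24 * q)
  lem = solve-∀

3p₄+p₈+p₈+p₈⇒3p₄+p₈+p₈+4p₈ : ∀ {q} → ((3 , 4) ∷ (1 , 8) ∷ (1 , 8) ∷ (1 , 8) ∷ []) represents q → ((3 , 4) ∷ (1 , 8) ∷ (1 , 8) ∷ (4 , 8) ∷ []) represents (2 ℕ.+ q ℕ.* 4)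
3p₄+p₈+p₈+p₈⇒3p₄+p₈+p₈+4p₈ {q} (scale v) = case arguments v of λ (x , y , z , w , h) → class 2 q 4 (at ((x + x) ∷ (1ℤ - (y + y)) ∷ (1ℤ - (z + z)) ∷ w ∷ []) (+ 4) h (lem x y z w (+ q)))
  where
  lem : ∀ x y z w q → let s₈ = λ (x : ℤ) → + 8 * ((+ 3 * x - 1ℤ) * (+ 3 * x - 1ℤ)) - + 8 in
    + 3 * (+ 24 * ((x + x) * (x + x))) + (+ 1 * s₈ (1ℤ - (y + y)) + (+ 1 * s₈ (1ℤ - (z + z)) + (+ 4 * s₈ w + 0ℤ))) - + 24 * (+ 2 + q * + 4)
    ≡ + 4 * (+ 3 * (+ 24 * (x * x)) + (+ 1 * s₈ y + (+ 1 * s₈ z + (+ 1 * s₈ w + 0ℤ))) - + 24 * q)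
  lem = solve-∀

-- The completed equation is 9x² + y² + z² + 5w² = 3n + 7; doubling all variables takes n = q to 4q
-- + 7.
quadruple-3p₄+p₈+p₈+5p₈ : ∀ {q} → ((3 , 4) ∷ (1 , 8) ∷ (1 , 8) ∷ (5 , 8) ∷ []) represents q → ((3 , 4) ∷ (1 , 8) ∷ (1 , 8) ∷ (5 , 8) ∷ []) represents (7 ℕ.+ q ℕ.* 4)
quadruple-3p₄+p₈+p₈+5p₈ {q} (scale v) = case arguments v of λ (x , y , z , w , h) → class 7 q 4 (at ((x + x) ∷ (1ℤ - (y + y)) ∷ (1ℤ - (z + z)) ∷ (1ℤ - (w + w)) ∷ []) (+ 4) h (lem x y z w (+ q)))
  where
  lem : ∀ x y z w q → let s₈ = λ (x : ℤ) → + 8 * ((+ 3 * x - 1ℤ) * (+ 3 * x - 1ℤ)) - + 8 in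
    + 3 * (+ 24 * ((x + x) * (x + x))) + (+ 1 * s₈ (1ℤ - (y + y)) + (+ 1 * s₈ (1ℤ - (z + z)) + (+ 5 * s₈ (1ℤ - (w + w)) + 0ℤ))) - + 24 * (+ 7 + q * + 4)
    ≡ + 4 * (+ 3 * (+ 24 * (x * x)) + (+ 1 * s₈ y + (+ 1 * s₈ z + (+ 5 * s₈ w + 0ℤ))) - + 24 * q)
  lem = solve-∀

3p₄+p₈+p₈+5p₈⇒p₈+2p₈+2p₈+5p₈ : ∀ {q} → ((3 , 4) ∷ (1 , 8) ∷ (1 , 8) ∷ (5 , 8) ∷ []) represents q → ((1 , 8) ∷ (2 , 8) ∷ (2 , 8) ∷ (5 , 8) ∷ []) represents (6 ℕ.+ q ℕ.* 4)
3p₄+p₈+p₈+5p₈⇒p₈+2p₈+2p₈+5p₈ {q} (scale v) = case arguments v of λ (x , y , z , w , h) → class 6 q 4 (at ((1ℤ - (y + y)) ∷ (x + z) ∷ (z - x) ∷ (1ℤ - (w + w)) ∷ []) (+ 4) h (lem x y z w (+ q)))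
  where
  lem : ∀ x y z w q → let s₈ = λ (x : ℤ) → + 8 * ((+ 3 * x - 1ℤ) * (+ 3 * x - 1ℤ)) - + 8 in
    + 1 * s₈ (1ℤ - (y + y)) + (+ 2 * s₈ (x + z) + (+ 2 * s₈ (z - x) + (+ 5 * s₈ (1ℤ - (w + w)) + 0ℤ))) - + 24 * (+ 6 + q * + 4)
    ≡ + 4 * (+ 3 * (+ 24 * (x * x)) + (+ 1 * s₈ y + (+ 1 * s₈ z + (+ 5 * s₈ w + 0ℤ))) - + 24 * q)
  lem = solve-∀

-- Quaternary sums, one residue class at a time

4p₅+p₈+p₈+p₈ : ∀ n → ((4 , 5) ∷ (1 , 8) ∷ (1 , 8) ∷ (1 , 8) ∷ []) represents n
4p₅+p₈+p₈+p₈ = modulo 2 λ where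
  zero q → widen (4p₅+p₈+p₈-0mod2 q)
  (suc zero) q → widen (adjoin (1 , 8) (+ 1) 1 refl (4p₅+p₈+p₈-0mod2 q))

4p₅+p₈+p₈+3p₈ : ∀ n → ((4 , 5) ∷ (1 , 8) ∷ (1 , 8) ∷ (3 , 8) ∷ []) represents n
4p₅+p₈+p₈+3p₈ = modulo 2 λ where
  zero q → widen (4p₅+p₈+p₈-0mod2 q)
  -- An odd n is reduced by 3p₈(1) = 3, for which n = 1 is too small.
  (suc zero) zero → solution (+ 0) (+ 0) (+ 1) (+ 0) refl
  (suc zero) (suc q) → widen (adjoin (3 , 8) (+ 1) 3 refl (4p₅+p₈+p₈-0mod2 q))

4p₅+p₈+2p₈+2p₈ : ∀ n → ((4 , 5) ∷ (1 , 8) ∷ (2 , 8) ∷ (2 , 8) ∷ []) represents n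
4p₅+p₈+2p₈+2p₈ = modulo 2 λ where
  zero q → widen (4p₅+2p₈+2p₈-0mod2 q)
  (suc zero) q → widen (adjoin (1 , 8) (+ 1) 1 refl (4p₅+2p₈+2p₈-0mod2 q))

2p₅+p₈+2p₈+2p₈ : ∀ n → ((2 , 5) ∷ (1 , 8) ∷ (2 , 8) ∷ (2 , 8) ∷ []) represents n
2p₅+p₈+2p₈+2p₈ = modulo 2 λ where
  zero q → widen (2p₅+2p₈+2p₈-0mod2 q)
  (suc zero) q → widen (adjoin (1 , 8) (+ 1) 1 refl (2p₅+2p₈+2p₈-0mod2 q))

2p₅+p₈+2p₈+3p₈ : ∀ n → ((2 , 5) ∷ (1 , 8) ∷ (2 , 8) ∷ (3 , 8) ∷ []) represents n
2p₅+p₈+2p₈+3p₈ = modulo 2 λ where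
  zero q → widen (2p₅+p₈+2p₈-0mod2 q)
  (suc zero) zero → solution (+ 0) (+ 1) (+ 0) (+ 0) refl
  (suc zero) (suc q) → widen (adjoin (3 , 8) (+ 1) 3 refl (2p₅+p₈+2p₈-0mod2 q))

4p₅+p₈+p₈+2p₈ : ∀ n → ((4 , 5) ∷ (1 , 8) ∷ (1 , 8) ∷ (2 , 8) ∷ []) represents n
4p₅+p₈+p₈+2p₈ = modulo 4 λ where
  zero q → widen (4p₅+p₈+2p₈-0mod4 q)
  (suc zero) q → widen (4p₅+p₈+2p₈-1mod4 q)
  (suc (suc zero)) q → widen (4p₅+p₈+2p₈-2mod4 q)
  (suc (suc (suc zero))) q → widen (adjoin (1 , 8) (+ 1) 1 refl (4p₅+p₈+2p₈-2mod4 q))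

4p₅+p₈+2p₈+3p₈ : ∀ n → ((4 , 5) ∷ (1 , 8) ∷ (2 , 8) ∷ (3 , 8) ∷ []) represents n
4p₅+p₈+2p₈+3p₈ = modulo 4 λ where
  zero q → widen (4p₅+p₈+2p₈-0mod4 q)
  (suc zero) q → widen (4p₅+p₈+2p₈-1mod4 q)
  (suc (suc zero)) q → widen (4p₅+p₈+2p₈-2mod4 q)
  (suc (suc (suc zero))) q → widen (adjoin (3 , 8) (+ 1) 3 refl (4p₅+p₈+2p₈-0mod4 q))

4p₅+p₈+2p₈+5p₈ : ∀ n → ((4 , 5) ∷ (1 , 8) ∷ (2 , 8) ∷ (5 , 8) ∷ []) represents n
4p₅+p₈+2p₈+5p₈ = modulo 4 λ where
  zero q → widen (4p₅+p₈+2p₈-0mod4 q)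
  (suc zero) q → widen (4p₅+p₈+2p₈-1mod4 q)
  (suc (suc zero)) q → widen (4p₅+p₈+2p₈-2mod4 q)
  (suc (suc (suc zero))) zero → solution (+ 0) (+ 1) (+ 1) (+ 0) refl
  (suc (suc (suc zero))) (suc q) → widen (adjoin (5 , 8) (+ 1) 5 refl (4p₅+p₈+2p₈-2mod4 q))

4p₅+p₈+2p₈+6p₈ : ∀ n → ((4 , 5) ∷ (1 , 8) ∷ (2 , 8) ∷ (6 , 8) ∷ []) represents n
4p₅+p₈+2p₈+6p₈ = modulo 4 λ where
  zero q → widen (4p₅+p₈+2p₈-0mod4 q)
  (suc zero) q → widen (4p₅+p₈+2p₈-1mod4 q)
  (suc (suc zero)) q → widen (4p₅+p₈+2p₈-2mod4 q)
  (suc (suc (suc zero))) zero → solution (+ 0) (+ 1) (+ 1) (+ 0) refl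
  (suc (suc (suc zero))) (suc q) → widen (adjoin (6 , 8) (+ 1) 6 refl (4p₅+p₈+2p₈-1mod4 q))

6p₃+2p₅+p₈+4p₈ : ∀ n → ((6 , 3) ∷ (2 , 5) ∷ (1 , 8) ∷ (4 , 8) ∷ []) represents n
6p₃+2p₅+p₈+4p₈ = modulo 4 λ where
  zero q → exchange 6p₃+2p₅ (4p₅+p₈+2p₈-0mod4 q)
  (suc zero) q → exchange 6p₃+2p₅ (4p₅+p₈+2p₈-1mod4 q)
  (suc (suc zero)) q → exchange 6p₃+2p₅ (4p₅+p₈+2p₈-2mod4 q)
  (suc (suc (suc zero))) q → exchange 6p₃+2p₅ (adjoin (2 , 8) (+ 1) 2 refl (4p₅+p₈+4p₈-1mod4 q))

3p₄+2p₅+p₈+p₈ : ∀ n → ((3 , 4) ∷ (2 , 5) ∷ (1 , 8) ∷ (1 , 8) ∷ []) represents n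
3p₄+2p₅+p₈+p₈ = modulo 4 λ where
  zero q → widen (3p₄+p₈+p₈-0mod4 q)
  (suc zero) q → widen (3p₄+p₈+p₈-1mod4 q)
  (suc (suc zero)) q → widen (adjoin (2 , 5) (+ 1) 2 refl (3p₄+p₈+p₈-0mod4 q))
  (suc (suc (suc zero))) q → widen (adjoin (2 , 5) (+ 1) 2 refl (3p₄+p₈+p₈-1mod4 q))

3p₄+p₈+p₈+2p₈ : ∀ n → ((3 , 4) ∷ (1 , 8) ∷ (1 , 8) ∷ (2 , 8) ∷ []) represents n
3p₄+p₈+p₈+2p₈ = modulo 4 λ where
  zero q → widen (3p₄+p₈+p₈-0mod4 q)
  (suc zero) q → widen (3p₄+p₈+p₈-1mod4 q)
  (suc (suc zero)) q → widen (adjoin (2 , 8) (+ 1) 2 refl (3p₄+p₈+p₈-0mod4 q))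
  (suc (suc (suc zero))) q → widen (adjoin (2 , 8) (+ 1) 2 refl (3p₄+p₈+p₈-1mod4 q))

-- For n ≡ 3 modulo 4 the completed value 3n + 3 is a multiple of 4, and the class is reduced to the
-- smaller (n - 3)/4.
3p₄+p₈+p₈+p₈ : ∀ n → ((3 , 4) ∷ (1 , 8) ∷ (1 , 8) ∷ (1 , 8) ∷ []) represents n
3p₄+p₈+p₈+p₈ = descent 4 λ where
  zero q _ → widen (3p₄+p₈+p₈-0mod4 q)
  (suc zero) q _ → widen (p₈+p₈+p₈-1mod4 q)
  (suc (suc zero)) q _ → widen (p₈+p₈+p₈-2mod4 q)
  (suc (suc (suc zero))) q ih → quadruple-3p₄+p₈+p₈+p₈ (ih (s≤s (ℕₚ.≤-trans (ℕₚ.m≤m*n q 4) (ℕₚ.m≤n+m _ 2))))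

3p₄+p₈+p₈+4p₈ : ∀ n → ((3 , 4) ∷ (1 , 8) ∷ (1 , 8) ∷ (4 , 8) ∷ []) represents n
3p₄+p₈+p₈+4p₈ = modulo 4 λ where
  zero q → widen (3p₄+p₈+p₈-0mod4 q)
  (suc zero) q → widen (3p₄+p₈+p₈-1mod4 q)
  (suc (suc zero)) q → 3p₄+p₈+p₈+p₈⇒3p₄+p₈+p₈+4p₈ (3p₄+p₈+p₈+p₈ q)
  (suc (suc (suc zero))) q → widen (adjoin (3 , 4) (+ 1) 3 refl (p₈+p₈+4p₈-0mod4 q))

3p₄+p₈+p₈+5p₈ : ∀ n → ((3 , 4) ∷ (1 , 8) ∷ (1 , 8) ∷ (5 , 8) ∷ []) represents n
3p₄+p₈+p₈+5p₈ = descent 4 λ where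
  zero q _ → widen (3p₄+p₈+p₈-0mod4 q)
  (suc zero) q _ → widen (3p₄+p₈+p₈-1mod4 q)
  (suc (suc zero)) zero _ → solution (+ 0) (+ 1) (+ 1) (+ 0) refl
  (suc (suc zero)) (suc q) _ → widen (adjoin (5 , 8) (+ 1) 5 refl (3p₄+p₈+p₈-1mod4 q))
  (suc (suc (suc zero))) zero _ → solution -[1+ 0 ] (+ 0) (+ 0) (+ 0) refl
  (suc (suc (suc zero))) (suc q) ih → quadruple-3p₄+p₈+p₈+5p₈ (ih (s≤s (ℕₚ.≤-trans (ℕₚ.m≤m*n q 4) (ℕₚ.m≤n+m _ 6))))

p₈+p₈+p₈+2p₈ : ∀ n → ((1 , 8) ∷ (1 , 8) ∷ (1 , 8) ∷ (2 , 8) ∷ []) represents n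
p₈+p₈+p₈+2p₈ = modulo 4 λ where
  zero zero → solution (+ 0) (+ 0) (+ 0) (+ 0) refl
  zero (suc q) → widen (adjoin (2 , 8) (+ 1) 2 refl (p₈+p₈+p₈-2mod4 q))
  (suc zero) q → widen (p₈+p₈+p₈-1mod4 q)
  (suc (suc zero)) q → widen (p₈+p₈+p₈-2mod4 q)
  (suc (suc (suc zero))) q → widen (adjoin (2 , 8) (+ 1) 2 refl (p₈+p₈+p₈-1mod4 q))

p₈+2p₈+2p₈+2p₈ : ∀ n → ((1 , 8) ∷ (2 , 8) ∷ (2 , 8) ∷ (2 , 8) ∷ []) represents n
p₈+2p₈+2p₈+2p₈ = modulo 4 λ where
  zero q → widen (p₈+2p₈+2p₈-0mod4 q)
  (suc zero) q → cast (cong suc (ℕₚ.*-assoc q 2 2)) (p₈+p₈+p₈+2p₈⇒p₈+2p₈+2p₈+2p₈ (p₈+p₈+p₈+2p₈ (q ℕ.* 2)))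
  (suc (suc zero)) q → widen (adjoin (2 , 8) (+ 1) 2 refl (p₈+2p₈+2p₈-0mod4 q))
  (suc (suc (suc zero))) q → cast (cong (λ n → 3 ℕ.+ n) (ℕₚ.*-assoc q 2 2)) (p₈+p₈+p₈+2p₈⇒p₈+2p₈+2p₈+2p₈ (p₈+p₈+p₈+2p₈ (suc (q ℕ.* 2))))

p₈+p₈+2p₈+2p₈ : ∀ n → ((1 , 8) ∷ (1 , 8) ∷ (2 , 8) ∷ (2 , 8) ∷ []) represents n
p₈+p₈+2p₈+2p₈ = modulo 4 λ where
  zero q → p₈+p₈+2p₈+2p₈-0mod4 q
  (suc zero) q → widen (p₈+p₈+2p₈-1mod4 q)
  (suc (suc zero)) q → 3p₄+p₈+p₈+p₈⇒p₈+p₈+2p₈+2p₈ (3p₄+p₈+p₈+p₈ q)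
  (suc (suc (suc zero))) q → widen (adjoin (2 , 8) (+ 1) 2 refl (p₈+p₈+2p₈-1mod4 q))

p₈+p₈+2p₈+3p₈ : ∀ n → ((1 , 8) ∷ (1 , 8) ∷ (2 , 8) ∷ (3 , 8) ∷ []) represents n
p₈+p₈+2p₈+3p₈ = modulo 4 λ where
  zero q → modulo 2 {λ q → _ represents (0 ℕ.+ q ℕ.* 4)} (λ where
    zero q → widen (p₈+p₈+2p₈-0mod8 q)
    (suc zero) q → widen (adjoin (3 , 8) (+ 1) 3 refl (p₈+p₈+2p₈-1mod4 (q ℕ.* 2)))) q
  (suc zero) q → widen (p₈+p₈+2p₈-1mod4 q)
  (suc (suc zero)) q → modulo 2 {λ q → _ represents (2 ℕ.+ q ℕ.* 4)} (λ where
    zero q → widen (p₈+p₈+2p₈-2mod8 q)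
    (suc zero) q → widen (adjoin (3 , 8) (+ 1) 3 refl (p₈+p₈+2p₈-3mod8 q))) q
  (suc (suc (suc zero))) q → modulo 2 {λ q → _ represents (3 ℕ.+ q ℕ.* 4)} (λ where
    zero q → widen (p₈+p₈+2p₈-3mod8 q)
    -- On the class 7 modulo 8, 3p₈(-1) = 15 leaves a multiple of 8; n = 7 is too small for it.
    (suc zero) zero → solution (+ 0) -[1+ 0 ] (+ 1) (+ 0) refl
    (suc zero) (suc q) → widen (adjoin (3 , 8) -[1+ 0 ] 15 refl (p₈+p₈+2p₈-0mod8 q))) q

p₈+2p₈+2p₈+6p₈ : ∀ n → ((1 , 8) ∷ (2 , 8) ∷ (2 , 8) ∷ (6 , 8) ∷ []) represents n
p₈+2p₈+2p₈+6p₈ = modulo 4 λ where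
  zero q → widen (p₈+2p₈+2p₈-0mod4 q)
  (suc zero) q → cast (cong suc (ℕₚ.*-assoc q 2 2)) (p₈+p₈+2p₈+3p₈⇒p₈+2p₈+2p₈+6p₈ (p₈+p₈+2p₈+3p₈ (q ℕ.* 2)))
  (suc (suc zero)) zero → solution (+ 0) (+ 0) (+ 1) (+ 0) refl
  (suc (suc zero)) (suc q) → widen (adjoin (6 , 8) (+ 1) 6 refl (p₈+2p₈+2p₈-0mod4 q))
  (suc (suc (suc zero))) q → cast (cong (λ n → 3 ℕ.+ n) (ℕₚ.*-assoc q 2 2)) (p₈+p₈+2p₈+3p₈⇒p₈+2p₈+2p₈+6p₈ (p₈+p₈+2p₈+3p₈ (suc (q ℕ.* 2))))

p₈+2p₈+2p₈+3p₈ : ∀ n → ((1 , 8) ∷ (2 , 8) ∷ (2 , 8) ∷ (3 , 8) ∷ []) represents n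
p₈+2p₈+2p₈+3p₈ = modulo 4 λ where
  zero q → widen (p₈+2p₈+2p₈-0mod4 q)
  (suc zero) q → modulo 4 {λ q → _ represents (1 ℕ.+ q ℕ.* 4)} (λ where
    zero q → widen (p₈+2p₈+2p₈-1mod16 q)
    (suc zero) q → widen (p₈+2p₈+2p₈-5mod16 q)
    -- From 9 and 13 modulo 16, 3p₈(2) = 24 leads to the known classes 1 and 5; n = 9 and n = 13 are
    -- too small.
    (suc (suc zero)) zero → solution -[1+ 0 ] (+ 1) (+ 1) (+ 0) refl
    (suc (suc zero)) (suc q) → widen (adjoin (3 , 8) (+ 2) 24 refl (p₈+2p₈+2p₈-1mod16 q))
    (suc (suc (suc zero))) zero → solution (+ 0) (+ 0) -[1+ 0 ] (+ 1) refl
    (suc (suc (suc zero))) (suc q) → widen (adjoin (3 , 8) (+ 2) 24 refl (p₈+2p₈+2p₈-5mod16 q))) q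
  (suc (suc zero)) q → modulo 4 {λ q → _ represents (2 ℕ.+ q ℕ.* 4)} (λ where
    -- From 2 and 10 modulo 16, 3p₈(-1) = 15 leads to 3 and 11; from 6 and 14, 3p₈(1) = 3 does.
    zero zero → solution (+ 0) (+ 0) (+ 1) (+ 0) refl
    zero (suc q) → widen (adjoin (3 , 8) -[1+ 0 ] 15 refl (p₈+2p₈+2p₈-3mod16 q))
    (suc zero) q → widen (adjoin (3 , 8) (+ 1) 3 refl (p₈+2p₈+2p₈-3mod16 q))
    (suc (suc zero)) zero → solution (+ 0) (+ 0) -[1+ 0 ] (+ 0) refl
    (suc (suc zero)) (suc q) → widen (adjoin (3 , 8) -[1+ 0 ] 15 refl (p₈+2p₈+2p₈-11mod16 q))
    (suc (suc (suc zero))) q → widen (adjoin (3 , 8) (+ 1) 3 refl (p₈+2p₈+2p₈-11mod16 q))) q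
  (suc (suc (suc zero))) q → widen (adjoin (3 , 8) (+ 1) 3 refl (p₈+2p₈+2p₈-0mod4 q))

p₈+2p₈+2p₈+5p₈ : ∀ n → ((1 , 8) ∷ (2 , 8) ∷ (2 , 8) ∷ (5 , 8) ∷ []) represents n
p₈+2p₈+2p₈+5p₈ = modulo 4 λ where
  zero q → widen (p₈+2p₈+2p₈-0mod4 q)
  (suc zero) zero → solution (+ 1) (+ 0) (+ 0) (+ 0) refl
  (suc zero) (suc q) → widen (adjoin (5 , 8) (+ 1) 5 refl (p₈+2p₈+2p₈-0mod4 q))
  (suc (suc zero)) zero → solution (+ 0) (+ 0) (+ 1) (+ 0) refl
  (suc (suc zero)) (suc q) → 3p₄+p₈+p₈+5p₈⇒p₈+2p₈+2p₈+5p₈ (3p₄+p₈+p₈+5p₈ q)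
  (suc (suc (suc zero))) q → modulo 4 {λ q → _ represents (3 ℕ.+ q ℕ.* 4)} (λ where
    zero q → widen (p₈+2p₈+2p₈-3mod16 q)
    (suc zero) q → widen (p₈+2p₈+2p₈-7mod16 q)
    (suc (suc zero)) q → widen (p₈+2p₈+2p₈-11mod16 q)
    -- From 15 modulo 16, 5p₈(2) = 40 leads to 7; n = 15 and n = 31 are too small.
    (suc (suc (suc zero))) zero → solution (+ 0) (+ 0) -[1+ 0 ] (+ 1) refl
    (suc (suc (suc zero))) (suc zero) → solution (+ 0) -[1+ 0 ] (+ 2) (+ 1) refl
    (suc (suc (suc zero))) (suc (suc q)) → widen (adjoin (5 , 8) (+ 2) 40 refl (p₈+2p₈+2p₈-7mod16 q))) q

3p₄+p₈+p₈+3p₈ : ∀ n → ((3 , 4) ∷ (1 , 8) ∷ (1 , 8) ∷ (3 , 8) ∷ []) represents n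
-- The exchange raises the value by 1, so 0 needs its own case.
3p₄+p₈+p₈+3p₈ zero = widen {[]} (scale [])
3p₄+p₈+p₈+3p₈ (suc n) = exchange 3p₄+p₈ (p₈+2p₈+2p₈+3p₈ n)

3p₄+p₈+p₈+6p₈ : ∀ n → ((3 , 4) ∷ (1 , 8) ∷ (1 , 8) ∷ (6 , 8) ∷ []) represents n
3p₄+p₈+p₈+6p₈ zero = widen {[]} (scale [])
3p₄+p₈+p₈+6p₈ (suc n) = exchange 3p₄+p₈ (p₈+2p₈+2p₈+6p₈ n)

-- From values scaled by 24 back to polygonal numbers

data Gonal : ℕ → Set where
  instance
    gon₃ : Gonal 3
    gon₄ : Gonal 4
    gon₅ : Gonal 5
    gon₈ : Gonal 8

half-exact : ∀ k {a} → a ≡ d k → a /ℕ 2 ≡ k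
half-exact k {a} refl = go (a %ℕ 2) (a /ℕ 2) (n%ℕd<d a 2) (a≡a%ℕn+[a/ℕn]*n a 2)
  where
  lem₀ : ∀ q → + 0 + q * + 2 ≡ + 2 * q
  lem₀ = solve-∀
  lem₁ : ∀ q → + 1 + q * + 2 ≡ q + q + 1ℤ
  lem₁ = solve-∀
  twice : ∀ k → k + k ≡ + 2 * k
  twice = solve-∀
  go : ∀ r q → r ℕ.< 2 → d k ≡ + r + q * + 2 → q ≡ k
  go 0 q _ e = sym (ℤₚ.*-cancelˡ-≡ (+ 2) k q (trans (sym (twice k)) (trans e (lem₀ q))))
  go 1 q _ e = ⊥-elim (even≢odd {k} {q} (trans e (lem₁ q)))
  go (suc (suc _)) q (s≤s (s≤s ())) _

pronic : ∀ x → ∃[ k ] x * x + x ≡ d k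
pronic x = go (parityℤ x)
  where
  lem₀ : ∀ k → (k + k) * (k + k) + (k + k) ≡ k * (k + k) + k + (k * (k + k) + k)
  lem₀ = solve-∀
  lem₁ : ∀ k → (k + k + 1ℤ) * (k + k + 1ℤ) + (k + k + 1ℤ) ≡ (k + k + 1ℤ) * (k + 1ℤ) + (k + k + 1ℤ) * (k + 1ℤ)
  lem₁ = solve-∀
  go : ∀ {x} → ℤParity x → ∃[ k ] x * x + x ≡ d k
  go (evenℤ k) = k * (k + k) + k , lem₀ k
  go (oddℤ k)  = (k + k + 1ℤ) * (k + 1ℤ) , lem₁ k

p-double : ∀ {r} → Gonal r → ∀ x → + 2 * p r x ≡ (+ r - + 2) * (x * x) - (+ r - + 4) * x
p-double g x = let k , e = halved g in trans (cong (_*_ (+ 2)) (half-exact k e)) (trans (twice k) (sym e))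
  where
  twice : ∀ k → + 2 * k ≡ k + k
  twice = solve-∀
  lem₃ : ∀ x → 1ℤ * (x * x) - -1ℤ * x ≡ x * x + x
  lem₃ = solve-∀
  lem₄ : ∀ x → + 2 * (x * x) - 0ℤ * x ≡ x * x + x * x
  lem₄ = solve-∀
  lem₅ : ∀ x → + 3 * (x * x) - 1ℤ * x ≡ x * x + x + (x * x - x + (x * x - x))
  lem₅ = solve-∀
  lem₅′ : ∀ k z → k + k + (z + z) ≡ k + z + (k + z)
  lem₅′ = solve-∀
  lem₈ : ∀ x → + 6 * (x * x) - + 4 * x ≡ + 3 * (x * x) - + 2 * x + (+ 3 * (x * x) - + 2 * x)
  lem₈ = solve-∀
  halved : ∀ {r} → Gonal r → ∃[ k ] (+ r - + 2) * (x * x) - (+ r - + 4) * x ≡ d k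
  halved gon₃ = let k , e = pronic x in k , trans (lem₃ x) e
  halved gon₄ = x * x , lem₄ x
  halved gon₅ = let k , e = pronic x ; z = x * x - x in k + z , trans (lem₅ x) (trans (cong (_+ (z + z)) e) (lem₅′ k z))
  halved gon₈ = + 3 * (x * x) - + 2 * x , lem₈ x

p-scaled : ∀ {r} → Gonal r → ∀ x → + 24 * p r x ≡ scaled r x
p-scaled {r} g x = trans (twelve (p r x)) (trans (cong (_*_ (+ 12)) (p-double g x)) (expand g))
  where
  twelve : ∀ y → + 24 * y ≡ + 12 * (+ 2 * y)
  twelve = solve-∀
  lem₃ : ∀ x → + 12 * (1ℤ * (x * x) - -1ℤ * x) ≡ + 12 * (x * x) + + 12 * x
  lem₃ = solve-∀
  lem₄ : ∀ x → + 12 * (+ 2 * (x * x) - 0ℤ * x) ≡ + 24 * (x * x)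
  lem₄ = solve-∀
  lem₅ : ∀ x → + 12 * (+ 3 * (x * x) - 1ℤ * x) ≡ (+ 6 * x - 1ℤ) * (+ 6 * x - 1ℤ) - 1ℤ
  lem₅ = solve-∀
  lem₈ : ∀ x → + 12 * (+ 6 * (x * x) - + 4 * x) ≡ + 8 * ((+ 3 * x - 1ℤ) * (+ 3 * x - 1ℤ)) - + 8
  lem₈ = solve-∀
  expand : ∀ {r} → Gonal r → + 12 * ((+ r - + 2) * (x * x) - (+ r - + 4) * x) ≡ scaled r x
  expand gon₃ = lem₃ x
  expand gon₄ = lem₄ x
  expand gon₅ = lem₅ x
  expand gon₈ = lem₈ x

-- Except for r = 4 the quadratic is negative between its roots, where no integer lies. Setting x =
-- n + 1 and x = -1 - n makes every factor visibly nonnegative.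
scaled-nonneg : ∀ {r} → Gonal r → ∀ x → 0ℤ ≤ scaled r x
scaled-nonneg g (+ zero) = at-zero g
  where
  at-zero : ∀ {r} → Gonal r → 0ℤ ≤ scaled r 0ℤ
  at-zero gon₃ = ℤₚ.≤-refl
  at-zero gon₄ = ℤₚ.≤-refl
  at-zero gon₅ = ℤₚ.≤-refl
  at-zero gon₈ = ℤₚ.≤-refl
scaled-nonneg g (+ suc n) = subst (0ℤ ≤_) (sym (positive g)) (+≤+ z≤n)
  where
  lem₃ : ∀ n → + 12 * ((1ℤ + n) * (1ℤ + n)) + + 12 * (1ℤ + n) ≡ + 12 * ((1ℤ + n) * (+ 2 + n))
  lem₃ = solve-∀
  lem₅ : ∀ n → (+ 6 * (1ℤ + n) - 1ℤ) * (+ 6 * (1ℤ + n) - 1ℤ) - 1ℤ ≡ + 12 * ((1ℤ + n) * (+ 2 + (n + n + n)))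
  lem₅ = solve-∀
  lem₈ : ∀ n → + 8 * ((+ 3 * (1ℤ + n) - 1ℤ) * (+ 3 * (1ℤ + n) - 1ℤ)) - + 8 ≡ + 24 * ((1ℤ + n) * (1ℤ + (n + n + n)))
  lem₈ = solve-∀
  bound : ∀ {r} → Gonal r → ℕ
  bound gon₃ = 12 ℕ.* (suc n ℕ.* (2 ℕ.+ n))
  bound gon₄ = 24 ℕ.* (suc n ℕ.* suc n)
  bound gon₅ = 12 ℕ.* (suc n ℕ.* (2 ℕ.+ (n ℕ.+ n ℕ.+ n)))
  bound gon₈ = 24 ℕ.* (suc n ℕ.* (1 ℕ.+ (n ℕ.+ n ℕ.+ n)))
  positive : ∀ {r} (g : Gonal r) → scaled r (+ suc n) ≡ + bound g
  positive gon₃ = lem₃ (+ n)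
  positive gon₄ = refl
  positive gon₅ = lem₅ (+ n)
  positive gon₈ = lem₈ (+ n)
scaled-nonneg g -[1+ n ] = subst (0ℤ ≤_) (sym (positive g)) (+≤+ z≤n)
  where
  lem₃ : ∀ n → + 12 * (- (1ℤ + n) * - (1ℤ + n)) + + 12 * - (1ℤ + n) ≡ + 12 * ((1ℤ + n) * n)
  lem₃ = solve-∀
  lem₅ : ∀ n → (+ 6 * - (1ℤ + n) - 1ℤ) * (+ 6 * - (1ℤ + n) - 1ℤ) - 1ℤ ≡ + 12 * ((1ℤ + n) * (+ 4 + (n + n + n)))
  lem₅ = solve-∀
  lem₈ : ∀ n → + 8 * ((+ 3 * - (1ℤ + n) - 1ℤ) * (+ 3 * - (1ℤ + n) - 1ℤ)) - + 8 ≡ + 24 * ((1ℤ + n) * (+ 5 + (n + n + n)))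
  lem₈ = solve-∀
  bound : ∀ {r} → Gonal r → ℕ
  bound gon₃ = 12 ℕ.* (suc n ℕ.* n)
  bound gon₄ = 24 ℕ.* (suc n ℕ.* suc n)
  bound gon₅ = 12 ℕ.* (suc n ℕ.* (4 ℕ.+ (n ℕ.+ n ℕ.+ n)))
  bound gon₈ = 24 ℕ.* (suc n ℕ.* (5 ℕ.+ (n ℕ.+ n ℕ.+ n)))
  positive : ∀ {r} (g : Gonal r) → scaled r -[1+ n ] ≡ + bound g
  positive gon₃ = trans (lem₃ (+ n)) (trans (cong (_*_ (+ 12)) (sym (ℤₚ.pos-* (suc n) n))) (sym (ℤₚ.pos-* 12 (suc n ℕ.* n))))
  positive gon₄ = refl
  positive gon₅ = lem₅ (+ n)
  positive gon₈ = lem₈ (+ n)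

data Exhaustive : Form → Set where
  exhaustive : ∀ {a r b s c t e u} {{_ : Gonal r}} {{_ : Gonal s}} {{_ : Gonal t}} {{_ : Gonal u}} →
    (∀ n → ((a , r) ∷ (b , s) ∷ (c , t) ∷ (e , u) ∷ []) represents n) → Exhaustive ((a , r) ∷ (b , s) ∷ (c , t) ∷ (e , u) ∷ [])

universal : ∀ {F} → Exhaustive F → Universal F
universal (exhaustive {a} {r} {b} {s} {c} {t} {e} {u} {{gr}} {{gs}} {{gt}} {{gu}} all) =
  (λ h l m n → nonneg (sum≥0 (sum≥0 (sum≥0 (⟦⟧≥0 a gr h) (⟦⟧≥0 b gs l)) (⟦⟧≥0 c gt m)) (⟦⟧≥0 e gu n)) (scaled-eval h l m n)) ,
  λ N → let h , l , m , n , eq = arguments (value (all N)) in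
    h , l , m , n , ℤₚ.*-cancelˡ-≡ (+ 24) _ (+ N) (trans (scaled-eval h l m n) (trans (assoc (⟦ a , r ⟧ h) (⟦ b , s ⟧ l) (⟦ c , t ⟧ m) (⟦ e , u ⟧ n)) eq))
  where
  F : Form
  F = (a , r) ∷ (b , s) ∷ (c , t) ∷ (e , u) ∷ []
  distrib : ∀ a b c e h l m n → + 24 * (a * h + b * l + c * m + e * n) ≡ a * (+ 24 * h) + b * (+ 24 * l) + c * (+ 24 * m) + e * (+ 24 * n)
  distrib = solve-∀
  assoc : ∀ a b c e → a + b + c + e ≡ a + (b + (c + (e + 0ℤ)))
  assoc = solve-∀
  scaled-eval : ∀ h l m n → + 24 * eval F h l m n ≡ ⟦ a , r ⟧ h + ⟦ b , s ⟧ l + ⟦ c , t ⟧ m + ⟦ e , u ⟧ n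
  scaled-eval h l m n = trans (distrib (+ a) (+ b) (+ c) (+ e) (p r h) (p s l) (p t m) (p u n))
    (cong₂ _+_ (cong₃ (λ x y z → + a * x + + b * y + + c * z) (p-scaled gr h) (p-scaled gs l) (p-scaled gt m)) (cong (_*_ (+ e)) (p-scaled gu n)))
  ⟦⟧≥0 : ∀ a {r} → Gonal r → ∀ x → 0ℤ ≤ ⟦ a , r ⟧ x
  ⟦⟧≥0 a {r} g x = subst (_≤ ⟦ a , r ⟧ x) (ℤₚ.*-zeroʳ (+ a)) (ℤₚ.*-monoˡ-≤-nonNeg (+ a) (scaled-nonneg g x))
  sum≥0 : ∀ {x y} → 0ℤ ≤ x → 0ℤ ≤ y → 0ℤ ≤ x + y
  sum≥0 = ℤₚ.+-mono-≤
  nonneg : ∀ {x y} → 0ℤ ≤ y → + 24 * x ≡ y → 0ℤ ≤ x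
  nonneg {x} 0≤y eq = ℤₚ.*-cancelˡ-≤-pos 0ℤ x (+ 24) (subst (0ℤ ≤_) (sym eq) 0≤y)

forms-exhaustive : All Exhaustive theorem3p1-forms
forms-exhaustive =
  exhaustive (λ n → widen (2p₅+4p₅+p₈ n)) ∷
  exhaustive 4p₅+p₈+p₈+p₈ ∷
  exhaustive (λ n → widen (2p₅+p₈+p₈ n)) ∷
  exhaustive p₈+p₈+p₈+2p₈ ∷
  exhaustive 4p₅+p₈+2p₈+2p₈ ∷
  exhaustive p₈+2p₈+2p₈+2p₈ ∷
  exhaustive (λ n → widen (3p₄+p₅+p₈ n)) ∷
  exhaustive (λ n → widen (6p₃+p₅+2p₅ n)) ∷
  exhaustive (λ n → widen (3p₄+p₅+p₈ n)) ∷
  exhaustive (λ n → widen (6p₃+p₅+2p₅ n)) ∷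
  exhaustive 3p₄+2p₅+p₈+p₈ ∷
  exhaustive 3p₄+p₈+p₈+p₈ ∷
  exhaustive (λ n → widen (2p₅+2p₅+p₈ n)) ∷
  exhaustive (λ n → widen (2p₅+p₈+p₈ n)) ∷
  exhaustive (λ n → exchange 3p₃+p₅ (p₅+2p₅+4p₅ n)) ∷
  exhaustive (λ n → exchange 3p₃+p₅ (p₅+2p₅+2p₈ n)) ∷
  exhaustive (λ n → widen (3p₄+p₅+p₈ n)) ∷
  exhaustive (λ n → widen (6p₃+p₅+2p₅ n)) ∷
  exhaustive 3p₄+p₈+p₈+2p₈ ∷
  exhaustive (λ n → exchange 6p₃+2p₅ (4p₅+p₈+2p₈+2p₈ n)) ∷
  exhaustive (λ n → exchange 3p₃+p₅ (2p₅+4p₅+p₈ n)) ∷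
  exhaustive (λ n → exchange 3p₃+p₅ (2p₅+p₈+p₈ n)) ∷
  exhaustive (λ n → exchange p₃+p₄ (3p₄+p₅+p₈ n)) ∷
  exhaustive (λ n → exchange p₃+p₄ (6p₃+p₅+2p₅ n)) ∷
  exhaustive (λ n → exchange p₃+2p₃ (3p₄+p₅+p₈ n)) ∷
  exhaustive (λ n → exchange p₃+p₄ (6p₃+p₅+2p₅ n)) ∷
  exhaustive (λ n → widen (2p₅+4p₅+p₈ n)) ∷
  exhaustive 4p₅+p₈+p₈+2p₈ ∷
  exhaustive 2p₅+p₈+2p₈+2p₈ ∷
  exhaustive p₈+p₈+2p₈+2p₈ ∷
  exhaustive (λ n → widen (p₅+2p₅+4p₅ n)) ∷
  exhaustive (λ n → widen (p₅+2p₅+2p₈ n)) ∷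
  exhaustive (λ n → widen (p₅+p₈+p₈ n)) ∷
  exhaustive (λ n → widen (p₅+p₈+p₈ n)) ∷
  exhaustive (λ n → exchange p₃+p₄ (p₅+2p₅+4p₅ n)) ∷
  exhaustive (λ n → exchange p₃+p₄ (p₅+2p₅+2p₈ n)) ∷
  exhaustive (λ n → exchange p₃+2p₃ (p₅+2p₅+4p₅ n)) ∷
  exhaustive (λ n → exchange p₃+2p₃ (p₅+2p₅+2p₈ n)) ∷
  exhaustive (λ n → exchange 2p₃+2p₄ (p₅+2p₅+4p₅ n)) ∷
  exhaustive (λ n → exchange 2p₃+4p₃ (p₅+2p₅+2p₈ n)) ∷
  exhaustive (λ n → widen (p₃+2p₅+4p₅ n)) ∷
  exhaustive (λ n → widen (p₃+2p₅+2p₈ n)) ∷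
  exhaustive (λ n → widen (2p₅+4p₅+p₈ n)) ∷
  exhaustive 4p₅+p₈+p₈+3p₈ ∷
  exhaustive 2p₅+p₈+2p₈+3p₈ ∷
  exhaustive p₈+p₈+2p₈+3p₈ ∷
  exhaustive 4p₅+p₈+2p₈+6p₈ ∷
  exhaustive p₈+2p₈+2p₈+6p₈ ∷
  exhaustive 3p₄+p₈+p₈+3p₈ ∷
  exhaustive (λ n → exchange 6p₃+2p₅ (4p₅+p₈+2p₈+3p₈ n)) ∷
  exhaustive 3p₄+p₈+p₈+4p₈ ∷
  exhaustive 6p₃+2p₅+p₈+4p₈ ∷
  exhaustive (λ n → exchange 3p₃+p₅ (2p₅+4p₅+p₈ n)) ∷
  exhaustive (λ n → exchange 3p₃+p₅ (2p₅+p₈+2p₈+2p₈ n)) ∷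
  exhaustive 3p₄+p₈+p₈+5p₈ ∷
  exhaustive (λ n → exchange 6p₃+2p₅ (4p₅+p₈+2p₈+5p₈ n)) ∷
  exhaustive 3p₄+p₈+p₈+6p₈ ∷
  exhaustive (λ n → exchange 6p₃+2p₅ (4p₅+p₈+2p₈+6p₈ n)) ∷
  exhaustive (λ n → exchange 3p₃+p₅ (2p₅+4p₅+p₈ n)) ∷
  exhaustive (λ n → exchange 3p₃+p₅ (2p₅+p₈+2p₈+3p₈ n)) ∷
  exhaustive 4p₅+p₈+2p₈+3p₈ ∷
  exhaustive p₈+2p₈+2p₈+3p₈ ∷
  exhaustive 4p₅+p₈+2p₈+5p₈ ∷
  exhaustive p₈+2p₈+2p₈+5p₈ ∷
  exhaustive (λ n → exchange 2p₃+2p₄ (2p₅+4p₅+p₈ n)) ∷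
  exhaustive (λ n → exchange 2p₃+4p₃ (2p₅+p₈+2p₈+3p₈ n)) ∷
  []

theorem3p1 : All Universal theorem3p1-forms
theorem3p1 = All.map universal forms-exhaustive
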